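{- Let $n \geq 2^{19}$ and let $t$ be an integer with $1 < t \leq \frac{n}{4032 \log_2 n}$. Let $\mathcal{F}$ be a $t$-intersecting family of labelled spanning trees of the complete graph $K_n$. Then \[ |\mathcal{F}| \leq 2^t n^{n-t-2}. \] Moreover, equality holds if and only if $\mathcal{F}$ consists of all spanning trees of $K_n$ containing a fixed set of $t$ pairwise disjoint edges.
   Context: A spanning tree of $K_n$ (on vertex set $[n]=\{1,\dots,n\}$) is identified with its edge set, a subset of $\binom{[n]}{2}$ of size $n-1$. Two spanning trees are $t$-intersecting if they share at least $t$ edges; a family of spanning trees is $t$-intersecting if every two of its members are $t$-intersecting. -}

module Defs where

open import Data.Nat using (ℕ; zero; suc; _+_; _*_; _∸_; _^_; _≤_; _<_)
open import Data.Fin using (Fin) renaming (_<_ to _<ᶠ_)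
open import Data.Fin.Subset using (Subset; _∈_; _⊆_; ∣_∣) renaming (_∩_ to _∩ˢ_)
open import Data.Vec using (Vec; lookup; zipWith; foldr)
open import Data.List using (List; length)
open import Data.List.Membership.Propositional renaming (_∈_ to _∈ₗ_)
open import Data.List.Relation.Unary.Unique.Propositional using (Unique)
open import Data.Product using (_×_; Σ)
open import Data.Sum using (_⊎_)
open import Relation.Binary.PropositionalEquality using (_≡_; _≢_)

-- An edge set of K_n, i.e. a subset of binom([n],2).
-- Row i of the vector records the set of j such that the edge {i,j} with i < j is present.
-- (Well-formedness, i.e. only entries with i < j are set, is the predicate WF below.)
-- This gives a canonical representation, so equality of edge sets is propositional equality.
EdgeSet : ℕ → Set
EdgeSet n = Vec (Subset n) n

HasEdge : ∀ {n} → EdgeSet n → Fin n → Fin n → Set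
HasEdge E i j = j ∈ lookup E i

WF : ∀ {n} → EdgeSet n → Set
WF {n} E = (i j : Fin n) → HasEdge E i j → i <ᶠ j

numEdges : ∀ {n} → EdgeSet n → ℕ
numEdges E = foldr (λ _ → ℕ) (λ s acc → ∣ s ∣ + acc) 0 E

_∩E_ : ∀ {n} → EdgeSet n → EdgeSet n → EdgeSet n
E ∩E F = zipWith _∩ˢ_ E F

_⊆E_ : ∀ {n} → EdgeSet n → EdgeSet n → Set
_⊆E_ {n} E F = (i : Fin n) → lookup E i ⊆ lookup F i

Adj : ∀ {n} → EdgeSet n → Fin n → Fin n → Set
Adj E u v = HasEdge E u v ⊎ HasEdge E v u

data Walk {n : ℕ} (E : EdgeSet n) : Fin n → Fin n → Set where
  here : ∀ {u} → Walk E u u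
  step : ∀ {u w v} → Adj E u w → Walk E w v → Walk E u v

Connected : ∀ {n} → EdgeSet n → Set
Connected {n} E = (u v : Fin n) → Walk E u v

IsSpanningTree : ∀ {n} → EdgeSet n → Set
IsSpanningTree {n} E = WF E × (numEdges E ≡ n ∸ 1) × Connected E

TIntersecting : ℕ → ∀ {n} → EdgeSet n → EdgeSet n → Set
TIntersecting t E F = t ≤ numEdges (E ∩E F)

IsTIntersectingTreeFamily : ℕ → ∀ {n} → List (EdgeSet n) → Set
IsTIntersectingTreeFamily t {n} 𝓕 =
  Unique 𝓕
  × ((T : EdgeSet n) → T ∈ₗ 𝓕 → IsSpanningTree T)
  × ((T T′ : EdgeSet n) → T ∈ₗ 𝓕 → T′ ∈ₗ 𝓕 → T ≢ T′ → TIntersecting t T T′)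

PairwiseDisjoint : ∀ {n} → EdgeSet n → Set
PairwiseDisjoint {n} S =
  (a b c d : Fin n) → HasEdge S a b → HasEdge S c d →
  (a ≡ c × b ≡ d) ⊎ (a ≢ c × a ≢ d × b ≢ c × b ≢ d)

module Submission where

-- Call a family of edge sets spread if at most a proportion (4/n)^|X| of it contains any given
-- set X.  By the minimal fragment argument of Park and Pham, applied in two rounds, a random
-- colour class contains a member of a spread family with probability above 1/2, so two spread
-- families have disjoint members.  Splitting off, again and again, the members that contain a
-- largest set S lying in a proportion at least (4/n)^|S| of them writes a t-intersecting family
-- F, up to a remainder of relative size 2^-q with q = n / 128, as a union of families that are
-- spread above small sets S; these cores S then pairwise t-intersect.  Shrinking the cores layer
-- by layer as long as they remain t-intersecting, either all of them contain a common B of size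
-- t, or F has at most about half of the claimed size.
--
-- The number of trees containing a forest with component sizes s₁, …, s_c is n^(c-2) s₁ ⋯ s_c;
-- among forests with t edges it is largest, 2^t n^(n-t-2), for matchings.  If B is a matching
-- and some T₀ in F does not contain B, then F misses every tree that contains B and meets T₀ in
-- fewer than t edges.  By edge switchings there are more of these than members in the remainder.

open import Defs
open import Data.Nat hiding (∣_-_∣)
open import Data.Nat.DivMod using (_/_; _%_; m/n*n≤m; m≡m%n+[m/n]*n; m%n<n; /-monoˡ-≤)
open import Data.Nat.Properties
open import Data.Nat.Tactic.RingSolver using (solve-∀)
open import Data.Bool using (Bool; true; false; if_then_else_; not)
import Data.Bool as Bool
open import Data.Empty using (⊥-elim)
open import Data.Fin using (Fin; zero; suc; combine; remQuot; fromℕ<; toℕ)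
  renaming (_≟_ to _≟ᶠ_; _<_ to _<ᶠ_; _<?_ to _<ᶠ?_)
import Data.Fin.Properties as Fin
open import Data.Fin.Properties using (combine-injective; combine-surjective; remQuot-combine; combine-remQuot)
  renaming (any? to anyᶠ?; all? to allᶠ?)
open import Data.Fin.Subset hiding (⊤) renaming (_∈_ to _∈ˢ_; _∉_ to _∉ˢ_)
open import Data.Fin.Subset.Properties
open import Data.List using (List; []; _∷_; _++_; length; map; filter; allFin; concatMap; cartesianProductWith; upTo)
import Data.List.Properties as List
open import Data.List.Membership.Propositional using (_∈_; find; lose)
open import Data.List.Membership.Propositional.Properties
  using (∈-∃++; ∈-++⁺ˡ; ∈-++⁺ʳ; ∈-++⁻; ∈-map⁺; ∈-map⁻; ∈-filter⁺; ∈-filter⁻; ∈-allFin; ∈-upTo⁺; ∈-upTo⁻; ∈-cartesianProductWith⁺)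
open import Data.List.Relation.Unary.All as All using (All; []; _∷_; all?)
open import Data.List.Relation.Unary.All.Properties using (¬All⇒Any¬)
open import Data.List.Relation.Unary.AllPairs using ([]; _∷_)
open import Data.List.Relation.Unary.Any as Any using (Any; here; there; any?)
open import Data.List.Relation.Unary.Unique.Propositional using (Unique)
import Data.List.Relation.Unary.Unique.Propositional.Properties as Unique
open import Data.Product using (_×_; _,_; Σ; ∃; proj₁; proj₂)
open import Data.Sum as Sum using (_⊎_; inj₁; inj₂; [_,_]′; swap)
open import Data.Vec as Vec using (Vec; []; _∷_; here; there; concat; lookup; zipWith)
import Data.Vec.Properties as Vec
open import Function using (_∘_; id)
open import Function.Bundles using (_⇔_; mk⇔; Equivalence)
open import Relation.Binary using (DecidableEquality; tri<; tri≈; tri>)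
open import Relation.Binary.PropositionalEquality hiding ([_]; resp)
open import Relation.Nullary
open import Relation.Nullary.Decidable using (_×-dec_; _⊎-dec_; decidable-stable)
open import Relation.Unary using (Decidable)

-- All trees together are already spread with 2 in place of 4: a set X lies in at most a proportion
-- (2/n)^|X| of the n^(n-2) trees. So when a set S is dense at rate 4/n in what is left of F, what
-- is left is at most 2^-|S| of all trees, and peeling can stop once |S| > q. That remainder must be
-- negligible against n^(n-t-2), and at the very end even against n^-37 times that number. Both
-- follow from n^(37+t) ≤ 2^q, and this is where the bound on t log n comes from.
--
-- Two rounds are needed because a tree has n - 1 edges: only fragments with fewer than 56 edges,
-- which the first round leaves, can be weighted heavily enough to be made empty in the second.
--
-- The condition t > 1 enters when T₀ is disjoint from B. A star at one vertex meets every spanning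
-- tree, so a tree cannot be asked to avoid T₀; it can be asked to avoid all but one edge of T₀, and
-- 1 < t.
--
-- Probabilities are counts over all colourings with four colours, and inequalities are cleared of
-- denominators, so the arithmetic stays in the natural numbers.

private
  variable
    A B : Set
    P Q : Set
    n N : ℕ

-- Exponential estimates in integers

-- Bernoulli's inequality (1 - d/(a+d))^l ≥ 1 - l d/(a+d), multiplied by (a+d)^(l+1).
bernoulli : ∀ a d l → (a + d) ^ l * (a + d) ≤ a ^ l * (a + d) + l * d * (a + d) ^ l
bernoulli a d zero = ≤-reflexive (sym (+-identityʳ _))
bernoulli a d (suc l) = begin
  (a + d) * (a + d) ^ l * (a + d)  ≡⟨ split a d ((a + d) ^ l) ⟩
  a * ((a + d) ^ l * (a + d)) + d * ((a + d) * (a + d) ^ l)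
    ≤⟨ +-monoˡ-≤ _ (*-monoʳ-≤ a (bernoulli a d l)) ⟩
  a * (a ^ l * (a + d) + l * d * (a + d) ^ l) + d * ((a + d) * (a + d) ^ l)
    ≤⟨ m≤m+n _ (d * (l * d * (a + d) ^ l)) ⟩
  a * (a ^ l * (a + d) + l * d * (a + d) ^ l) + d * ((a + d) * (a + d) ^ l) + d * (l * d * (a + d) ^ l)
    ≡⟨ join a d l (a ^ l) ((a + d) ^ l) ⟩
  a * a ^ l * (a + d) + (d + l * d) * ((a + d) * (a + d) ^ l)  ∎
  where
  open ≤-Reasoning
  split : ∀ a d x → (a + d) * x * (a + d) ≡ a * (x * (a + d)) + d * ((a + d) * x)
  split = solve-∀
  join : ∀ a d l y x → a * (y * (a + d) + l * d * x) + d * ((a + d) * x) + d * (l * d * x)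
                     ≡ a * y * (a + d) + (d + l * d) * ((a + d) * x)
  join = solve-∀

-- By Bernoulli, (a/(a+d))^l is at least 1 - l d/(a+d), which is at least 1/2.
[a+d]^l≤2a^l : ∀ a d l → 0 < a → 2 * (l * d) ≤ a + d → (a + d) ^ l ≤ 2 * a ^ l
[a+d]^l≤2a^l a@(suc _) d l _ small = *-cancelʳ-≤ _ _ (a + d) (+-cancelˡ-≤ (X * (a + d)) _ _ (begin
  X * (a + d) + X * (a + d)  ≡⟨ double X (a + d) ⟩
  2 * (X * (a + d))  ≤⟨ *-monoʳ-≤ 2 (bernoulli a d l) ⟩
  2 * (Y * (a + d) + l * d * X)  ≡⟨ shuffle Y (a + d) (l * d) X ⟩
  2 * (l * d) * X + 2 * Y * (a + d)  ≤⟨ +-monoˡ-≤ _ (*-monoˡ-≤ X small) ⟩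
  (a + d) * X + 2 * Y * (a + d)  ≡⟨ cong (_+ 2 * Y * (a + d)) (*-comm (a + d) X) ⟩
  X * (a + d) + 2 * Y * (a + d)  ∎))
  where
  open ≤-Reasoning
  X = (a + d) ^ l
  Y = a ^ l
  double : ∀ x m → x * m + x * m ≡ 2 * (x * m)
  double = solve-∀
  shuffle : ∀ y m e x → 2 * (y * m + e * x) ≡ 2 * e * x + 2 * y * m
  shuffle = solve-∀

-- An integer substitute for (1 + 1/m)^s ≤ e. The previous bound reaches only exponents up to
-- (m+1)/2, so s is split into two halves, each costing a factor 2.
[1+m]^s≤4m^s : ∀ m s → 0 < m → s ≤ m → suc m ^ s ≤ 4 * m ^ s
[1+m]^s≤4m^s m s 0<m s≤m = begin
  suc m ^ s  ≡⟨ cong (suc m ^_) (sym (⌊n/2⌋+⌈n/2⌉≡n s)) ⟩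
  suc m ^ (⌊ s /2⌋ + ⌈ s /2⌉)  ≡⟨ ^-distribˡ-+-* (suc m) ⌊ s /2⌋ ⌈ s /2⌉ ⟩
  suc m ^ ⌊ s /2⌋ * suc m ^ ⌈ s /2⌉
    ≤⟨ *-mono-≤ (half ⌊ s /2⌋ (≤-trans (⌊n/2⌋-mono (n≤1+n s)) ≤-refl)) (half ⌈ s /2⌉ ≤-refl) ⟩
  2 * m ^ ⌊ s /2⌋ * (2 * m ^ ⌈ s /2⌉)  ≡⟨ four (m ^ ⌊ s /2⌋) (m ^ ⌈ s /2⌉) ⟩
  4 * (m ^ ⌊ s /2⌋ * m ^ ⌈ s /2⌉)  ≡⟨ cong (4 *_) (sym (^-distribˡ-+-* m ⌊ s /2⌋ ⌈ s /2⌉)) ⟩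
  4 * m ^ (⌊ s /2⌋ + ⌈ s /2⌉)  ≡⟨ cong (λ k → 4 * m ^ k) (⌊n/2⌋+⌈n/2⌉≡n s) ⟩
  4 * m ^ s  ∎
  where
  open ≤-Reasoning
  four : ∀ x y → 2 * x * (2 * y) ≡ 4 * (x * y)
  four = solve-∀
  twice : ∀ h → 2 * (h * 1) ≡ h + h
  twice = solve-∀
  half : ∀ h → h ≤ ⌈ s /2⌉ → suc m ^ h ≤ 2 * m ^ h
  half h h≤ = subst (λ k → k ^ h ≤ 2 * m ^ h) (+-comm m 1) ([a+d]^l≤2a^l m 1 h 0<m (begin
    2 * (h * 1)  ≡⟨ twice h ⟩
    h + h  ≤⟨ +-mono-≤ h≤ h≤ ⟩
    ⌈ s /2⌉ + ⌈ s /2⌉  ≤⟨ +-monoʳ-≤ ⌈ s /2⌉ (⌊n/2⌋≤⌈n/2⌉ (suc s)) ⟩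
    ⌊ suc s /2⌋ + ⌈ suc s /2⌉  ≡⟨ ⌊n/2⌋+⌈n/2⌉≡n (suc s) ⟩
    suc s  ≤⟨ s≤s s≤m ⟩
    suc m  ≡⟨ +-comm 1 m ⟩
    m + 1  ∎))

-- Stands in for (1 + j/s)^s ≤ e^j; the base is raised one unit at a time.
[s+j]^s≤4^j*s^s : ∀ s j → 0 < s → (s + j) ^ s ≤ 4 ^ j * s ^ s
[s+j]^s≤4^j*s^s s zero 0<s = ≤-reflexive (trans (cong (_^ s) (+-identityʳ s)) (sym (+-identityʳ _)))
[s+j]^s≤4^j*s^s s (suc j) 0<s = begin
  (s + suc j) ^ s  ≡⟨ cong (_^ s) (+-suc s j) ⟩
  suc (s + j) ^ s  ≤⟨ [1+m]^s≤4m^s (s + j) s (≤-trans 0<s (m≤m+n s j)) (m≤m+n s j) ⟩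
  4 * (s + j) ^ s  ≤⟨ *-monoʳ-≤ 4 ([s+j]^s≤4^j*s^s s j 0<s) ⟩
  4 * (4 ^ j * s ^ s)  ≡⟨ sym (*-assoc 4 (4 ^ j) (s ^ s)) ⟩
  4 ^ suc j * s ^ s  ∎
  where open ≤-Reasoning

^-cancelˡ-≤ : ∀ a b m → 0 < m → a ^ m ≤ b ^ m → a ≤ b
^-cancelˡ-≤ a b (suc m) _ le with a ≤? b
... | yes a≤b = a≤b
... | no a≰b = ⊥-elim (<⇒≱ (^-monoˡ-< (suc m) (≰⇒> a≰b)) le)

^-distribʳ-* : ∀ o m n → (m * n) ^ o ≡ m ^ o * n ^ o
^-distribʳ-* zero m n = refl
^-distribʳ-* (suc o) m n = trans (cong (m * n *_) (^-distribʳ-* o m n)) (lem m n (m ^ o) (n ^ o))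
  where
  lem : ∀ m n x y → m * n * (x * y) ≡ m * x * (n * y)
  lem = solve-∀

-- Sums over lists and finite sets

𝟙 : Dec P → ℕ
𝟙 (yes _) = 1
𝟙 (no _)  = 0

𝟙-yes : (d : Dec P) → P → 𝟙 d ≡ 1
𝟙-yes (yes _) p = refl
𝟙-yes (no ¬p) p = ⊥-elim (¬p p)

𝟙-no : (d : Dec P) → ¬ P → 𝟙 d ≡ 0
𝟙-no (yes p) ¬p = ⊥-elim (¬p p)
𝟙-no (no _) ¬p = refl

𝟙≤1 : (d : Dec P) → 𝟙 d ≤ 1
𝟙≤1 (yes _) = ≤-refl
𝟙≤1 (no _) = z≤n

𝟙-mono : (d : Dec P) (e : Dec Q) → (P → Q) → 𝟙 d ≤ 𝟙 e
𝟙-mono (yes p) e f = ≤-reflexive (sym (𝟙-yes e (f p)))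
𝟙-mono (no _) e f = z≤n

𝟙-cong : (d : Dec P) (e : Dec Q) → (P → Q) → (Q → P) → 𝟙 d ≡ 𝟙 e
𝟙-cong d e f g = ≤-antisym (𝟙-mono d e f) (𝟙-mono e d g)

𝟙-¬ : (d : Dec P) → 𝟙 d + 𝟙 (¬? d) ≡ 1
𝟙-¬ (yes _) = refl
𝟙-¬ (no _) = refl

𝟙-× : (d : Dec P) (e : Dec Q) → 𝟙 (d ×-dec e) ≡ 𝟙 d * 𝟙 e
𝟙-× (yes _) (yes _) = refl
𝟙-× (yes _) (no _) = refl
𝟙-× (no _) e = refl

𝟙*-mono : (d : Dec P) {a b : ℕ} → (P → a ≤ b) → 𝟙 d * a ≤ 𝟙 d * b
𝟙*-mono (yes p) f = *-monoʳ-≤ 1 (f p)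
𝟙*-mono (no _) f = z≤n

𝟙*-cong : (d : Dec P) {a b : ℕ} → (P → a ≡ b) → 𝟙 d * a ≡ 𝟙 d * b
𝟙*-cong (yes p) f = cong (1 *_) (f p)
𝟙*-cong (no _) f = refl

𝟙*≤ : (d : Dec P) (a : ℕ) → 𝟙 d * a ≤ a
𝟙*≤ (yes p) a = ≤-reflexive (+-identityʳ a)
𝟙*≤ (no _) a = z≤n

𝟙≤ : (d : Dec P) {a : ℕ} → (P → 1 ≤ a) → 𝟙 d ≤ a
𝟙≤ (yes p) f = f p
𝟙≤ (no _) f = z≤n

𝟙>0⇒ : (d : Dec P) → 0 < 𝟙 d → P
𝟙>0⇒ (yes p) _ = p

∑ : List A → (A → ℕ) → ℕ
∑ [] f = 0
∑ (x ∷ xs) f = f x + ∑ xs f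

∑-mono-∈ : ∀ (xs : List A) {f g : A → ℕ} → (∀ {x} → x ∈ xs → f x ≤ g x) → ∑ xs f ≤ ∑ xs g
∑-mono-∈ [] h = z≤n
∑-mono-∈ (x ∷ xs) h = +-mono-≤ (h (here refl)) (∑-mono-∈ xs (h ∘ there))

∑-mono : ∀ (xs : List A) {f g : A → ℕ} → (∀ x → f x ≤ g x) → ∑ xs f ≤ ∑ xs g
∑-mono xs h = ∑-mono-∈ xs (λ {x} _ → h x)

∑-cong-∈ : ∀ (xs : List A) {f g : A → ℕ} → (∀ {x} → x ∈ xs → f x ≡ g x) → ∑ xs f ≡ ∑ xs g
∑-cong-∈ [] h = refl
∑-cong-∈ (x ∷ xs) h = cong₂ _+_ (h (here refl)) (∑-cong-∈ xs (h ∘ there))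

∑-cong : ∀ (xs : List A) {f g : A → ℕ} → (∀ x → f x ≡ g x) → ∑ xs f ≡ ∑ xs g
∑-cong xs h = ∑-cong-∈ xs (λ {x} _ → h x)

∑-+ : ∀ (xs : List A) (f g : A → ℕ) → ∑ xs (λ x → f x + g x) ≡ ∑ xs f + ∑ xs g
∑-+ [] f g = refl
∑-+ (x ∷ xs) f g = trans (cong (f x + g x +_) (∑-+ xs f g)) (lem (f x) (g x) (∑ xs f) (∑ xs g))
  where
  lem : ∀ a b c d → a + b + (c + d) ≡ a + c + (b + d)
  lem = solve-∀

∑-*ˡ : ∀ (xs : List A) c (f : A → ℕ) → ∑ xs (λ x → c * f x) ≡ c * ∑ xs f
∑-*ˡ [] c f = sym (*-zeroʳ c)
∑-*ˡ (x ∷ xs) c f = trans (cong (c * f x +_) (∑-*ˡ xs c f)) (sym (*-distribˡ-+ c (f x) (∑ xs f)))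

∑-*ʳ : ∀ (xs : List A) c (f : A → ℕ) → ∑ xs (λ x → f x * c) ≡ ∑ xs f * c
∑-*ʳ xs c f = trans (∑-cong xs (λ x → *-comm (f x) c)) (trans (∑-*ˡ xs c f) (*-comm c _))

∑-0 : ∀ (xs : List A) → ∑ xs (λ _ → 0) ≡ 0
∑-0 [] = refl
∑-0 (x ∷ xs) = ∑-0 xs

∑-swap : ∀ (xs : List A) (ys : List B) (f : A → B → ℕ) →
  ∑ xs (λ x → ∑ ys (f x)) ≡ ∑ ys (λ y → ∑ xs (λ x → f x y))
∑-swap [] ys f = sym (∑-0 ys)
∑-swap (x ∷ xs) ys f = trans (cong (∑ ys (f x) +_) (∑-swap xs ys f)) (sym (∑-+ ys _ _))

∑-const : ∀ (xs : List A) c → ∑ xs (λ _ → c) ≡ length xs * c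
∑-const [] c = refl
∑-const (x ∷ xs) c = cong (c +_) (∑-const xs c)

∑-1 : ∀ (xs : List A) → ∑ xs (λ _ → 1) ≡ length xs
∑-1 xs = trans (∑-const xs 1) (*-identityʳ _)

∑-++ : ∀ (xs ys : List A) f → ∑ (xs ++ ys) f ≡ ∑ xs f + ∑ ys f
∑-++ [] ys f = refl
∑-++ (x ∷ xs) ys f = trans (cong (f x +_) (∑-++ xs ys f)) (sym (+-assoc (f x) _ _))

∑-map : ∀ (g : A → B) xs f → ∑ (map g xs) f ≡ ∑ xs (f ∘ g)
∑-map g [] f = refl
∑-map g (x ∷ xs) f = cong (f (g x) +_) (∑-map g xs f)

∑-filter : ∀ {P : A → Set} (P? : Decidable P) xs f → ∑ (filter P? xs) f ≡ ∑ xs (λ x → 𝟙 (P? x) * f x)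
∑-filter P? [] f = refl
∑-filter P? (x ∷ xs) f with P? x
... | yes _ = cong₂ _+_ (sym (+-identityʳ (f x))) (∑-filter P? xs f)
... | no  _ = ∑-filter P? xs f

∑-∈ : ∀ {xs : List A} {x} f → x ∈ xs → f x ≤ ∑ xs f
∑-∈ f (here refl) = m≤m+n _ _
∑-∈ f (there x∈) = ≤-trans (∑-∈ f x∈) (m≤n+m _ _)

∑-witness : ∀ (xs : List A) (f g : A → ℕ) → ∑ xs f < ∑ xs g → ∃ λ x → x ∈ xs × f x < g x
∑-witness (x ∷ xs) f g lt with f x <? g x
... | yes p = x , here refl , p
... | no ¬p = let y , y∈ , q = ∑-witness xs f g (+-cancelˡ-< (g x) _ _
                    (≤-<-trans (+-monoˡ-≤ _ (≮⇒≥ ¬p)) lt)) in y , there y∈ , q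

∑-witness₀ : ∀ (xs : List A) (f : A → ℕ) → 0 < ∑ xs f → ∃ λ x → x ∈ xs × 0 < f x
∑-witness₀ xs f lt = ∑-witness xs (λ _ → 0) f (subst (_< ∑ xs f) (sym (∑-0 xs)) lt)

∑-⊆ : ∀ {xs ys : List A} f → Unique xs → (∀ {x} → x ∈ xs → x ∈ ys) → ∑ xs f ≤ ∑ ys f
∑-⊆ {xs = []} f u h = z≤n
∑-⊆ {xs = x ∷ xs} {ys} f (x∉ ∷ u) h with ∈-∃++ (h (here refl))
... | as , bs , refl = begin
  f x + ∑ xs f  ≤⟨ +-monoʳ-≤ (f x) (∑-⊆ f u sub) ⟩
  f x + ∑ (as ++ bs) f  ≡⟨ cong (f x +_) (∑-++ as bs f) ⟩
  f x + (∑ as f + ∑ bs f)  ≡⟨ lem (f x) (∑ as f) (∑ bs f) ⟩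
  ∑ as f + (f x + ∑ bs f)  ≡⟨ sym (∑-++ as (x ∷ bs) f) ⟩
  ∑ (as ++ x ∷ bs) f  ∎
  where
  open ≤-Reasoning
  lem : ∀ a b c → a + (b + c) ≡ b + (a + c)
  lem = solve-∀
  sub : ∀ {y} → y ∈ xs → y ∈ as ++ bs
  sub y∈ with ∈-++⁻ as (h (there y∈))
  ... | inj₁ p = ∈-++⁺ˡ p
  ... | inj₂ (here refl) = ⊥-elim (All.lookup x∉ y∈ refl)
  ... | inj₂ (there p) = ∈-++⁺ʳ as p

∑-unique≤1 : ∀ (_≟_ : DecidableEquality A) {xs} → Unique xs → ∀ a → ∑ xs (λ x → 𝟙 (a ≟ x)) ≤ 1
∑-unique≤1 _≟_ [] a = z≤n
∑-unique≤1 _≟_ {x ∷ xs} (x∉ ∷ u) a with a ≟ x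
... | no _ = ∑-unique≤1 _≟_ u a
... | yes refl = ≤-reflexive (cong suc (trans (∑-cong-∈ xs (λ {y} y∈ → 𝟙-no (a ≟ y) (All.lookup x∉ y∈))) (∑-0 xs)))

∑-collapse : ∀ (_≟_ : DecidableEquality A) {xs} → Unique xs → ∀ {a} → a ∈ xs → (f : A → ℕ) →
  ∑ xs (λ x → 𝟙 (a ≟ x) * f x) ≡ f a
∑-collapse _≟_ {xs} u {a} a∈ f = begin
  ∑ xs (λ x → 𝟙 (a ≟ x) * f x)  ≡⟨ ∑-cong xs (λ x → 𝟙*-cong (a ≟ x) (λ a≡x → cong f (sym a≡x))) ⟩
  ∑ xs (λ x → 𝟙 (a ≟ x) * f a)  ≡⟨ ∑-*ʳ xs (f a) _ ⟩
  ∑ xs (λ x → 𝟙 (a ≟ x)) * f a  ≡⟨ cong (_* f a) (≤-antisym (∑-unique≤1 _≟_ u a)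
      (subst (_≤ ∑ xs (λ x → 𝟙 (a ≟ x))) (𝟙-yes (a ≟ a) refl) (∑-∈ (λ x → 𝟙 (a ≟ x)) a∈))) ⟩
  1 * f a  ≡⟨ +-identityʳ (f a) ⟩
  f a  ∎
  where open ≡-Reasoning

argmin : ∀ {P : A → Set} (P? : Decidable P) (f : A → ℕ) xs → Any P xs →
  ∃ λ x → x ∈ xs × P x × (∀ {y} → y ∈ xs → P y → f x ≤ f y)
argmin {A = A} {P} P? f (x ∷ xs) ex with any? P? xs
argmin P? f (x ∷ xs) (here px) | no ¬any = x , here refl , px , λ where
  (here refl) _ → ≤-refl
  (there y∈) py → ⊥-elim (¬any (lose y∈ py))
argmin P? f (x ∷ xs) (there ex) | no ¬any = ⊥-elim (¬any ex)
argmin P? f (x ∷ xs) _ | yes ex with argmin P? f xs ex | P? x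
... | m , m∈ , pm , least | no ¬px = m , there m∈ , pm , λ where
  (here refl) px → ⊥-elim (¬px px)
  (there y∈) py → least y∈ py
... | m , m∈ , pm , least | yes px with f m ≤? f x
... | yes m≤x = m , there m∈ , pm , λ where
  (here refl) _ → m≤x
  (there y∈) py → least y∈ py
... | no m≰x = x , here refl , px , λ where
  (here refl) _ → ≤-refl
  (there y∈) py → ≤-trans (<⇒≤ (≰⇒> m≰x)) (least y∈ py)

argmax : ∀ {P : A → Set} (P? : Decidable P) (f : A → ℕ) b xs → (∀ x → f x ≤ b) → Any P xs →
  ∃ λ x → x ∈ xs × P x × (∀ {y} → y ∈ xs → P y → f y ≤ f x)
argmax P? f b xs bd ex with argmin P? (λ x → b ∸ f x) xs ex
... | x , x∈ , px , least = x , x∈ , px , λ {y} y∈ py →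
  ≮⇒≥ λ x<y → <⇒≱ (∸-monoʳ-< x<y (bd y)) (least y∈ py)

∑-allFin-suc : ∀ n (f : Fin (suc n) → ℕ) → ∑ (allFin (suc n)) f ≡ f zero + ∑ (allFin n) (f ∘ suc)
∑-allFin-suc n f = cong (f zero +_) (trans (cong (λ xs → ∑ xs f) (sym (List.map-tabulate id suc))) (∑-map suc (allFin n) f))

-- Cardinalities and enumeration of subsets

∣p∣≡∣p∩q∣+∣p─q∣ : ∀ (p q : Subset N) → ∣ p ∣ ≡ ∣ p ∩ q ∣ + ∣ p ─ q ∣
∣p∣≡∣p∩q∣+∣p─q∣ [] [] = refl
∣p∣≡∣p∩q∣+∣p─q∣ (true ∷ p) (true ∷ q) = cong suc (∣p∣≡∣p∩q∣+∣p─q∣ p q)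
∣p∣≡∣p∩q∣+∣p─q∣ (true ∷ p) (false ∷ q) = trans (cong suc (∣p∣≡∣p∩q∣+∣p─q∣ p q)) (sym (+-suc _ _))
∣p∣≡∣p∩q∣+∣p─q∣ (false ∷ p) (true ∷ q) = ∣p∣≡∣p∩q∣+∣p─q∣ p q
∣p∣≡∣p∩q∣+∣p─q∣ (false ∷ p) (false ∷ q) = ∣p∣≡∣p∩q∣+∣p─q∣ p q

∣p∪q∣≡∣p∣+∣q─p∣ : ∀ (p q : Subset N) → ∣ p ∪ q ∣ ≡ ∣ p ∣ + ∣ q ─ p ∣
∣p∪q∣≡∣p∣+∣q─p∣ [] [] = refl
∣p∪q∣≡∣p∣+∣q─p∣ (true ∷ p) (true ∷ q) = cong suc (∣p∪q∣≡∣p∣+∣q─p∣ p q)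
∣p∪q∣≡∣p∣+∣q─p∣ (true ∷ p) (false ∷ q) = cong suc (∣p∪q∣≡∣p∣+∣q─p∣ p q)
∣p∪q∣≡∣p∣+∣q─p∣ (false ∷ p) (true ∷ q) = trans (cong suc (∣p∪q∣≡∣p∣+∣q─p∣ p q)) (sym (+-suc _ _))
∣p∪q∣≡∣p∣+∣q─p∣ (false ∷ p) (false ∷ q) = ∣p∪q∣≡∣p∣+∣q─p∣ p q

x∈p─q⇒x∉q : ∀ {x} (p q : Subset N) → x ∈ˢ p ─ q → x ∉ˢ q
x∈p─q⇒x∉q (true ∷ p) (true ∷ q) () here
x∈p─q⇒x∉q (false ∷ p) (true ∷ q) () here
x∈p─q⇒x∉q (_ ∷ p) (true ∷ q) (there x∈) (there x∈q) = x∈p─q⇒x∉q p q x∈ x∈q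
x∈p─q⇒x∉q (_ ∷ p) (false ∷ q) (there x∈) (there x∈q) = x∈p─q⇒x∉q p q x∈ x∈q

p⊆q∧∣q∣≤∣p∣⇒p≡q : ∀ {p q : Subset N} → p ⊆ q → ∣ q ∣ ≤ ∣ p ∣ → p ≡ q
p⊆q∧∣q∣≤∣p∣⇒p≡q {p = p} {q} p⊆q le = ⊆-antisym p⊆q λ {x} x∈q → helper x∈q (x ∈? p)
  where
  helper : ∀ {x} → x ∈ˢ q → Dec (x ∈ˢ p) → x ∈ˢ p
  helper x∈q (yes x∈p) = x∈p
  helper x∈q (no x∉p) = ⊥-elim (<⇒≱ (p⊂q⇒∣p∣<∣q∣ (p⊆q , _ , x∈q , x∉p)) le)

∣p∣≡1+∣p-x∣ : ∀ {x} {p : Subset N} → x ∈ˢ p → ∣ p ∣ ≡ suc ∣ p - x ∣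
∣p∣≡1+∣p-x∣ {p = true ∷ p} here = cong (suc ∘ ∣_∣) (sym (p─⊥≡p p))
∣p∣≡1+∣p-x∣ {p = true ∷ p} (there x∈) = cong suc (∣p∣≡1+∣p-x∣ x∈)
∣p∣≡1+∣p-x∣ {p = false ∷ p} (there x∈) = ∣p∣≡1+∣p-x∣ x∈

∣p∪⁅x⁆∣≡1+∣p∣ : ∀ {x} {p : Subset N} → x ∉ˢ p → ∣ p ∪ ⁅ x ⁆ ∣ ≡ suc ∣ p ∣
∣p∪⁅x⁆∣≡1+∣p∣ {x = zero} {true ∷ p} x∉ = ⊥-elim (x∉ here)
∣p∪⁅x⁆∣≡1+∣p∣ {x = zero} {false ∷ p} x∉ = cong (suc ∘ ∣_∣) (∪-identityʳ p)
∣p∪⁅x⁆∣≡1+∣p∣ {x = suc x} {true ∷ p} x∉ = cong suc (∣p∪⁅x⁆∣≡1+∣p∣ (x∉ ∘ there))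
∣p∪⁅x⁆∣≡1+∣p∣ {x = suc x} {false ∷ p} x∉ = ∣p∪⁅x⁆∣≡1+∣p∣ (x∉ ∘ there)

∪-lub : ∀ {p q r : Subset N} → p ⊆ r → q ⊆ r → p ∪ q ⊆ r
∪-lub {p = p} {q} p⊆r q⊆r x∈ = [ p⊆r , q⊆r ]′ (x∈p∪q⁻ p q x∈)

⁅x⁆⊆ : ∀ {x} {p : Subset N} → x ∈ˢ p → ⁅ x ⁆ ⊆ p
⁅x⁆⊆ {x = x} {p} x∈p y∈ = subst (_∈ˢ p) (sym (x∈⁅y⁆⇒x≡y x y∈)) x∈p

∣p∣≡∑ : ∀ (p : Subset N) → ∣ p ∣ ≡ ∑ (allFin N) (λ x → 𝟙 (x ∈? p))
∣p∣≡∑ {zero} [] = refl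
∣p∣≡∑ {suc N} (b ∷ p) = trans (cons b) (sym (∑-allFin-suc N (λ x → 𝟙 (x ∈? (b ∷ p)))))
  where
  rest : ∀ b → ∣ p ∣ ≡ ∑ (allFin N) (λ x → 𝟙 (suc x ∈? (b ∷ p)))
  rest b = trans (∣p∣≡∑ p) (∑-cong (allFin N) λ x → 𝟙-cong (x ∈? p) (suc x ∈? (b ∷ p)) there drop-there)
  cons : ∀ b → ∣ b ∷ p ∣ ≡ 𝟙 (zero ∈? (b ∷ p)) + ∑ (allFin N) (λ x → 𝟙 (suc x ∈? (b ∷ p)))
  cons true = cong suc (rest true)
  cons false = rest false

subsets : ∀ N → List (Subset N)
subsets zero = [] ∷ []
subsets (suc N) = map (false ∷_) (subsets N) ++ map (true ∷_) (subsets N)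

∈-subsets : ∀ (p : Subset N) → p ∈ subsets N
∈-subsets [] = here refl
∈-subsets (false ∷ p) = ∈-++⁺ˡ (∈-map⁺ (false ∷_) (∈-subsets p))
∈-subsets {suc N} (true ∷ p) = ∈-++⁺ʳ (map (false ∷_) (subsets N)) (∈-map⁺ (true ∷_) (∈-subsets p))

subsets-unique : ∀ N → Unique (subsets N)
subsets-unique zero = [] ∷ []
subsets-unique (suc N) = Unique.++⁺ (Unique.map⁺ (λ { refl → refl }) (subsets-unique N)) (Unique.map⁺ (λ { refl → refl }) (subsets-unique N))
  λ (v∈ , w∈) → disj (proj₂ (proj₂ (∈-map⁻ (false ∷_) v∈))) (proj₂ (proj₂ (∈-map⁻ (true ∷_) w∈)))
  where
  disj : ∀ {p q : Subset N} {r : Subset (suc N)} → r ≡ false ∷ p → r ≡ true ∷ q → Data.Empty.⊥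
  disj refl ()

∑-subsets-suc : ∀ N (f : Subset (suc N) → ℕ) →
  ∑ (subsets (suc N)) f ≡ ∑ (subsets N) (λ p → f (false ∷ p)) + ∑ (subsets N) (λ p → f (true ∷ p))
∑-subsets-suc N f = trans (∑-++ (map (false ∷_) (subsets N)) _ f) (cong₂ _+_ (∑-map _ (subsets N) f) (∑-map _ (subsets N) f))

-- By the binomial theorem the sum is n^(k-|S|) (n+x)^|S|. Letting k exceed |S| gives one bound for
-- all members of size at most k.
∑-⊆-binomial : ∀ x n k (S : Subset N) → ∣ S ∣ ≤ k →
  ∑ (subsets N) (λ T → 𝟙 (T ⊆? S) * (x ^ ∣ T ∣ * n ^ (k ∸ ∣ T ∣))) ≤ (n + x) ^ k
∑-⊆-binomial x n k [] _ = begin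
  𝟙 ([] ⊆? []) * (1 * n ^ k) + 0  ≡⟨ +-identityʳ _ ⟩
  𝟙 ([] ⊆? []) * (1 * n ^ k)  ≤⟨ 𝟙*≤ ([] ⊆? []) _ ⟩
  1 * n ^ k  ≡⟨ *-identityˡ _ ⟩
  n ^ k  ≤⟨ ^-monoˡ-≤ k (m≤m+n n x) ⟩
  (n + x) ^ k  ∎
  where open ≤-Reasoning
∑-⊆-binomial {suc N} x n k (false ∷ S) le = begin
  ∑ (subsets (suc N)) F  ≡⟨ ∑-subsets-suc N F ⟩
  ∑ (subsets N) (λ T → F (false ∷ T)) + ∑ (subsets N) (λ T → F (true ∷ T))
    ≡⟨ cong₂ _+_ (∑-cong (subsets N) (λ T → cong (_* (x ^ ∣ T ∣ * n ^ (k ∸ ∣ T ∣)))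
        (𝟙-cong ((false ∷ T) ⊆? (false ∷ S)) (T ⊆? S) drop-∷-⊆ s⊆s)))
                 (trans (∑-cong (subsets N) (λ T → cong (_* (x ^ suc ∣ T ∣ * n ^ (k ∸ suc ∣ T ∣)))
                     (𝟙-no ((true ∷ T) ⊆? (false ∷ S)) (λ s → none (s here))))) (∑-0 (subsets N))) ⟩
  ∑ (subsets N) (λ T → 𝟙 (T ⊆? S) * (x ^ ∣ T ∣ * n ^ (k ∸ ∣ T ∣))) + 0  ≡⟨ +-identityʳ _ ⟩
  ∑ (subsets N) (λ T → 𝟙 (T ⊆? S) * (x ^ ∣ T ∣ * n ^ (k ∸ ∣ T ∣)))  ≤⟨ ∑-⊆-binomial x n k S le ⟩
  (n + x) ^ k  ∎
  where
  open ≤-Reasoning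
  F = λ (T : Subset (suc N)) → 𝟙 (T ⊆? (false ∷ S)) * (x ^ ∣ T ∣ * n ^ (k ∸ ∣ T ∣))
  none : zero ∈ˢ (false ∷ S) → Data.Empty.⊥
  none ()
∑-⊆-binomial {suc N} x n (suc k) (true ∷ S) (s≤s le) = begin
  ∑ (subsets (suc N)) F  ≡⟨ ∑-subsets-suc N F ⟩
  ∑ (subsets N) (λ T → F (false ∷ T)) + ∑ (subsets N) (λ T → F (true ∷ T))
    ≡⟨ cong₂ _+_ (trans (∑-cong (subsets N) out) (∑-*ˡ (subsets N) n G))
        (trans (∑-cong (subsets N) ins) (∑-*ˡ (subsets N) x G)) ⟩
  n * ∑ (subsets N) G + x * ∑ (subsets N) G  ≡⟨ sym (*-distribʳ-+ (∑ (subsets N) G) n x) ⟩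
  (n + x) * ∑ (subsets N) G  ≤⟨ *-monoʳ-≤ (n + x) (∑-⊆-binomial x n k S le) ⟩
  (n + x) * (n + x) ^ k  ∎
  where
  open ≤-Reasoning
  F = λ (T : Subset (suc N)) → 𝟙 (T ⊆? (true ∷ S)) * (x ^ ∣ T ∣ * n ^ (suc k ∸ ∣ T ∣))
  G = λ T → 𝟙 (T ⊆? S) * (x ^ ∣ T ∣ * n ^ (k ∸ ∣ T ∣))
  alg₁ : ∀ i a n b → i * (a * (n * b)) ≡ n * (i * (a * b))
  alg₁ = solve-∀
  alg₂ : ∀ i x a b → i * (x * a * b) ≡ x * (i * (a * b))
  alg₂ = solve-∀
  out : ∀ T → F (false ∷ T) ≡ n * G T
  out T = trans (cong (_* (x ^ ∣ T ∣ * n ^ (suc k ∸ ∣ T ∣))) (𝟙-cong ((false ∷ T) ⊆? (true ∷ S)) (T ⊆? S) drop-∷-⊆ out⊆))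
    (trans (𝟙*-cong (T ⊆? S) (λ T⊆S → cong (λ e → x ^ ∣ T ∣ * n ^ e) (+-∸-assoc 1 (≤-trans (p⊆q⇒∣p∣≤∣q∣ T⊆S) le))))
      (alg₁ (𝟙 (T ⊆? S)) (x ^ ∣ T ∣) n (n ^ (k ∸ ∣ T ∣))))
  ins : ∀ T → F (true ∷ T) ≡ x * G T
  ins T = trans (cong (_* (x ^ suc ∣ T ∣ * n ^ (k ∸ ∣ T ∣))) (𝟙-cong ((true ∷ T) ⊆? (true ∷ S)) (T ⊆? S) drop-∷-⊆ s⊆s))
    (alg₂ (𝟙 (T ⊆? S)) x (x ^ ∣ T ∣) (n ^ (k ∸ ∣ T ∣)))

cnt : List (Subset N) → Subset N → ℕ
cnt xs X = ∑ xs (λ T → 𝟙 (X ⊆? T))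

-- Minimal fragments under random colourings

-- One colour for each of two rounds, for each of two families. Using a single colouring for both
-- families makes their regions disjoint, while every colour still has chance 1/4 at each element.
Colour : Set
Colour = Fin 4

colourings : ∀ N → List (Vec Colour N)
colourings zero = [] ∷ []
colourings (suc N) = concatMap (λ a → map (a ∷_) (colourings N)) (allFin 4)

∑-concatMap : ∀ {A B : Set} (g : A → List B) xs f → ∑ (concatMap g xs) f ≡ ∑ xs (λ x → ∑ (g x) f)
∑-concatMap g [] f = refl
∑-concatMap g (x ∷ xs) f = trans (∑-++ (g x) _ f) (cong (∑ (g x) f +_) (∑-concatMap g xs f))

∑-colourings-suc : ∀ N (f : Vec Colour (suc N) → ℕ) →
  ∑ (colourings (suc N)) f ≡ ∑ (allFin 4) (λ a → ∑ (colourings N) (λ c → f (a ∷ c)))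
∑-colourings-suc N f = trans (∑-concatMap (λ a → map (a ∷_) (colourings N)) (allFin 4) f)
    (∑-cong (allFin 4) (λ a → ∑-map (a ∷_) (colourings N) f))

∑-colourings-1 : ∀ N → ∑ (colourings N) (λ _ → 1) ≡ 4 ^ N
∑-colourings-1 zero = refl
∑-colourings-1 (suc N) = begin
  ∑ (colourings (suc N)) (λ _ → 1)  ≡⟨ ∑-colourings-suc N (λ _ → 1) ⟩
  ∑ (allFin 4) (λ _ → ∑ (colourings N) (λ _ → 1))  ≡⟨ ∑-const (allFin 4) (∑ (colourings N) (λ _ → 1)) ⟩
  4 * ∑ (colourings N) (λ _ → 1)  ≡⟨ cong (4 *_) (∑-colourings-1 N) ⟩
  4 ^ suc N  ∎
  where open ≡-Reasoning

region : (Colour → Bool) → Vec Colour N → Subset N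
region R c = Vec.map R c

recolour : Colour → Subset N → Vec Colour N → Vec Colour N
recolour ρ = zipWith (λ b x → if b then ρ else x)

head-∈ : ∀ {b} {p : Subset N} → zero ∈ˢ b ∷ p → b ≡ true
head-∈ here = refl

∈-head : ∀ {b} {p : Subset N} → b ≡ true → zero ∈ˢ b ∷ p
∈-head refl = here

region-recolour⁻ : ∀ R ρ (T : Subset N) c {x} → x ∈ˢ region R (recolour ρ T c) → x ∈ˢ T ⊎ x ∈ˢ region R c
region-recolour⁻ R ρ (true ∷ T) (a ∷ c) {zero} x∈ = inj₁ here
region-recolour⁻ R ρ (false ∷ T) (a ∷ c) {zero} x∈ = inj₂ (∈-head (head-∈ x∈))
region-recolour⁻ R ρ (b ∷ T) (a ∷ c) {suc x} (there x∈) with region-recolour⁻ R ρ T c x∈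
... | inj₁ p = inj₁ (there p)
... | inj₂ p = inj₂ (there p)

T⊆region-recolour : ∀ R ρ → R ρ ≡ true → (T : Subset N) → ∀ c → T ⊆ region R (recolour ρ T c)
T⊆region-recolour R ρ Rρ (true ∷ T) (a ∷ c) here rewrite Rρ = here
T⊆region-recolour R ρ Rρ (b ∷ T) (a ∷ c) (there x∈) = there (T⊆region-recolour R ρ Rρ T c x∈)

region⊆region-recolour : ∀ R ρ → R ρ ≡ true → (T : Subset N) → ∀ c → region R c ⊆ region R (recolour ρ T c)
region⊆region-recolour R ρ Rρ (true ∷ T) (a ∷ c) {zero} x∈ rewrite Rρ = here
region⊆region-recolour R ρ Rρ (false ∷ T) (a ∷ c) {zero} x∈ = ∈-head (head-∈ x∈)
region⊆region-recolour R ρ Rρ (b ∷ T) (a ∷ c) {suc x} (there x∈) = there (region⊆region-recolour R ρ Rρ T c x∈)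

-- Elements outside a region stay outside when painted with another outside colour. Hence what the
-- first round produced is unchanged by recolourings made in the second.
region-recolour-fixed : ∀ R ρ → R ρ ≡ false → (T : Subset N) → ∀ c → T ⊆ ∁ (region R c) → region R
    (recolour ρ T c) ≡ region R c
region-recolour-fixed R ρ Rρ [] [] _ = refl
region-recolour-fixed R ρ Rρ (true ∷ T) (a ∷ c) sub = cong₂ _∷_ (trans Rρ (sym (not-true (head-∈ (sub here)))))
    (region-recolour-fixed R ρ Rρ T c (drop-∷-⊆ sub))
  where
  not-true : ∀ {b} → not b ≡ true → b ≡ false
  not-true {false} _ = refl
region-recolour-fixed R ρ Rρ (false ∷ T) (a ∷ c) sub = cong (R a ∷_) (region-recolour-fixed R ρ Rρ T c (drop-∷-⊆ sub))

-- Painting T forgets only the old colours on T. If T misses the region, these are among the at most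
-- three colours outside `R`, so every colouring has at most 3^|T| preimages.
∑-recolour : ∀ R ρ → ∑ (allFin 4) (λ a → 𝟙 (R a Bool.≟ false)) ≤ 3 → (T : Subset N) (g : Vec Colour N → ℕ) →
  ∑ (colourings N) (λ c → 𝟙 (T ⊆? ∁ (region R c)) * g (recolour ρ T c)) ≤ 3 ^ ∣ T ∣ * ∑ (colourings N) g
∑-recolour R ρ few [] g = +-monoˡ-≤ 0 (≤-trans (𝟙*≤ ([] ⊆? []) (g [])) (m≤m+n _ _))
∑-recolour {suc N} R ρ few (false ∷ T) g = begin
  ∑ (colourings (suc N)) F  ≡⟨ ∑-colourings-suc N F ⟩
  ∑ (allFin 4) (λ a → ∑ (colourings N) (λ c → F (a ∷ c)))
    ≤⟨ ∑-mono (allFin 4) (λ a → ≤-trans (∑-mono (colourings N)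
        (λ c → *-monoˡ-≤ _ (𝟙-mono ((false ∷ T) ⊆? ∁ (region R (a ∷ c))) (T ⊆? ∁ (region R c)) drop-∷-⊆)))
         (∑-recolour R ρ few T (λ c → g (a ∷ c)))) ⟩
  ∑ (allFin 4) (λ a → 3 ^ ∣ T ∣ * ∑ (colourings N) (λ c → g (a ∷ c)))  ≡⟨ ∑-*ˡ (allFin 4) (3 ^ ∣ T ∣)
      (λ a → ∑ (colourings N) (λ c → g (a ∷ c))) ⟩
  3 ^ ∣ T ∣ * ∑ (allFin 4) (λ a → ∑ (colourings N) (λ c → g (a ∷ c)))  ≡⟨ cong (3 ^ ∣ T ∣ *_) (sym (∑-colourings-suc N g)) ⟩
  3 ^ ∣ T ∣ * ∑ (colourings (suc N)) g  ∎
  where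
  open ≤-Reasoning
  F = λ c → 𝟙 ((false ∷ T) ⊆? ∁ (region R c)) * g (recolour ρ (false ∷ T) c)
∑-recolour {suc N} R ρ few (true ∷ T) g = begin
  ∑ (colourings (suc N)) F  ≡⟨ ∑-colourings-suc N F ⟩
  ∑ (allFin 4) (λ a → ∑ (colourings N) (λ c → F (a ∷ c)))
    ≤⟨ ∑-mono (allFin 4) (λ a → ≤-trans (∑-mono (colourings N) (bound a))
        (≤-reflexive (∑-*ˡ (colourings N) (𝟙 (R a Bool.≟ false)) G))) ⟩
  ∑ (allFin 4) (λ a → 𝟙 (R a Bool.≟ false) * ∑ (colourings N) G)  ≡⟨ ∑-*ʳ (allFin 4) (∑ (colourings N) G)
      (λ a → 𝟙 (R a Bool.≟ false)) ⟩
  ∑ (allFin 4) (λ a → 𝟙 (R a Bool.≟ false)) * ∑ (colourings N) G  ≤⟨ *-mono-≤ few (∑-recolour R ρ few T (λ c → g (ρ ∷ c))) ⟩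
  3 * (3 ^ ∣ T ∣ * ∑ (colourings N) (λ c → g (ρ ∷ c)))
    ≤⟨ *-monoʳ-≤ 3 (*-monoʳ-≤ (3 ^ ∣ T ∣) (∑-∈ (λ a → ∑ (colourings N) (λ c → g (a ∷ c))) (∈-allFin ρ))) ⟩
  3 * (3 ^ ∣ T ∣ * ∑ (allFin 4) (λ a → ∑ (colourings N) (λ c → g (a ∷ c))))  ≡⟨ sym (*-assoc 3 (3 ^ ∣ T ∣) _) ⟩
  3 ^ suc ∣ T ∣ * ∑ (allFin 4) (λ a → ∑ (colourings N) (λ c → g (a ∷ c)))  ≡⟨ cong (3 ^ suc ∣ T ∣ *_)
      (sym (∑-colourings-suc N g)) ⟩
  3 ^ suc ∣ T ∣ * ∑ (colourings (suc N)) g  ∎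
  where
  open ≤-Reasoning
  F = λ c → 𝟙 ((true ∷ T) ⊆? ∁ (region R c)) * g (recolour ρ (true ∷ T) c)
  G = λ c → 𝟙 (T ⊆? ∁ (region R c)) * g (ρ ∷ recolour ρ T c)
  not-true : ∀ {b} → not b ≡ true → b ≡ false
  not-true {false} _ = refl
  bound : ∀ a c → F (a ∷ c) ≤ 𝟙 (R a Bool.≟ false) * G c
  bound a c = begin
    F (a ∷ c)  ≤⟨ *-monoˡ-≤ _ (𝟙-mono ((true ∷ T) ⊆? ∁ (region R (a ∷ c))) ((R a Bool.≟ false) ×-dec (T ⊆? ∁ (region R c)))
                      (λ s → not-true (head-∈ (s here)) , drop-∷-⊆ s)) ⟩
    𝟙 ((R a Bool.≟ false) ×-dec (T ⊆? ∁ (region R c))) * g (ρ ∷ recolour ρ T c)  ≡⟨ cong (_* g (ρ ∷ recolour ρ T c))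
        (𝟙-× (R a Bool.≟ false) _) ⟩
    𝟙 (R a Bool.≟ false) * 𝟙 (T ⊆? ∁ (region R c)) * g (ρ ∷ recolour ρ T c)  ≡⟨ *-assoc (𝟙 (R a Bool.≟ false)) _ _ ⟩
    𝟙 (R a Bool.≟ false) * G c ∎

-- The fragment `S′ ─ W` is what the member S′ still needs once the random set W is given. A small
-- fragment lying inside S may replace S even if it comes from a different member.
Covered : List (Subset N) → Subset N → ℕ → Subset N → Set
Covered H W v S = Any (λ S′ → S′ ─ W ⊆ S × ∣ S′ ─ W ∣ < v) H

covered? : ∀ (H : List (Subset N)) W v S → Dec (Covered H W v S)
covered? H W v S = any? (λ S′ → (S′ ─ W ⊆? S) ×-dec (∣ S′ ─ W ∣ <? v)) H

uncovered : List (Subset N) → Subset N → ℕ → ℕ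
uncovered H W v = ∑ H (λ S → 𝟙 (¬? (covered? H W v S)))

-- The family depends on the colouring because in the second round it consists of the fragments left
-- by the first. For the same reason `L` is separate from the size of the family: fragments may be
-- fewer, but their spread is measured against the original family.
module MinimalFragments
  (R : Colour → Bool) (ρ : Colour) (Rρ : R ρ ≡ true)
  (few : ∑ (allFin 4) (λ a → 𝟙 (R a Bool.≟ false)) ≤ 3)
  {N} (H : Vec Colour N → List (Subset N))
  (invariant : ∀ T c → T ⊆ ∁ (region R c) → H (recolour ρ T c) ≡ H c)
  (n k v m L : ℕ) (0<m : 0 < m)
  (size : ∀ c {S} → S ∈ H c → ∣ S ∣ ≤ k)
  (spread : ∀ c X → cnt (H c) X * n ^ ∣ X ∣ ≤ 4 ^ ∣ X ∣ * L)
  where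

  inside? : ∀ c → Dec (Any (_⊆ region R c) (H c))
  inside? c = any? (_⊆? region R c) (H c)

  member : Vec Colour N → Subset N
  member c with inside? c
  ... | yes p = proj₁ (find p)
  -- The default need only have size at most k.
  ... | no _ = ⊥

  ∣member∣≤k : ∀ c → ∣ member c ∣ ≤ k
  ∣member∣≤k c with inside? c
  ... | yes p = size c (proj₁ (proj₂ (find p)))
  ... | no _ = subst (_≤ k) (sym (∣⊥∣≡0 N)) z≤n

  -- Let T be a smallest fragment inside S. Once T is painted, the region is W ∪ T, so the canonical
  -- member S* found there has S* ─ W ⊆ T ⊆ S, and minimality of T forces S* ─ W = T. Thus T is a
  -- subset of a set that the recoloured colouring alone determines.
  fragment⊆member : ∀ c {S} → S ∈ H c → ¬ Covered (H c) (region R c) v S →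
    ∃ λ T → T ⊆ ∁ (region R c) × T ⊆ member (recolour ρ T c) × v ≤ ∣ T ∣ × T ⊆ S
  fragment⊆member c {S} S∈ ¬cov with argmin (λ S′ → S′ ─ region R c ⊆? S) (λ S′ → ∣ S′ ─ region R c ∣) (H c)
      (lose S∈ (p─q⊆p S _))
  ... | M , M∈ , M⊆S , least = T , T⊆∁ , T⊆member , ≮⇒≥ (λ lt → ¬cov (lose M∈ (M⊆S , lt))) , M⊆S
    where
    W = region R c
    T = M ─ W
    c′ = recolour ρ T c
    T⊆∁ : T ⊆ ∁ W
    T⊆∁ x∈ = x∉p⇒x∈∁p (x∈p─q⇒x∉q M W x∈)
    H≡ : H c′ ≡ H c
    H≡ = invariant T c T⊆∁
    M⊆ : M ⊆ region R c′
    M⊆ {x} x∈ with x ∈? W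
    ... | yes x∈W = region⊆region-recolour R ρ Rρ T c x∈W
    ... | no x∉W = T⊆region-recolour R ρ Rρ T c (x∈p∧x∉q⇒x∈p─q x∈ x∉W)
    T⊆member : T ⊆ member c′
    T⊆member with inside? c′
    ... | no ¬p = ⊥-elim (¬p (lose (subst (M ∈_) (sym H≡) M∈) M⊆))
    ... | yes p = subst (_⊆ S*) S*─W≡T (p─q⊆p S* W)
      where
      S* = proj₁ (find p)
      S*∈ : S* ∈ H c
      S*∈ = subst (S* ∈_) H≡ (proj₁ (proj₂ (find p)))
      S*─W⊆T : S* ─ W ⊆ T
      S*─W⊆T x∈ with region-recolour⁻ R ρ T c (proj₂ (proj₂ (find p)) (p─q⊆p S* W x∈))
      ... | inj₁ x∈T = x∈T
      ... | inj₂ x∈W = ⊥-elim (x∈p─q⇒x∉q S* W x∈ x∈W)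
      S*─W≡T : S* ─ W ≡ T
      S*─W≡T = p⊆q∧∣q∣≤∣p∣⇒p≡q S*─W⊆T (least S*∈ (⊆-trans S*─W⊆T M⊆S))

  -- The spread bound for the number of members above T, scaled by n^k, times a factor m per
  -- element. That factor is at least m^v on fragments with v or more elements, which makes large
  -- fragments expensive as in Markov's inequality.
  weight : Subset N → ℕ
  weight T = m ^ ∣ T ∣ * (4 ^ ∣ T ∣ * n ^ (k ∸ ∣ T ∣) * L)

  -- The set T, a minimal fragment, is disjoint from the region of c but lies in the canonical member
  -- of the recoloured c; c is recovered from its recolouring, T, and one of three old colours on T.
  uncovered-bound : ∀ c → uncovered (H c) (region R c) v * (m ^ v * n ^ k) ≤
    ∑ (subsets N) (λ T → 𝟙 (T ⊆? ∁ (region R c)) * (𝟙 (T ⊆? member (recolour ρ T c)) * weight T))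
  uncovered-bound c = begin
    uncovered (H c) W v * (m ^ v * n ^ k)  ≤⟨ *-monoˡ-≤ _ (∑-mono-∈ (H c) (λ {S} S∈ → 𝟙≤ (¬? (covered? (H c) W v S)) (one S∈))) ⟩
    ∑ (H c) (λ S → ∑ (subsets N) (λ T → a T * 𝟙 (T ⊆? S))) * (m ^ v * n ^ k)
      ≡⟨ cong (_* (m ^ v * n ^ k)) (∑-swap (H c) (subsets N) (λ S T → a T * 𝟙 (T ⊆? S))) ⟩
    ∑ (subsets N) (λ T → ∑ (H c) (λ S → a T * 𝟙 (T ⊆? S))) * (m ^ v * n ^ k)
      ≡⟨ sym (∑-*ʳ (subsets N) (m ^ v * n ^ k) _) ⟩
    ∑ (subsets N) (λ T → ∑ (H c) (λ S → a T * 𝟙 (T ⊆? S)) * (m ^ v * n ^ k))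
      ≤⟨ ∑-mono (subsets N) each ⟩
    ∑ (subsets N) (λ T → 𝟙 (T ⊆? ∁ W) * (𝟙 (T ⊆? member (recolour ρ T c)) * weight T)) ∎
    where
    open ≤-Reasoning
    W = region R c
    d : (T : Subset N) → Dec (T ⊆ ∁ W)
    d T = T ⊆? ∁ W
    e : (T : Subset N) → Dec (T ⊆ member (recolour ρ T c))
    e T = T ⊆? member (recolour ρ T c)
    a : Subset N → ℕ
    a T = 𝟙 (d T) * (𝟙 (e T) * 𝟙 (v ≤? ∣ T ∣))
    one : ∀ {S} → S ∈ H c → ¬ Covered (H c) W v S → 1 ≤ ∑ (subsets N) (λ T → a T * 𝟙 (T ⊆? S))
    one {S} S∈ ¬cov with fragment⊆member c S∈ ¬cov
    ... | T , p , q , r , s = ≤-trans (≤-reflexive (sym eq)) (∑-∈ (λ T → a T * 𝟙 (T ⊆? S)) (∈-subsets T))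
      where
      eq : a T * 𝟙 (T ⊆? S) ≡ 1
      eq rewrite 𝟙-yes (d T) p | 𝟙-yes (e T) q | 𝟙-yes (v ≤? ∣ T ∣) r | 𝟙-yes (T ⊆? S) s = refl
    alg : ∀ x y z w K → x * (y * z) * w * K ≡ x * (y * (z * (w * K)))
    alg = solve-∀
    alg₂ : ∀ w a b c → w * (a * (b * c)) ≡ a * (w * b * c)
    alg₂ = solve-∀
    alg₃ : ∀ a p L r → a * (p * L * r) ≡ a * (p * r * L)
    alg₃ = solve-∀
    each : ∀ T → ∑ (H c) (λ S → a T * 𝟙 (T ⊆? S)) * (m ^ v * n ^ k) ≤ 𝟙 (d T) * (𝟙 (e T) * weight T)
    each T = begin
      ∑ (H c) (λ S → a T * 𝟙 (T ⊆? S)) * (m ^ v * n ^ k)  ≡⟨ cong (_* (m ^ v * n ^ k)) (∑-*ˡ (H c) (a T) _) ⟩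
      a T * cnt (H c) T * (m ^ v * n ^ k)  ≡⟨ alg (𝟙 (d T)) (𝟙 (e T)) (𝟙 (v ≤? ∣ T ∣)) (cnt (H c) T) (m ^ v * n ^ k) ⟩
      𝟙 (d T) * (𝟙 (e T) * (𝟙 (v ≤? ∣ T ∣) * (cnt (H c) T * (m ^ v * n ^ k))))
        ≤⟨ *-monoʳ-≤ (𝟙 (d T)) (𝟙*-mono (e T) (λ T⊆ → ≤-trans (𝟙*-mono (v ≤? ∣ T ∣) (λ v≤ → main T⊆ v≤))
            (𝟙*≤ (v ≤? ∣ T ∣) _))) ⟩
      𝟙 (d T) * (𝟙 (e T) * weight T) ∎
      where
      main : T ⊆ member (recolour ρ T c) → v ≤ ∣ T ∣ → cnt (H c) T * (m ^ v * n ^ k) ≤ weight T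
      main T⊆ v≤ = begin
        cnt (H c) T * (m ^ v * n ^ k)  ≡⟨ cong (λ j → cnt (H c) T * (m ^ v * n ^ j)) (sym (m+[n∸m]≡n ∣T∣≤k)) ⟩
        cnt (H c) T * (m ^ v * n ^ (∣ T ∣ + (k ∸ ∣ T ∣)))  ≡⟨ cong (λ j → cnt (H c) T * (m ^ v * j))
            (^-distribˡ-+-* n ∣ T ∣ _) ⟩
        cnt (H c) T * (m ^ v * (n ^ ∣ T ∣ * n ^ (k ∸ ∣ T ∣)))  ≡⟨ alg₂ (cnt (H c) T) (m ^ v) (n ^ ∣ T ∣) _ ⟩
        m ^ v * (cnt (H c) T * n ^ ∣ T ∣ * n ^ (k ∸ ∣ T ∣))  ≤⟨ *-mono-≤ (^-monoʳ-≤ m {{>-nonZero 0<m}} v≤)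
            (*-monoˡ-≤ _ (spread c T)) ⟩
        m ^ ∣ T ∣ * (4 ^ ∣ T ∣ * L * n ^ (k ∸ ∣ T ∣))  ≡⟨ alg₃ (m ^ ∣ T ∣) (4 ^ ∣ T ∣) L _ ⟩
        weight T  ∎
        where
        ∣T∣≤k : ∣ T ∣ ≤ k
        ∣T∣≤k = ≤-trans (p⊆q⇒∣p∣≤∣q∣ T⊆) (∣member∣≤k (recolour ρ T c))

  -- Each element of T costs 3 for its forgotten colour, 4 for the spread and m for the weight,
  -- which gives 12 m. After the sums are exchanged, T runs only over subsets of one canonical
  -- member of size at most k, so the binomial bound applies.
  ∑-uncovered : ∑ (colourings N) (λ c → uncovered (H c) (region R c) v) * (m ^ v * n ^ k) ≤ 4 ^ N * ((n + 12 * m) ^ k * L)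
  ∑-uncovered = begin
    ∑ cs (λ c → uncovered (H c) (region R c) v) * (m ^ v * n ^ k)  ≡⟨ sym (∑-*ʳ cs (m ^ v * n ^ k) _) ⟩
    ∑ cs (λ c → uncovered (H c) (region R c) v * (m ^ v * n ^ k))  ≤⟨ ∑-mono cs uncovered-bound ⟩
    ∑ cs (λ c → ∑ Ts (λ T → 𝟙 (T ⊆? ∁ (region R c)) * g T (recolour ρ T c)))  ≡⟨ ∑-swap cs Ts _ ⟩
    ∑ Ts (λ T → ∑ cs (λ c → 𝟙 (T ⊆? ∁ (region R c)) * g T (recolour ρ T c)))  ≤⟨ ∑-mono Ts
        (λ T → ∑-recolour R ρ few T (g T)) ⟩
    ∑ Ts (λ T → 3 ^ ∣ T ∣ * ∑ cs (g T))  ≡⟨ ∑-cong Ts (λ T → sym (∑-*ˡ cs (3 ^ ∣ T ∣) (g T))) ⟩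
    ∑ Ts (λ T → ∑ cs (λ c → 3 ^ ∣ T ∣ * g T c))  ≡⟨ ∑-swap Ts cs _ ⟩
    ∑ cs (λ c → ∑ Ts (λ T → 3 ^ ∣ T ∣ * g T c))  ≤⟨ ∑-mono cs each ⟩
    ∑ cs (λ c → (n + 12 * m) ^ k * L)  ≡⟨ ∑-const cs _ ⟩
    length cs * ((n + 12 * m) ^ k * L)  ≡⟨ cong (_* ((n + 12 * m) ^ k * L)) (trans (sym (∑-1 cs)) (∑-colourings-1 N)) ⟩
    4 ^ N * ((n + 12 * m) ^ k * L)  ∎
    where
    open ≤-Reasoning
    cs = colourings N
    Ts = subsets N
    g : Subset N → Vec Colour N → ℕ
    g T c = 𝟙 (T ⊆? member c) * weight T
    alg : ∀ p i a b q l → p * (i * (a * (b * q * l))) ≡ i * (p * b * a * q) * l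
    alg = solve-∀
    pow : ∀ j → 3 ^ j * 4 ^ j * m ^ j ≡ (12 * m) ^ j
    pow j = trans (cong (_* m ^ j) (sym (^-distribʳ-* j 3 4))) (sym (^-distribʳ-* j 12 m))
    each : ∀ c → ∑ Ts (λ T → 3 ^ ∣ T ∣ * g T c) ≤ (n + 12 * m) ^ k * L
    each c = begin
      ∑ Ts (λ T → 3 ^ ∣ T ∣ * g T c)
        ≡⟨ ∑-cong Ts (λ T → trans (alg (3 ^ ∣ T ∣) (𝟙 (T ⊆? member c)) (m ^ ∣ T ∣) (4 ^ ∣ T ∣) (n ^ (k ∸ ∣ T ∣)) L)
             (cong (λ z → 𝟙 (T ⊆? member c) * (z * n ^ (k ∸ ∣ T ∣)) * L) (pow ∣ T ∣))) ⟩
      ∑ Ts (λ T → 𝟙 (T ⊆? member c) * ((12 * m) ^ ∣ T ∣ * n ^ (k ∸ ∣ T ∣)) * L)  ≡⟨ ∑-*ʳ Ts L _ ⟩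
      ∑ Ts (λ T → 𝟙 (T ⊆? member c) * ((12 * m) ^ ∣ T ∣ * n ^ (k ∸ ∣ T ∣))) * L
        ≤⟨ *-monoˡ-≤ L (∑-⊆-binomial (12 * m) n k (member c) (∣member∣≤k c)) ⟩
      (n + 12 * m) ^ k * L ∎

-- Each covered S is replaced by a fragment contained in S, so no set X gains members above it;
-- uncovered S are dropped.
fragments : List (Subset N) → Subset N → ℕ → List (Subset N) → List (Subset N)
fragments H W v [] = []
fragments H W v (S ∷ xs) with covered? H W v S
... | yes p = (proj₁ (find p) ─ W) ∷ fragments H W v xs
... | no _ = fragments H W v xs

length-fragments : ∀ (H : List (Subset N)) W v xs →
  ∑ xs (λ S → 𝟙 (¬? (covered? H W v S))) + length (fragments H W v xs) ≡ length xs
length-fragments H W v [] = refl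
length-fragments H W v (S ∷ xs) with covered? H W v S
... | yes p = trans (+-suc _ _) (cong suc (length-fragments H W v xs))
... | no _ = cong suc (length-fragments H W v xs)

cnt-fragments : ∀ (H : List (Subset N)) W v xs X → cnt (fragments H W v xs) X ≤ cnt xs X
cnt-fragments H W v [] X = z≤n
cnt-fragments H W v (S ∷ xs) X with covered? H W v S
... | yes p = +-mono-≤ (𝟙-mono (X ⊆? (proj₁ (find p) ─ W)) (X ⊆? S) (λ s → ⊆-trans s (proj₁ (proj₂ (proj₂ (find p))))))
    (cnt-fragments H W v xs X)
... | no _ = ≤-trans (cnt-fragments H W v xs X) (m≤n+m _ _)

∈-fragments⁻ : ∀ (H : List (Subset N)) W v xs {Y} → Y ∈ fragments H W v xs → ∃ λ S → S ∈ H × Y ≡ S ─ W × ∣ Y ∣ < v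
∈-fragments⁻ H W v (S ∷ xs) Y∈ with covered? H W v S
∈-fragments⁻ H W v (S ∷ xs) (here refl) | yes p = let S′ , S′∈ , _ , lt = find p in S′ , S′∈ , refl , lt
∈-fragments⁻ H W v (S ∷ xs) (there Y∈) | yes p = ∈-fragments⁻ H W v xs Y∈
∈-fragments⁻ H W v (S ∷ xs) Y∈ | no _ = ∈-fragments⁻ H W v xs Y∈

∣p∣<1⇒x∉p : ∀ {p : Subset N} → ∣ p ∣ < 1 → ∀ {x} → x ∉ˢ p
∣p∣<1⇒x∉p lt x∈ with subst (_< 1) (∣p∣≡1+∣p-x∣ x∈) lt
... | s≤s ()

region-mono : ∀ {R R′ : Colour → Bool} → (∀ a → R a ≡ true → R′ a ≡ true) → (c : Vec Colour N) → region R c ⊆ region R′ c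
region-mono h (a ∷ c) {zero} x∈ = ∈-head (h a (head-∈ x∈))
region-mono h (a ∷ c) {suc x} (there x∈) = there (region-mono h c x∈)

-- Round one has m = 2, v = 56, k = n: since (n+24)^n ≤ 4^24 n^n, the lost proportion is at most 2 ·
-- 2^48 / 2^56 ≤ 1/8. Round two has m = 32, v = 1, k = 56: since (n+384)^56 ≤ 2 n^56, it is at most
-- 2 · 2 / 32 = 1/8. The bound 43008 = 2 · 56 · 384 is what this second estimate asks of n. The
-- factor 2 in `spread` is the price paid later for making petals avoid the other core.
module TwoStep {N} (n : ℕ) (n≥ : 43008 ≤ n) (H : List (Subset N)) (nonempty : 0 < length H)
  (size : ∀ {S} → S ∈ H → ∣ S ∣ ≤ n)
  (spread : ∀ X → cnt H X * n ^ ∣ X ∣ ≤ 4 ^ ∣ X ∣ * (2 * length H))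
  (R₁ R₂ : Colour → Bool) (ρ₁ ρ₂ : Colour) (R₁ρ₁ : R₁ ρ₁ ≡ true) (R₁ρ₂ : R₁ ρ₂ ≡ false) (R₂ρ₂ : R₂ ρ₂ ≡ true)
  (R₁⊆R₂ : ∀ a → R₁ a ≡ true → R₂ a ≡ true)
  (few₁ : ∑ (allFin 4) (λ a → 𝟙 (R₁ a Bool.≟ false)) ≤ 3)
  (few₂ : ∑ (allFin 4) (λ a → 𝟙 (R₂ a Bool.≟ false)) ≤ 3)
  where

  inside? : ∀ c → Dec (Any (_⊆ region R₂ c) H)
  inside? c = any? (_⊆? region R₂ c) H

  private
    F : Vec Colour N → List (Subset N)
    F c = fragments H (region R₁ c) 56 H

    abstract
      0<n : 0 < n
      0<n = ≤-trans (m<m+n 0 {43008} (s≤s z≤n)) n≥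

    invariant : ∀ T c → T ⊆ ∁ (region R₂ c) → F (recolour ρ₂ T c) ≡ F c
    invariant T c T⊆ = cong (λ W → fragments H W 56 H) (region-recolour-fixed R₁ ρ₂ R₁ρ₂ T c
      (λ x∈ → x∉p⇒x∈∁p λ x∈R₁ → x∈∁p⇒x∉p (T⊆ x∈) (region-mono {R = R₁} {R₂} R₁⊆R₂ c x∈R₁)))

    module M₁ = MinimalFragments R₁ ρ₁ R₁ρ₁ few₁ (λ _ → H) (λ _ _ _ → refl) n n 56 2 (2 * length H) (s≤s z≤n)
      (λ _ → size) (λ _ → spread)
    module M₂ = MinimalFragments R₂ ρ₂ R₂ρ₂ few₂ F invariant n 56 1 32 (2 * length H) (s≤s z≤n)
      (λ c Y∈ → <⇒≤ (proj₂ (proj₂ (proj₂ (∈-fragments⁻ H (region R₁ c) 56 H Y∈)))))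
      (λ c X → ≤-trans (*-monoˡ-≤ (n ^ ∣ X ∣) (cnt-fragments H (region R₁ c) 56 H X)) (spread X))

    B₁ = ∑ (colourings N) (λ c → uncovered H (region R₁ c) 56)
    B₂ = ∑ (colourings N) (λ c → uncovered (F c) (region R₂ c) 1)

    bound₁ : 8 * B₁ ≤ 4 ^ N * length H
    bound₁ = arith B₁ (4 ^ N) (length H) (n ^ n) (m^n>0 n {{>-nonZero 0<n}} n)
      (≤-trans M₁.∑-uncovered (*-monoʳ-≤ (4 ^ N) (*-monoˡ-≤ (2 * length H) ([s+j]^s≤4^j*s^s n 24 0<n))))
      where
      open ≤-Reasoning
      arith : ∀ b a l X → 0 < X → b * (2 ^ 56 * X) ≤ a * (4 ^ 24 * X * (2 * l)) → 8 * b ≤ a * l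
      arith b a l X 0<X h = *-cancelʳ-≤ _ _ (2 ^ 49 * X) {{>-nonZero (*-mono-< {0} {2 ^ 49} {0} {X} (s≤s z≤n) 0<X)}} (begin
        8 * b * (2 ^ 49 * X)  ≤⟨ *-monoˡ-≤ (2 ^ 49 * X) (*-monoˡ-≤ b (m≤m+n 8 120)) ⟩
        128 * b * (2 ^ 49 * X)  ≡⟨ alg₁ 128 b (2 ^ 49) X ⟩
        b * (2 ^ 56 * X)  ≤⟨ h ⟩
        a * (4 ^ 24 * X * (2 * l))  ≡⟨ alg₂ a (4 ^ 24) X 2 l ⟩
        a * l * (2 ^ 49 * X)  ∎)
        where
        alg₁ : ∀ c b p X → c * b * (p * X) ≡ b * (c * p * X)
        alg₁ = solve-∀
        alg₂ : ∀ a p X c l → a * (p * X * (c * l)) ≡ a * l * (c * p * X)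
        alg₂ = solve-∀

    bound₂ : 8 * B₂ ≤ 4 ^ N * length H
    bound₂ = arith B₂ (4 ^ N) (length H) (n ^ 56) (m^n>0 n {{>-nonZero 0<n}} 56)
      (≤-trans M₂.∑-uncovered (*-monoʳ-≤ (4 ^ N) (*-monoˡ-≤ (2 * length H)
          ([a+d]^l≤2a^l n 384 56 0<n (≤-trans n≥ (m≤m+n n 384))))))
      where
      open ≤-Reasoning
      arith : ∀ b a l X → 0 < X → b * (32 * X) ≤ a * (2 * X * (2 * l)) → 8 * b ≤ a * l
      arith b a l X 0<X h = *-cancelʳ-≤ _ _ (4 * X) {{>-nonZero (*-mono-< {0} {4} {0} {X} (s≤s z≤n) 0<X)}} (begin
        8 * b * (4 * X)  ≡⟨ alg₁ b X ⟩
        b * (32 * X)  ≤⟨ h ⟩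
        a * (2 * X * (2 * l))  ≡⟨ alg₂ a X l ⟩
        a * l * (4 * X)  ∎)
        where
        alg₁ : ∀ b X → 8 * b * (4 * X) ≡ b * (32 * X)
        alg₁ = solve-∀
        alg₂ : ∀ a X l → a * (2 * X * (2 * l)) ≡ a * l * (4 * X)
        alg₂ = solve-∀

    -- With v = 1, covered in round two means that some fragment has nothing left outside the second
    -- region, so that its member lies inside. If no member does, every member is either lost in
    -- round one or has an uncovered fragment in round two.
    outside-bound : ∀ c → 𝟙 (¬? (inside? c)) * length H ≤ uncovered H (region R₁ c) 56 + uncovered (F c) (region R₂ c) 1
    outside-bound c = ≤-trans (𝟙*-mono (¬? (inside? c)) all-uncovered) (𝟙*≤ (¬? (inside? c)) _)
      where
      W₁ = region R₁ c
      W₂ = region R₂ c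
      open ≤-Reasoning
      all-uncovered : ¬ Any (_⊆ W₂) H → length H ≤ uncovered H W₁ 56 + uncovered (F c) W₂ 1
      all-uncovered ¬in = begin
        length H  ≡⟨ sym (length-fragments H W₁ 56 H) ⟩
        uncovered H W₁ 56 + length (F c)  ≡⟨ cong (uncovered H W₁ 56 +_) (sym (∑-1 (F c))) ⟩
        uncovered H W₁ 56 + ∑ (F c) (λ _ → 1)  ≡⟨ cong (uncovered H W₁ 56 +_)
            (∑-cong (F c) (λ Y → sym (𝟙-yes (¬? (covered? (F c) W₂ 1 Y)) none))) ⟩
        uncovered H W₁ 56 + uncovered (F c) W₂ 1  ∎
        where
        none : ∀ {Y} → ¬ Covered (F c) W₂ 1 Y
        none cov with find cov
        ... | Y′ , Y′∈ , _ , lt with ∈-fragments⁻ H W₁ 56 H Y′∈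
        ... | S , S∈ , refl , _ = ¬in (lose S∈ S⊆W₂)
          where
          S⊆W₂ : S ⊆ W₂
          S⊆W₂ {x} x∈ with x ∈? W₁ | x ∈? W₂
          ... | yes x∈W₁ | _ = region-mono {R = R₁} {R₂} R₁⊆R₂ c x∈W₁
          ... | no _ | yes x∈W₂ = x∈W₂
          ... | no x∉W₁ | no x∉W₂ = ⊥-elim (∣p∣<1⇒x∉p lt (x∈p∧x∉q⇒x∈p─q (x∈p∧x∉q⇒x∈p─q x∈ x∉W₁) x∉W₂))

  rarely-outside : 4 * ∑ (colourings N) (λ c → 𝟙 (¬? (inside? c))) ≤ 4 ^ N
  rarely-outside = *-cancelʳ-≤ _ _ (length H) {{>-nonZero nonempty}} (*-cancelˡ-≤ 2 (begin
    2 * (4 * ∑ cs fail * length H)  ≡⟨ alg (∑ cs fail) (length H) ⟩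
    8 * (∑ cs fail * length H)  ≡⟨ cong (8 *_) (sym (∑-*ʳ cs (length H) fail)) ⟩
    8 * ∑ cs (λ c → fail c * length H)  ≤⟨ *-monoʳ-≤ 8 (∑-mono cs outside-bound) ⟩
    8 * ∑ cs (λ c → uncovered H (region R₁ c) 56 + uncovered (F c) (region R₂ c) 1)  ≡⟨ cong (8 *_)
        (∑-+ cs (λ c → uncovered H (region R₁ c) 56) (λ c → uncovered (F c) (region R₂ c) 1)) ⟩
    8 * (B₁ + B₂)  ≡⟨ *-distribˡ-+ 8 B₁ B₂ ⟩
    8 * B₁ + 8 * B₂  ≤⟨ +-mono-≤ bound₁ bound₂ ⟩
    4 ^ N * length H + 4 ^ N * length H  ≡⟨ alg₂ (4 ^ N * length H) ⟩
    2 * (4 ^ N * length H)  ∎))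
    where
    open ≤-Reasoning
    cs = colourings N
    fail = λ c → 𝟙 (¬? (inside? c))
    alg : ∀ f l → 2 * (4 * f * l) ≡ 8 * (f * l)
    alg = solve-∀
    alg₂ : ∀ x → x + x ≡ 2 * x
    alg₂ = solve-∀

-- Each family fails on at most a quarter of the colourings, so some colouring serves both: one
-- member lies in the two red colours and the other in the two blue ones.
spread-disjoint : ∀ {N} n → 43008 ≤ n → (H H′ : List (Subset N)) → 0 < length H → 0 < length H′ →
  (∀ {S} → S ∈ H → ∣ S ∣ ≤ n) → (∀ {S} → S ∈ H′ → ∣ S ∣ ≤ n) →
  (∀ X → cnt H X * n ^ ∣ X ∣ ≤ 4 ^ ∣ X ∣ * (2 * length H)) →
  (∀ X → cnt H′ X * n ^ ∣ X ∣ ≤ 4 ^ ∣ X ∣ * (2 * length H′)) →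
  ∃ λ S → ∃ λ S′ → S ∈ H × S′ ∈ H′ × (∀ {x} → x ∈ˢ S → x ∉ˢ S′)
spread-disjoint {N} n n≥ H H′ ne ne′ size size′ spread spread′ = both (∑-witness cs fails (λ _ → 1) few-fails)
  where
  red₁ red₂ blue₁ blue₂ : Colour → Bool
  red₁ zero = true
  red₁ (suc _) = false
  red₂ zero = true
  red₂ (suc zero) = true
  red₂ (suc (suc _)) = false
  blue₁ (suc (suc zero)) = true
  blue₁ _ = false
  blue₂ (suc (suc _)) = true
  blue₂ _ = false
  red₁⊆red₂ : ∀ a → red₁ a ≡ true → red₂ a ≡ true
  red₁⊆red₂ zero _ = refl
  blue₁⊆blue₂ : ∀ a → blue₁ a ≡ true → blue₂ a ≡ true
  blue₁⊆blue₂ (suc (suc _)) _ = refl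
  module Red = TwoStep n n≥ H ne size spread red₁ red₂ zero (suc zero) refl refl refl
    red₁⊆red₂ ≤-refl (s≤s (s≤s z≤n))
  module Blue = TwoStep n n≥ H′ ne′ size′ spread′ blue₁ blue₂ (suc (suc zero)) (suc (suc (suc zero))) refl refl refl
    blue₁⊆blue₂ ≤-refl (s≤s (s≤s z≤n))
  cs = colourings N
  fails : Vec Colour N → ℕ
  fails c = 𝟙 (¬? (Red.inside? c)) + 𝟙 (¬? (Blue.inside? c))
  few-fails : ∑ cs fails < ∑ cs (λ _ → 1)
  few-fails = subst (∑ cs fails <_) (sym (∑-colourings-1 N)) (*-cancelˡ-< 4 _ _ (begin-strict
    4 * ∑ cs fails  ≡⟨ cong (4 *_) (∑-+ cs (λ c → 𝟙 (¬? (Red.inside? c))) (λ c → 𝟙 (¬? (Blue.inside? c)))) ⟩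
    4 * (∑ cs (λ c → 𝟙 (¬? (Red.inside? c))) + ∑ cs (λ c → 𝟙 (¬? (Blue.inside? c))))  ≡⟨ *-distribˡ-+ 4
        (∑ cs (λ c → 𝟙 (¬? (Red.inside? c)))) _ ⟩
    4 * ∑ cs (λ c → 𝟙 (¬? (Red.inside? c))) + 4 * ∑ cs (λ c → 𝟙
        (¬? (Blue.inside? c)))  ≤⟨ +-mono-≤ Red.rarely-outside Blue.rarely-outside ⟩
    4 ^ N + 4 ^ N  <⟨ m<m+n (4 ^ N + 4 ^ N) (+-mono-< 4^N>0 4^N>0) ⟩
    4 ^ N + 4 ^ N + (4 ^ N + 4 ^ N)  ≡⟨ alg (4 ^ N) ⟩
    4 * 4 ^ N  ∎))
    where
    open ≤-Reasoning
    4^N>0 = m^n>0 4 N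
    alg : ∀ x → x + x + (x + x) ≡ 4 * x
    alg = solve-∀
  red-blue : ∀ {N} (c : Vec Colour N) {x} → x ∈ˢ region red₂ c → x ∉ˢ region blue₂ c
  red-blue (zero ∷ c) {zero} _ ()
  red-blue (suc zero ∷ c) {zero} _ ()
  red-blue (suc (suc _) ∷ c) {zero} () _
  red-blue (_ ∷ c) {suc x} (there p) (there q) = red-blue c p q
  both : (∃ λ c → c ∈ cs × fails c < 1) → ∃ λ S → ∃ λ S′ → S ∈ H × S′ ∈ H′ × (∀ {x} → x ∈ˢ S → x ∉ˢ S′)
  both (c , _ , lt) with Red.inside? c | Blue.inside? c
  ... | yes p | yes q = let S , S∈ , S⊆ = find p ; S′ , S′∈ , S′⊆ = find q in
          S , S′ , S∈ , S′∈ , λ {x} x∈S x∈S′ → red-blue c (S⊆ x∈S) (S′⊆ x∈S′)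
  both (c , _ , s≤s ()) | no _ | _
  both (c , _ , s≤s ()) | yes _ | no _

-- Peeling into spread families

cnt≤length : ∀ (F : List (Subset N)) X → cnt F X ≤ length F
cnt≤length F X = ≤-trans (∑-mono F (λ T → 𝟙≤1 (X ⊆? T))) (≤-reflexive (∑-1 F))

cnt-⊥ : ∀ (F : List (Subset N)) → cnt F ⊥ ≡ length F
cnt-⊥ F = trans (∑-cong F (λ T → 𝟙-yes (⊥ ⊆? T) ⊥⊆)) (∑-1 F)

length-filter-∑ : ∀ {A : Set} {P : A → Set} (P? : Decidable P) xs → length (filter P? xs) ≡ ∑ xs (λ x → 𝟙 (P? x))
length-filter-∑ P? xs = trans (sym (∑-1 (filter P? xs))) (trans (∑-filter P? xs _) (∑-cong xs (λ x → *-identityʳ _)))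

∑-filter-≤ : ∀ {A : Set} {P : A → Set} (P? : Decidable P) xs f → ∑ (filter P? xs) f ≤ ∑ xs f
∑-filter-≤ P? xs f = ≤-trans (≤-reflexive (∑-filter P? xs f)) (∑-mono xs (λ x → 𝟙*≤ (P? x) (f x)))

∑-𝟙-split : ∀ {A : Set} {P : A → Set} (P? : Decidable P) xs → ∑ xs (λ x → 𝟙 (P? x)) + ∑ xs (λ x → 𝟙 (¬? (P? x))) ≡ length xs
∑-𝟙-split P? xs = trans (sym (∑-+ xs _ _)) (trans (∑-cong xs (λ x → 𝟙-¬ (P? x))) (∑-1 xs))

disjoint-─ : ∀ {p q : Subset N} → (∀ {x} → x ∈ˢ p → x ∉ˢ q) → p ─ q ≡ p
disjoint-─ {p = p} {q} dis = ⊆-antisym (p─q⊆p p q) (λ x∈ → x∈p∧x∉q⇒x∈p─q x∈ (dis x∈))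

-- `G` is a witness that F is spread above S: a random member of `G` contains X with probability at
-- most (4/n)^d, where d counts only the elements of X outside S.
record Core (n q : ℕ) (F : List (Subset N)) (S : Subset N) : Set where
  field
    small    : ∣ S ∣ ≤ q
    G        : List (Subset N)
    G⊆F      : ∀ {T} → T ∈ G → T ∈ F
    S⊆       : ∀ {T} → T ∈ G → S ⊆ T
    nonempty : 0 < length G
    spread   : ∀ X → cnt G X * n ^ ∣ X ─ S ∣ ≤ 4 ^ ∣ X ─ S ∣ * length G

Core-mono : ∀ {n q} {F F′ : List (Subset N)} → (∀ {T} → T ∈ F → T ∈ F′) → ∀ {S} → Core n q F S → Core n q F′ S
Core-mono sub core = record { small = small ; G = G ; G⊆F = sub ∘ G⊆F ; S⊆ = S⊆ ; nonempty = nonempty ; spread = spread }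
  where open Core core

uncoveredBy : List (Subset N) → List (Subset N) → ℕ
uncoveredBy 𝒮 F = ∑ F (λ T → 𝟙 (¬? (any? (_⊆? T) 𝒮)))

-- S is a largest dense set; the empty set is always dense, so S exists. If |S| > q, density at rate
-- 4/n against the hypothesis at rate 2/n leaves at most Q / 2^|S| members, and these are given up.
-- Otherwise no S ∪ X with X outside S is dense, which is exactly spreadness above S, and the
-- members that do not contain S are treated recursively.
peel : ∀ {n q Q} → 0 < n → ∀ fuel (F : List (Subset N)) → length F ≤ fuel →
  (∀ X → cnt F X * n ^ ∣ X ∣ ≤ 2 ^ ∣ X ∣ * Q) →
  ∃ λ 𝒮 → All (Core n q F) 𝒮 × uncoveredBy 𝒮 F * 2 ^ suc q ≤ Q
peel 0<n fuel [] _ sp = [] , [] , z≤n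
peel {N} {n} {q} {Q} 0<n (suc fuel) F@(_ ∷ _) len≤ sp
  with argmax (λ S → length F * 4 ^ ∣ S ∣ ≤? cnt F S * n ^ ∣ S ∣) ∣_∣ N (subsets N) ∣p∣≤n
         (lose (∈-subsets ⊥) (≤-reflexive (cong₂ (λ a b → a * b) (sym (cnt-⊥ F))
             (trans (cong (4 ^_) (∣⊥∣≡0 N)) (cong (n ^_) (sym (∣⊥∣≡0 N)))))))
... | S , _ , dense , maximal with ∣ S ∣ ≤? q
... | no big = [] , [] , (begin
    uncoveredBy [] F * 2 ^ suc q  ≤⟨ *-mono-≤ (≤-trans (∑-mono F (λ T → 𝟙≤1 (¬? (any? (_⊆? T) [])))) (≤-reflexive (∑-1 F)))
        (^-monoʳ-≤ 2 (≰⇒> big)) ⟩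
    length F * 2 ^ s  ≤⟨ *-cancelʳ-≤ _ _ (2 ^ s) {{m^n≢0 2 s}} (begin
      length F * 2 ^ s * 2 ^ s  ≡⟨ *-assoc (length F) (2 ^ s) (2 ^ s) ⟩
      length F * (2 ^ s * 2 ^ s)  ≡⟨ cong (length F *_) (sym (^-distribʳ-* s 2 2)) ⟩
      length F * 4 ^ s  ≤⟨ dense ⟩
      cnt F S * n ^ s  ≤⟨ sp S ⟩
      2 ^ s * Q  ≡⟨ *-comm (2 ^ s) Q ⟩
      Q * 2 ^ s  ∎) ⟩
    Q ∎)
  where
  open ≤-Reasoning
  s = ∣ S ∣
... | yes small = S ∷ proj₁ rec , core ∷ All.map (Core-mono (proj₁ ∘ ∈-filter⁻ avoid?)) (proj₁ (proj₂ rec)) ,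
    ≤-trans (*-monoˡ-≤ (2 ^ suc q) fewer) (proj₂ (proj₂ rec))
  where
  open ≤-Reasoning
  s = ∣ S ∣
  avoid? = λ T → ¬? (S ⊆? T)
  G = filter (S ⊆?_) F
  F′ = filter avoid? F
  len-G : length G ≡ cnt F S
  len-G = length-filter-∑ (S ⊆?_) F
  G>0 : 0 < length G
  G>0 = subst (0 <_) (sym len-G) (*-cancelʳ-< (n ^ s) 0 _ (<-≤-trans (*-mono-< {0} {length F} {0} {4 ^ s} (s≤s z≤n)
      (m^n>0 4 s)) dense))
  len-F′ : length G + length F′ ≡ length F
  len-F′ = trans (cong₂ _+_ len-G (length-filter-∑ avoid? F)) (∑-𝟙-split (S ⊆?_) F)
  F′<F : length F′ < length F
  F′<F = subst (length F′ <_) len-F′ (m<n+m (length F′) G>0)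
  rec = peel 0<n fuel F′ (s≤s⁻¹ (≤-trans F′<F len≤)) (λ X → ≤-trans (*-monoˡ-≤ (n ^ ∣ X ∣) (∑-filter-≤ avoid? F _)) (sp X))
  spread : ∀ X → cnt G X * n ^ ∣ X ─ S ∣ ≤ 4 ^ ∣ X ─ S ∣ * length G
  spread X with ∣ X ─ S ∣ in eq
  ... | zero = ≤-trans (≤-reflexive (*-identityʳ _)) (≤-trans (cnt≤length G X) (≤-reflexive (sym (*-identityˡ _))))
  ... | suc d = *-cancelʳ-≤ _ _ (n ^ s) {{m^n≢0 n s {{>-nonZero 0<n}}}} (begin
    cnt G X * n ^ suc d * n ^ s  ≤⟨ *-monoˡ-≤ (n ^ s) (*-monoˡ-≤ (n ^ suc d) G≤) ⟩
    cnt F (S ∪ X) * n ^ suc d * n ^ s  ≡⟨ trans (*-assoc (cnt F (S ∪ X)) _ _)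
        (cong (cnt F (S ∪ X) *_) (sym (^-distribˡ-+-* n (suc d) s))) ⟩
    cnt F (S ∪ X) * n ^ (suc d + s)  ≡⟨ cong (λ z → cnt F (S ∪ X) * n ^ z) (sym size) ⟩
    cnt F (S ∪ X) * n ^ ∣ S ∪ X ∣  ≤⟨ ≰⇒≥ (λ le → <⇒≱ bigger (maximal (∈-subsets (S ∪ X)) le)) ⟩
    length F * 4 ^ ∣ S ∪ X ∣  ≡⟨ cong (λ z → length F * 4 ^ z) size ⟩
    length F * 4 ^ (suc d + s)  ≡⟨ cong (length F *_) (^-distribˡ-+-* 4 (suc d) s) ⟩
    length F * (4 ^ suc d * 4 ^ s)  ≡⟨ alg (length F) (4 ^ suc d) (4 ^ s) ⟩
    4 ^ suc d * (length F * 4 ^ s)  ≤⟨ *-monoʳ-≤ (4 ^ suc d) dense ⟩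
    4 ^ suc d * (cnt F S * n ^ s)  ≡⟨ cong (λ z → 4 ^ suc d * (z * n ^ s)) (sym len-G) ⟩
    4 ^ suc d * (length G * n ^ s)  ≡⟨ sym (*-assoc (4 ^ suc d) _ _) ⟩
    4 ^ suc d * length G * n ^ s  ∎)
    where
    alg : ∀ a b c → a * (b * c) ≡ b * (a * c)
    alg = solve-∀
    size : ∣ S ∪ X ∣ ≡ suc d + s
    size = trans (∣p∪q∣≡∣p∣+∣q─p∣ S X) (trans (cong (s +_) eq) (+-comm s (suc d)))
    bigger : s < ∣ S ∪ X ∣
    bigger = subst (s <_) (sym size) (m<n+m s {suc d} (s≤s z≤n))
    G≤ : cnt G X ≤ cnt F (S ∪ X)
    G≤ = ≤-trans (≤-reflexive (∑-filter (S ⊆?_) F _)) (∑-mono F (λ T → ≤-trans (≤-reflexive (sym (𝟙-× (S ⊆? T) (X ⊆? T))))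
      (𝟙-mono ((S ⊆? T) ×-dec (X ⊆? T)) ((S ∪ X) ⊆? T) (λ (a , b) → ∪-lub a b))))
  core : Core n q F S
  core = record { small = small ; G = G ; G⊆F = proj₁ ∘ ∈-filter⁻ (S ⊆?_) ; S⊆ = proj₂ ∘ ∈-filter⁻ (S ⊆?_) {xs = F}
                ; nonempty = G>0 ; spread = spread }
  fewer : uncoveredBy (S ∷ proj₁ rec) F ≤ uncoveredBy (proj₁ rec) F′
  fewer = ≤-trans (∑-mono F (λ T → ≤-trans (𝟙-mono (¬? (any? (_⊆? T) (S ∷ proj₁ rec)))
      (avoid? T ×-dec ¬? (any? (_⊆? T) (proj₁ rec)))
      (λ ¬any → ¬any ∘ here , ¬any ∘ there)) (≤-reflexive (𝟙-× (avoid? T) _))))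
    (≤-reflexive (sym (∑-filter avoid? F _)))

-- Petals that avoid the other core `S′` are needed, since an element of `S′` outside S could
-- otherwise be shared. An element of `S′ ─ S` lies in at most a proportion 4/n of `G`, so at most
-- 4q/n ≤ 1/32 of `G` is discarded, well within the factor 2 allowed.
module Petals {n q} (n≥ : 43008 ≤ n) (128q≤n : 128 * q ≤ n) {F : List (Subset N)} (size : ∀ {T} → T ∈ F → ∣ T ∣ ≤ n)
  {S : Subset N} (core : Core n q F S) (S′ : Subset N) (small′ : ∣ S′ ∣ ≤ q) where
  open Core core

  avoids? : ∀ T → Dec (T ─ S ⊆ ∁ S′)
  avoids? T = T ─ S ⊆? ∁ S′

  H : List (Subset N)
  H = map (_─ S) (filter avoids? G)

  private
    abstract
      0<n : 0 < n
      0<n = ≤-trans (m<m+n 0 {43008} (s≤s z≤n)) n≥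
    open ≤-Reasoning

    hits : ℕ
    hits = ∑ G (λ T → 𝟙 (¬? (avoids? T)))

    hit : ∀ T → 𝟙 (¬? (avoids? T)) ≤ ∑ (allFin N) (λ e → 𝟙 (e ∈? (S′ ─ S)) * 𝟙 (⁅ e ⁆ ⊆? T))
    hit T = 𝟙≤ (¬? (avoids? T)) (go (nonempty? ((T ─ S) ∩ S′)))
      where
      go : Dec (Nonempty ((T ─ S) ∩ S′)) → ¬ (T ─ S ⊆ ∁ S′) → 1 ≤ ∑ (allFin N) (λ e → 𝟙 (e ∈? (S′ ─ S)) * 𝟙 (⁅ e ⁆ ⊆? T))
      go (no empty) ¬av = ⊥-elim (¬av (λ {x} x∈ → x∉p⇒x∈∁p (λ x∈S′ → empty (x , x∈p∩q⁺ (x∈ , x∈S′)))))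
      go (yes (x , x∈)) ¬av = ≤-trans (≤-reflexive (sym (cong₂ _*_
          (𝟙-yes (x ∈? (S′ ─ S)) (x∈p∧x∉q⇒x∈p─q x∈S′ (x∈p─q⇒x∉q T S x∈T─S))) (𝟙-yes (⁅ x ⁆ ⊆? T) (⁅x⁆⊆ (p─q⊆p T S x∈T─S))))))
          (∑-∈ (λ e → 𝟙 (e ∈? (S′ ─ S)) * 𝟙 (⁅ e ⁆ ⊆? T)) (∈-allFin x))
        where
        x∈T─S = proj₁ (x∈p∩q⁻ (T ─ S) S′ x∈)
        x∈S′ = proj₂ (x∈p∩q⁻ (T ─ S) S′ x∈)

    hits-bound : hits * n ≤ q * (4 * length G)
    hits-bound = begin
      hits * n  ≤⟨ *-monoˡ-≤ n (∑-mono G hit) ⟩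
      ∑ G (λ T → ∑ (allFin N) (λ e → 𝟙 (e ∈? (S′ ─ S)) * 𝟙 (⁅ e ⁆ ⊆? T))) * n  ≡⟨ cong (_* n)
          (∑-swap G (allFin N) (λ T e → 𝟙 (e ∈? (S′ ─ S)) * 𝟙 (⁅ e ⁆ ⊆? T))) ⟩
      ∑ (allFin N) (λ e → ∑ G (λ T → 𝟙 (e ∈? (S′ ─ S)) * 𝟙 (⁅ e ⁆ ⊆? T))) * n  ≡⟨ cong (_* n)
          (∑-cong (allFin N) (λ e → ∑-*ˡ G (𝟙 (e ∈? (S′ ─ S))) _)) ⟩
      ∑ (allFin N) (λ e → 𝟙 (e ∈? (S′ ─ S)) * cnt G ⁅ e ⁆) * n  ≡⟨ sym (∑-*ʳ (allFin N) n _) ⟩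
      ∑ (allFin N) (λ e → 𝟙 (e ∈? (S′ ─ S)) * cnt G ⁅ e ⁆ * n)  ≤⟨ ∑-mono (allFin N) each ⟩
      ∑ (allFin N) (λ e → 𝟙 (e ∈? (S′ ─ S)) * (4 * length G))  ≡⟨ ∑-*ʳ (allFin N) (4 * length G) _ ⟩
      ∑ (allFin N) (λ e → 𝟙 (e ∈? (S′ ─ S))) * (4 * length G)  ≡⟨ cong (_* (4 * length G)) (sym (∣p∣≡∑ (S′ ─ S))) ⟩
      ∣ S′ ─ S ∣ * (4 * length G)  ≤⟨ *-monoˡ-≤ (4 * length G) (≤-trans (∣p─q∣≤∣p∣ S′ S) small′) ⟩
      q * (4 * length G)  ∎
      where
      each : ∀ e → 𝟙 (e ∈? (S′ ─ S)) * cnt G ⁅ e ⁆ * n ≤ 𝟙 (e ∈? (S′ ─ S)) * (4 * length G)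
      each e = ≤-trans (≤-reflexive (*-assoc (𝟙 (e ∈? (S′ ─ S))) _ _)) (𝟙*-mono (e ∈? (S′ ─ S)) λ e∈ →
        subst₂ _≤_ (cong (cnt G ⁅ e ⁆ *_) (trans (cong (n ^_) (one e∈)) (*-identityʳ n)))
            (cong (λ z → 4 ^ z * length G) (one e∈)) (spread ⁅ e ⁆))
        where
        one : e ∈ˢ S′ ─ S → ∣ ⁅ e ⁆ ─ S ∣ ≡ 1
        one e∈ = trans (cong ∣_∣ (disjoint-─ λ x∈ → subst (_∉ˢ S) (sym (x∈⁅y⁆⇒x≡y e x∈)) (x∈p─q⇒x∉q S′ S e∈))) (∣⁅x⁆∣≡1 e)

    len-H : length H ≡ ∑ G (λ T → 𝟙 (avoids? T))
    len-H = trans (List.length-map (_─ S) (filter avoids? G)) (length-filter-∑ avoids? G)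

    len-G : length H + hits ≡ length G
    len-G = trans (cong (_+ hits) len-H) (∑-𝟙-split avoids? G)

  G≤2H : length G ≤ 2 * length H
  G≤2H = +-cancelʳ-≤ (2 * hits) _ _ (begin
    length G + 2 * hits  ≤⟨ +-monoʳ-≤ (length G) 2hits≤G ⟩
    length G + length G  ≡⟨ cong (λ z → z + z) (sym len-G) ⟩
    length H + hits + (length H + hits) ≡⟨ alg (length H) hits ⟩
    2 * length H + 2 * hits ∎)
    where
    alg : ∀ h x → h + x + (h + x) ≡ 2 * h + 2 * x
    alg = solve-∀
    alg₁ : ∀ x n → 2 * x * n ≡ 2 * (x * n)
    alg₁ = solve-∀
    alg₂ : ∀ q l → 2 * (q * (4 * l)) + 120 * q * l ≡ l * (128 * q)
    alg₂ = solve-∀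
    2hits≤G : 2 * hits ≤ length G
    2hits≤G = *-cancelʳ-≤ _ _ n {{>-nonZero 0<n}} (begin
      2 * hits * n  ≡⟨ alg₁ hits n ⟩
      2 * (hits * n)  ≤⟨ *-monoʳ-≤ 2 hits-bound ⟩
      2 * (q * (4 * length G))  ≤⟨ m≤m+n _ _ ⟩
      2 * (q * (4 * length G)) + 120 * q * length G  ≡⟨ alg₂ q (length G) ⟩
      length G * (128 * q)  ≤⟨ *-monoʳ-≤ (length G) 128q≤n ⟩
      length G * n  ∎)

  H-nonempty : 0 < length H
  H-nonempty = *-cancelˡ-< 2 0 (length H) (<-≤-trans nonempty G≤2H)

  ∈-H⁻ : ∀ {U} → U ∈ H → ∃ λ T → T ∈ F × S ⊆ T × U ≡ T ─ S × T ─ S ⊆ ∁ S′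
  ∈-H⁻ U∈ with ∈-map⁻ (_─ S) U∈
  ... | T , T∈ , eq = let T∈G , av = ∈-filter⁻ avoids? T∈ in T , G⊆F T∈G , S⊆ T∈G , eq , av

  H-size : ∀ {U} → U ∈ H → ∣ U ∣ ≤ n
  H-size U∈ with ∈-H⁻ U∈
  ... | T , T∈ , _ , refl , _ = ≤-trans (∣p─q∣≤∣p∣ T S) (size T∈)

  H-spread : ∀ X → cnt H X * n ^ ∣ X ∣ ≤ 4 ^ ∣ X ∣ * (2 * length H)
  H-spread X with X ⊆? ∁ S
  ... | no ¬dis = ≤-trans (≤-reflexive (cong (_* n ^ ∣ X ∣) none)) z≤n
    where
    none : cnt H X ≡ 0
    none = trans (∑-cong-∈ H (λ {U} U∈ → 𝟙-no (X ⊆? U) (λ X⊆U → case-U U∈ X⊆U))) (∑-0 H)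
      where
      case-U : ∀ {U} → U ∈ H → ¬ (X ⊆ U)
      case-U U∈ X⊆U with ∈-H⁻ U∈
      ... | T , _ , _ , refl , _ = ¬dis (λ x∈ → x∉p⇒x∈∁p (x∈p─q⇒x∉q T S (X⊆U x∈)))
  ... | yes dis = begin
    cnt H X * n ^ ∣ X ∣  ≤⟨ *-monoˡ-≤ (n ^ ∣ X ∣) H≤G ⟩
    cnt G X * n ^ ∣ X ∣  ≡⟨ cong (λ Y → cnt G X * n ^ ∣ Y ∣) (sym X─S) ⟩
    cnt G X * n ^ ∣ X ─ S ∣  ≤⟨ spread X ⟩
    4 ^ ∣ X ─ S ∣ * length G  ≡⟨ cong (λ Y → 4 ^ ∣ Y ∣ * length G) X─S ⟩
    4 ^ ∣ X ∣ * length G  ≤⟨ *-monoʳ-≤ (4 ^ ∣ X ∣) G≤2H ⟩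
    4 ^ ∣ X ∣ * (2 * length H)  ∎
    where
    X─S : X ─ S ≡ X
    X─S = disjoint-─ (λ x∈ → x∈∁p⇒x∉p (dis x∈))
    H≤G : cnt H X ≤ cnt G X
    H≤G = begin
      cnt H X  ≡⟨ ∑-map (_─ S) (filter avoids? G) _ ⟩
      ∑ (filter avoids? G) (λ T → 𝟙 (X ⊆? (T ─ S)))  ≤⟨ ∑-filter-≤ avoids? G _ ⟩
      ∑ G (λ T → 𝟙 (X ⊆? (T ─ S)))  ≤⟨ ∑-mono G (λ T → 𝟙-mono (X ⊆? (T ─ S)) (X ⊆? T) (λ s x∈ → p─q⊆p T S (s x∈))) ⟩
      cnt G X  ∎

-- Disjoint petals exist by spreadness. If each also avoids the opposite core, an element common to
-- T and T′ can only lie in S ∩ S′.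
cores-intersect : ∀ {n q t} → 43008 ≤ n → 128 * q ≤ n → {F : List (Subset N)} → (∀ {T} → T ∈ F → ∣ T ∣ ≤ n) →
  (∀ {T T′} → T ∈ F → T′ ∈ F → t ≤ ∣ T ∩ T′ ∣) →
  ∀ {S S′} → Core n q F S → Core n q F S′ → t ≤ ∣ S ∩ S′ ∣
cores-intersect {N} {n = n} {t = t} n≥ 128q≤n {F} size t-int {S} {S′} core core′ =
  conclude (spread-disjoint n n≥ P.H P′.H P.H-nonempty P′.H-nonempty P.H-size P′.H-size P.H-spread P′.H-spread)
  where
  module P = Petals n≥ 128q≤n size core S′ (Core.small core′)
  module P′ = Petals n≥ 128q≤n size core′ S (Core.small core)
  disjoint-petals : ∀ {T T′} → T ∈ F → T′ ∈ F → T ─ S ⊆ ∁ S′ → T′ ─ S′ ⊆ ∁ S → (∀ {x} → x ∈ˢ T ─ S → x ∉ˢ T′ ─ S′) →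
      t ≤ ∣ S ∩ S′ ∣
  disjoint-petals {T} {T′} T∈ T′∈ av av′ dis = ≤-trans (t-int T∈ T′∈) (p⊆q⇒∣p∣≤∣q∣ sub)
    where
    sub : T ∩ T′ ⊆ S ∩ S′
    sub {x} x∈ with x∈p∩q⁻ T T′ x∈ | x ∈? S | x ∈? S′
    ... | _ | yes x∈S | yes x∈S′ = x∈p∩q⁺ (x∈S , x∈S′)
    ... | x∈T , x∈T′ | yes x∈S | no x∉S′ = ⊥-elim (x∈∁p⇒x∉p (av′ (x∈p∧x∉q⇒x∈p─q x∈T′ x∉S′)) x∈S)
    ... | x∈T , x∈T′ | no x∉S | yes x∈S′ = ⊥-elim (x∈∁p⇒x∉p (av (x∈p∧x∉q⇒x∈p─q x∈T x∉S)) x∈S′)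
    ... | x∈T , x∈T′ | no x∉S | no x∉S′ = ⊥-elim (dis (x∈p∧x∉q⇒x∈p─q x∈T x∉S) (x∈p∧x∉q⇒x∈p─q x∈T′ x∉S′))
  conclude : (∃ λ U → ∃ λ U′ → U ∈ P.H × U′ ∈ P′.H × (∀ {x} → x ∈ˢ U → x ∉ˢ U′)) → t ≤ ∣ S ∩ S′ ∣
  conclude (U , U′ , U∈ , U′∈ , dis) = let T , T∈ , _ , eq , av = P.∈-H⁻ U∈ ; T′ , T′∈ , _ , eq′ , av′ = P′.∈-H⁻ U′∈ in
    disjoint-petals T∈ T′∈ av av′ (λ {x} x∈ x∈′ → dis (subst (x ∈ˢ_) (sym eq) x∈) (subst (x ∈ˢ_) (sym eq′) x∈′))

-- Simplifying the cores

subset-of-size : ∀ (p : Subset N) m → m ≤ ∣ p ∣ → ∃ λ r → r ⊆ p × ∣ r ∣ ≡ m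
subset-of-size [] zero z≤n = [] , id , refl
subset-of-size (false ∷ p) m le = let r , r⊆ , eq = subset-of-size p m le in false ∷ r , s⊆s r⊆ , eq
subset-of-size (true ∷ p) zero le = let r , r⊆ , eq = subset-of-size p zero z≤n in false ∷ r , out⊆ r⊆ , eq
subset-of-size (true ∷ p) (suc m) (s≤s le) = let r , r⊆ , eq = subset-of-size p m le in true ∷ r , s⊆s r⊆ , cong suc eq

∣p∪q∣≤∣p∣+∣q∣ : ∀ (p q : Subset N) → ∣ p ∪ q ∣ ≤ ∣ p ∣ + ∣ q ∣
∣p∪q∣≤∣p∣+∣q∣ p q = ≤-trans (≤-reflexive (∣p∪q∣≡∣p∣+∣q─p∣ p q)) (+-monoʳ-≤ ∣ p ∣ (∣p─q∣≤∣p∣ q p))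

∣p∣<∣q∣⇒q─p : ∀ {p q : Subset N} → ∣ p ∣ < ∣ q ∣ → ∃ λ x → x ∈ˢ q × x ∉ˢ p
∣p∣<∣q∣⇒q─p {p = p} {q} lt with nonempty? (q ─ p)
... | yes (x , x∈) = x , p─q⊆p q p x∈ , x∈p─q⇒x∉q q p x∈
... | no empty = ⊥-elim (<⇒≱ lt (p⊆q⇒∣p∣≤∣q∣ λ {x} x∈ → helper x∈ (x ∈? p)))
  where
  helper : ∀ {x} → x ∈ˢ q → Dec (x ∈ˢ p) → x ∈ˢ p
  helper x∈ (yes x∈p) = x∈p
  helper x∈ (no x∉p) = ⊥-elim (empty (_ , x∈p∧x∉q⇒x∈p─q x∈ x∉p))

∣p─∣-antitone : ∀ (p : Subset N) {q r} → q ⊆ r → ∣ p ─ r ∣ ≤ ∣ p ─ q ∣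
∣p─∣-antitone p {q} {r} q⊆r = p⊆q⇒∣p∣≤∣q∣ sub
  where
  sub : p ─ r ⊆ p ─ q
  sub x∈ = x∈p∧x∉q⇒x∈p─q (p─q⊆p p r x∈) (λ x∈q → x∈p─q⇒x∉q p r x∈ (q⊆r x∈q))

p∩r⊆q∩r : ∀ {p q r : Subset N} → p ⊆ q → p ∩ r ⊆ q ∩ r
p∩r⊆q∩r {p = p} {q} {r} p⊆q x∈ = let a , b = x∈p∩q⁻ p r x∈ in x∈p∩q⁺ (p⊆q a , b)

∑-over-subset : ∀ (p : Subset N) (f : Fin N → ℕ) b → (∀ {x} → x ∈ˢ p → f x ≤ b) →
  ∑ (allFin N) (λ x → 𝟙 (x ∈? p) * f x) ≤ ∣ p ∣ * b
∑-over-subset {N} p f b h = ≤-trans (∑-mono (allFin N) (λ x → 𝟙*-mono (x ∈? p) h))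
  (≤-reflexive (trans (∑-*ʳ (allFin N) b _) (cong (_* b) (sym (∣p∣≡∑ p)))))

-- A union bound over witnesses x.
∑-swap-bound : ∀ {A B : Set} {P : A → Set} {I : B → Set} {Q : B → A → Set} (P? : Decidable P) (I? : Decidable I)
    (Q? : ∀ x a → Dec (Q x a))
  (F : List A) (xs : List B) → (∀ {a} → a ∈ F → P a → ∃ λ x → x ∈ xs × I x × Q x a) →
  ∑ F (λ a → 𝟙 (P? a)) ≤ ∑ xs (λ x → 𝟙 (I? x) * ∑ F (λ a → 𝟙 (Q? x a)))
∑-swap-bound {P = P} P? I? Q? F xs h = begin
  ∑ F (λ a → 𝟙 (P? a))  ≤⟨ ∑-mono-∈ F (λ {a} a∈ → 𝟙≤ (P? a) (one a∈)) ⟩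
  ∑ F (λ a → ∑ xs (λ x → 𝟙 (I? x) * 𝟙 (Q? x a)))  ≡⟨ ∑-swap F xs (λ a x → 𝟙 (I? x) * 𝟙 (Q? x a)) ⟩
  ∑ xs (λ x → ∑ F (λ a → 𝟙 (I? x) * 𝟙 (Q? x a)))  ≡⟨ ∑-cong xs (λ x → ∑-*ˡ F (𝟙 (I? x)) _) ⟩
  ∑ xs (λ x → 𝟙 (I? x) * ∑ F (λ a → 𝟙 (Q? x a)))  ∎
  where
  open ≤-Reasoning
  one : ∀ {a} → a ∈ F → P a → 1 ≤ ∑ xs (λ x → 𝟙 (I? x) * 𝟙 (Q? x a))
  one {a} a∈ pa = let x , x∈ , i , q = h a∈ pa in
    ≤-trans (≤-reflexive (sym (cong₂ _*_ (𝟙-yes (I? x) i) (𝟙-yes (Q? x a) q)))) (∑-∈ (λ x → 𝟙 (I? x) * 𝟙 (Q? x a)) x∈)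

empty-or-∈ : ∀ {A : Set} (xs : List A) → xs ≡ [] ⊎ ∃ (_∈ xs)
empty-or-∈ [] = inj₁ refl
empty-or-∈ (x ∷ xs) = inj₂ (x , here refl)

module Simplification {N} (n q t M : ℕ) (0<n : 0 < n) (128q≤n : 128 * q ≤ n) (0<q : 0 < q) (F : List (Subset N))
  (density : ∀ X j → ∣ X ∣ ≡ t + j → cnt F X * n ^ j ≤ 2 ^ j * M) where

  covered : List (Subset N) → ℕ
  covered 𝒯 = ∑ F (λ T → 𝟙 (any? (_⊆? T) 𝒯))

  Intersecting : List (Subset N) → Set
  Intersecting 𝒯 = ∀ {X Y} → X ∈ 𝒯 → Y ∈ 𝒯 → t ≤ ∣ X ∩ Y ∣

  Trivial : List (Subset N) → Set
  Trivial 𝒯 = ∃ λ B → ∣ B ∣ ≡ t × All (B ⊆_) 𝒯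

  module Irreducible (j : ℕ) (0<j : 0 < j) (s≤q : t + j ≤ q) (𝒯 W : List (Subset N)) (int : Intersecting 𝒯)
    (W⊆𝒯 : ∀ {Z} → Z ∈ W → Z ∈ 𝒯) (sizes : ∀ {Y} → Y ∈ 𝒯 → ∣ Y ∣ ≤ t + j) (size-W : ∀ {Z} → Z ∈ W → ∣ Z ∣ ≡ t + j)
    (irreducible : ∀ {Z x} → Z ∈ W → x ∈ˢ Z → ∃ λ Y → Y ∈ 𝒯 × ∣ (Z - x) ∩ Y ∣ < t) where

    open ≤-Reasoning

    between? : ∀ X T → Dec (Any (λ Z → X ⊆ Z × Z ⊆ T) W)
    between? X T = any? (λ Z → (X ⊆? Z) ×-dec (Z ⊆? T)) W

    above : Subset N → ℕ
    above X = ∑ F (λ T → 𝟙 (between? X T))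

    -- If X is properly contained in some Z of W, an element of Z outside X cannot be deleted from
    -- Z, so some Y has |X ∩ Y| < t. Every set of W above X meets Y in t elements and hence contains
    -- one of the at most 2j elements of Y ─ X. Branching over these i times reaches sets of size t
    -- + j, where `density` applies.
    above-bound : ∀ i X → ∣ X ∣ + i ≡ t + j → (∀ {Y} → Y ∈ 𝒯 → ∣ Y ─ X ∣ ≤ 2 * j) → above X * n ^ j ≤ (2 * j) ^ i *
        (2 ^ j * M)
    above-bound zero X size _ = begin
      above X * n ^ j  ≤⟨ *-monoˡ-≤ (n ^ j) (∑-mono F (λ T → 𝟙-mono (between? X T) (X ⊆? T) (λ b → let Z , _ , X⊆Z , Z⊆T = find b in ⊆-trans X⊆Z Z⊆T))) ⟩
      cnt F X * n ^ j  ≤⟨ density X j (trans (sym (+-identityʳ _)) size) ⟩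
      2 ^ j * M  ≡⟨ sym (*-identityˡ _) ⟩
      (2 * j) ^ zero * (2 ^ j * M) ∎
    above-bound (suc i) X size few with any? (X ⊆?_) W
    ... | no none = ≤-trans (≤-reflexive (cong (_* n ^ j) (trans
        (∑-cong F (λ T → 𝟙-no (between? X T) (λ b → none (Any.map proj₁ b)))) (∑-0 F)))) z≤n
    ... | yes some with find some
    ... | Z , Z∈ , X⊆Z with ∣p∣<∣q∣⇒q─p {p = X} {Z} (subst (∣ X ∣ <_) (trans size (sym (size-W Z∈))) (m<m+n ∣ X ∣ (s≤s z≤n)))
    ... | x , x∈Z , x∉X with irreducible Z∈ x∈Z
    ... | Y , Y∈ , small = begin
      above X * n ^ j
        ≤⟨ *-monoˡ-≤ (n ^ j) (∑-swap-bound (between? X) (_∈? (Y ─ X)) (λ e → between? (X ∪ ⁅ e ⁆)) F (allFin N) (λ _ b → let e , p , r = extend b in e , ∈-allFin e , p , r)) ⟩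
      ∑ (allFin N) (λ e → 𝟙 (e ∈? (Y ─ X)) * above (X ∪ ⁅ e ⁆)) * n ^ j  ≡⟨ sym (∑-*ʳ (allFin N) (n ^ j) _) ⟩
      ∑ (allFin N) (λ e → 𝟙 (e ∈? (Y ─ X)) * above (X ∪ ⁅ e ⁆) * n ^ j)  ≡⟨ ∑-cong (allFin N)
          (λ e → *-assoc (𝟙 (e ∈? (Y ─ X))) _ _) ⟩
      ∑ (allFin N) (λ e → 𝟙 (e ∈? (Y ─ X)) * (above (X ∪ ⁅ e ⁆) * n ^ j))  ≤⟨ ∑-over-subset (Y ─ X) _ _ next ⟩
      ∣ Y ─ X ∣ * ((2 * j) ^ i * (2 ^ j * M))  ≤⟨ *-monoˡ-≤ _ (few Y∈) ⟩
      2 * j * ((2 * j) ^ i * (2 ^ j * M))  ≡⟨ sym (*-assoc (2 * j) _ _) ⟩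
      (2 * j) ^ suc i * (2 ^ j * M)  ∎
      where
      X⊆Z-x : X ⊆ Z - x
      X⊆Z-x {y} y∈ = x∈p∧x≢y⇒x∈p-y (X⊆Z y∈) (λ { refl → x∉X y∈ })
      X∩Y<t : ∣ X ∩ Y ∣ < t
      X∩Y<t = ≤-<-trans (p⊆q⇒∣p∣≤∣q∣ (p∩r⊆q∩r {r = Y} X⊆Z-x)) small
      extend : ∀ {T} → Any (λ Z → X ⊆ Z × Z ⊆ T) W → ∃ λ e → e ∈ˢ Y ─ X × Any (λ Z → X ∪ ⁅ e ⁆ ⊆ Z × Z ⊆ T) W
      extend b with find b
      ... | Z′ , Z′∈ , X⊆Z′ , Z′⊆T with ∣p∣<∣q∣⇒q─p {p = X ∩ Y} {Z′ ∩ Y} (<-≤-trans X∩Y<t (int (W⊆𝒯 Z′∈) Y∈))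
      ... | e , e∈ , e∉ with x∈p∩q⁻ Z′ Y e∈
      ... | e∈Z′ , e∈Y = e , x∈p∧x∉q⇒x∈p─q e∈Y (λ e∈X → e∉ (x∈p∩q⁺ (e∈X , e∈Y))) , lose Z′∈ (∪-lub X⊆Z′ (⁅x⁆⊆ e∈Z′) , Z′⊆T)
      next : ∀ {e} → e ∈ˢ Y ─ X → above (X ∪ ⁅ e ⁆) * n ^ j ≤ (2 * j) ^ i * (2 ^ j * M)
      next {e} e∈ = above-bound i (X ∪ ⁅ e ⁆)
        (trans (cong (_+ i) (∣p∪⁅x⁆∣≡1+∣p∣ (x∈p─q⇒x∉q Y X e∈))) (trans (sym (+-suc ∣ X ∣ i)) size))
        (λ {Y′} Y′∈ → ≤-trans (∣p─∣-antitone Y′ {X} {X ∪ ⁅ e ⁆} (p⊆p∪q ⁅ e ⁆)) (few Y′∈))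

    -- One term of the expansion of (s+j)^s with s = t + j: the binomial coefficient times s^t j^j
    -- is at most (s+j)^s ≤ 4^j s^s.
    binomial : ∀ {Y} → ∣ Y ∣ ≡ t + j →
      ∑ (subsets N) (λ X → 𝟙 ((X ⊆? Y) ×-dec (∣ X ∣ ≟ t))) * j ^ j ≤ 4 ^ j * (t + j) ^ j
    binomial {Y} eq = *-cancelʳ-≤ _ _ (s ^ t) {{m^n≢0 s t {{>-nonZero 0<s}}}} (begin
      C * j ^ j * s ^ t  ≡⟨ alg C (j ^ j) (s ^ t) ⟩
      C * (s ^ t * j ^ j)  ≡⟨ sym (∑-*ʳ (subsets N) (s ^ t * j ^ j) _) ⟩
      ∑ (subsets N) (λ X → 𝟙 ((X ⊆? Y) ×-dec (∣ X ∣ ≟ t)) * (s ^ t * j ^ j))  ≤⟨ ∑-mono (subsets N) each ⟩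
      ∑ (subsets N) (λ X → 𝟙 (X ⊆? Y) * (s ^ ∣ X ∣ * j ^ (s ∸ ∣ X ∣)))  ≤⟨ ∑-⊆-binomial s j s Y (≤-reflexive eq) ⟩
      (j + s) ^ s  ≡⟨ cong (_^ s) (+-comm j s) ⟩
      (s + j) ^ s  ≤⟨ [s+j]^s≤4^j*s^s s j 0<s ⟩
      4 ^ j * s ^ (t + j)  ≡⟨ cong (4 ^ j *_) (^-distribˡ-+-* s t j) ⟩
      4 ^ j * (s ^ t * s ^ j)  ≡⟨ alg₂ (4 ^ j) (s ^ t) (s ^ j) ⟩
      4 ^ j * s ^ j * s ^ t  ∎)
      where
      s = t + j
      C = ∑ (subsets N) (λ X → 𝟙 ((X ⊆? Y) ×-dec (∣ X ∣ ≟ t)))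
      0<s : 0 < s
      0<s = ≤-trans 0<j (m≤n+m j t)
      alg : ∀ c a b → c * a * b ≡ c * (b * a)
      alg = solve-∀
      alg₂ : ∀ c a b → c * (a * b) ≡ c * b * a
      alg₂ = solve-∀
      each : ∀ X → 𝟙 ((X ⊆? Y) ×-dec (∣ X ∣ ≟ t)) * (s ^ t * j ^ j) ≤ 𝟙 (X ⊆? Y) * (s ^ ∣ X ∣ * j ^ (s ∸ ∣ X ∣))
      each X = begin
        𝟙 ((X ⊆? Y) ×-dec (∣ X ∣ ≟ t)) * (s ^ t * j ^ j)  ≡⟨ cong (_* (s ^ t * j ^ j)) (𝟙-× (X ⊆? Y) (∣ X ∣ ≟ t)) ⟩
        𝟙 (X ⊆? Y) * 𝟙 (∣ X ∣ ≟ t) * (s ^ t * j ^ j)  ≡⟨ *-assoc (𝟙 (X ⊆? Y)) _ _ ⟩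
        𝟙 (X ⊆? Y) * (𝟙 (∣ X ∣ ≟ t) * (s ^ t * j ^ j))  ≡⟨ cong (𝟙 (X ⊆? Y) *_)
            (𝟙*-cong (∣ X ∣ ≟ t) (λ eq → cong₂ (λ a b → s ^ a * j ^ b) (sym eq)
            (sym (trans (cong (s ∸_) eq) (m+n∸m≡n t j))))) ⟩
        𝟙 (X ⊆? Y) * (𝟙 (∣ X ∣ ≟ t) * (s ^ ∣ X ∣ * j ^ (s ∸ ∣ X ∣)))  ≤⟨ *-monoʳ-≤ (𝟙 (X ⊆? Y)) (𝟙*≤ (∣ X ∣ ≟ t) _) ⟩
        𝟙 (X ⊆? Y) * (s ^ ∣ X ∣ * j ^ (s ∸ ∣ X ∣))  ∎

    -- Both `Y ─ Y₀` and `Y₀ ─ X` have at most j elements, because t of the at most t + j elements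
    -- are common.
    deficit : ∀ {Y Y₀ X} → Y ∈ 𝒯 → Y₀ ∈ W → X ⊆ Y₀ → ∣ X ∣ ≡ t → ∣ Y ─ X ∣ ≤ 2 * j
    deficit {Y} {Y₀} {X} Y∈ Y₀∈ X⊆ eq = begin
      ∣ Y ─ X ∣  ≤⟨ p⊆q⇒∣p∣≤∣q∣ sub ⟩
      ∣ (Y ─ Y₀) ∪ (Y₀ ─ X) ∣  ≤⟨ ∣p∪q∣≤∣p∣+∣q∣ (Y ─ Y₀) (Y₀ ─ X) ⟩
      ∣ Y ─ Y₀ ∣ + ∣ Y₀ ─ X ∣  ≤⟨ +-mono-≤ (over (∣p∣≡∣p∩q∣+∣p─q∣ Y Y₀) (int Y∈ (W⊆𝒯 Y₀∈)) (sizes Y∈))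
                                          (over (∣p∣≡∣p∩q∣+∣p─q∣ Y₀ X)
                                              (subst (_≤ ∣ Y₀ ∩ X ∣) eq (p⊆q⇒∣p∣≤∣q∣ (λ x∈ → x∈p∩q⁺ (X⊆ x∈ , x∈))))
                                              (≤-reflexive (size-W Y₀∈))) ⟩
      j + j  ≡⟨ cong (j +_) (sym (+-identityʳ j)) ⟩
      2 * j  ∎
      where
      over : ∀ {a b c} → a ≡ b + c → t ≤ b → a ≤ t + j → c ≤ j
      over {a} {b} {c} e t≤b a≤ = +-cancelˡ-≤ t _ _ (≤-trans (+-monoˡ-≤ c t≤b) (≤-trans (≤-reflexive (sym e)) a≤))
      sub : Y ─ X ⊆ (Y ─ Y₀) ∪ (Y₀ ─ X)
      sub {x} x∈ with x ∈? Y₀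
      ... | yes x∈Y₀ = x∈p∪q⁺ (inj₂ (x∈p∧x∉q⇒x∈p─q x∈Y₀ (x∈p─q⇒x∉q Y X x∈)))
      ... | no x∉Y₀ = x∈p∪q⁺ (inj₁ (x∈p∧x∉q⇒x∈p─q (p─q⊆p Y X x∈) x∉Y₀))

    -- Every set of W shares some t-set X with Y₀; j branching steps complete X. With the bounds on
    -- the choices of X and on the branching, at most (16 (t+j) / n)^j M members are covered, which
    -- is at most M / 8^j because 128 q ≤ n.
    covered-bound : 2 ^ (j + 2) * covered W ≤ M
    covered-bound with empty-or-∈ W
    ... | inj₁ refl = ≤-trans (≤-reflexive (trans (cong (2 ^ (j + 2) *_) (∑-0 F)) (*-zeroʳ (2 ^ (j + 2))))) z≤n
    ... | inj₂ (Y₀ , Y₀∈) = begin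
      2 ^ (j + 2) * covered W  ≤⟨ *-monoˡ-≤ (covered W) 2^[j+2]≤8^j ⟩
      8 ^ j * covered W  ≤⟨ *-cancelʳ-≤ _ _ (16 ^ j * q ^ j) {{m*n≢0 (16 ^ j)
          (q ^ j) {{m^n≢0 16 j}} {{m^n≢0 q j {{>-nonZero 0<q}}}}}} main ⟩
      M  ∎
      where
      s = t + j
      C = ∑ (subsets N) (λ X → 𝟙 ((X ⊆? Y₀) ×-dec (∣ X ∣ ≟ t)))
      2^[j+2]≤8^j : 2 ^ (j + 2) ≤ 8 ^ j
      2^[j+2]≤8^j = begin
        2 ^ (j + 2)  ≡⟨ ^-distribˡ-+-* 2 j 2 ⟩
        2 ^ j * 4 ^ 1  ≤⟨ *-monoʳ-≤ (2 ^ j) (^-monoʳ-≤ 4 0<j) ⟩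
        2 ^ j * 4 ^ j  ≡⟨ sym (^-distribʳ-* j 2 4) ⟩
        8 ^ j  ∎
      through : ∀ {T} → Any (_⊆ T) W → ∃ λ X → X ∈ subsets N × (X ⊆ Y₀ × ∣ X ∣ ≡ t) × Any (λ Z → X ⊆ Z × Z ⊆ T) W
      through a with find a
      ... | Z , Z∈ , Z⊆T with subset-of-size (Z ∩ Y₀) t (int (W⊆𝒯 Z∈) (W⊆𝒯 Y₀∈))
      ... | X , X⊆ , eq = X , ∈-subsets X , (⊆-trans X⊆ (p∩q⊆q Z Y₀) , eq) , lose Z∈ (⊆-trans X⊆ (p∩q⊆p Z Y₀) , Z⊆T)
      first : covered W * n ^ j ≤ C * ((2 * j) ^ j * (2 ^ j * M))
      first = begin
        covered W * n ^ j  ≤⟨ *-monoˡ-≤ (n ^ j) (∑-swap-bound (λ T → any? (_⊆? T) W)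
            (λ X → (X ⊆? Y₀) ×-dec (∣ X ∣ ≟ t)) between? F (subsets N) (λ _ → through)) ⟩
        ∑ (subsets N) (λ X → 𝟙 ((X ⊆? Y₀) ×-dec (∣ X ∣ ≟ t)) * above X) * n ^ j  ≡⟨ sym (∑-*ʳ (subsets N) (n ^ j) _) ⟩
        ∑ (subsets N) (λ X → 𝟙 ((X ⊆? Y₀) ×-dec (∣ X ∣ ≟ t)) * above X * n ^ j)
          ≤⟨ ∑-mono (subsets N) (λ X → ≤-trans (≤-reflexive (*-assoc (𝟙 ((X ⊆? Y₀) ×-dec (∣ X ∣ ≟ t))) _ _))
               (𝟙*-mono ((X ⊆? Y₀) ×-dec (∣ X ∣ ≟ t)) (λ (X⊆ , eq) → above-bound j X (cong (_+ j) eq)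
                   (λ Y∈ → deficit Y∈ Y₀∈ X⊆ eq)))) ⟩
        ∑ (subsets N) (λ X → 𝟙 ((X ⊆? Y₀) ×-dec (∣ X ∣ ≟ t)) * ((2 * j) ^ j * (2 ^ j * M)))  ≡⟨ ∑-*ʳ (subsets N) _ _ ⟩
        C * ((2 * j) ^ j * (2 ^ j * M))  ∎
      pow₁ : 4 ^ j * (2 ^ j * 2 ^ j) ≡ 16 ^ j
      pow₁ = trans (cong (4 ^ j *_) (sym (^-distribʳ-* j 2 2))) (sym (^-distribʳ-* j 4 4))
      pow₂ : 8 ^ j * 16 ^ j ≡ 128 ^ j
      pow₂ = sym (^-distribʳ-* j 8 16)
      alg₁ : ∀ e u p r → e * u * (p * r) ≡ u * (e * p * r)
      alg₁ = solve-∀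
      alg₂ : ∀ c a b m → c * (a * b * (a * m)) ≡ c * b * (a * a * m)
      alg₂ = solve-∀
      alg₃ : ∀ f r a m → f * r * (a * m) ≡ m * (f * a * r)
      alg₃ = solve-∀
      main : 8 ^ j * covered W * (16 ^ j * q ^ j) ≤ M * (16 ^ j * q ^ j)
      main = begin
        8 ^ j * covered W * (16 ^ j * q ^ j)  ≡⟨ alg₁ (8 ^ j) (covered W) (16 ^ j) (q ^ j) ⟩
        covered W * (8 ^ j * 16 ^ j * q ^ j)  ≡⟨ cong (covered W *_)
            (trans (cong (_* q ^ j) pow₂) (sym (^-distribʳ-* j 128 q))) ⟩
        covered W * (128 * q) ^ j  ≤⟨ *-monoʳ-≤ (covered W) (^-monoˡ-≤ j 128q≤n) ⟩
        covered W * n ^ j  ≤⟨ first ⟩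
        C * ((2 * j) ^ j * (2 ^ j * M))  ≡⟨ cong (λ z → C * (z * (2 ^ j * M))) (^-distribʳ-* j 2 j) ⟩
        C * (2 ^ j * j ^ j * (2 ^ j * M))  ≡⟨ alg₂ C (2 ^ j) (j ^ j) M ⟩
        C * j ^ j * (2 ^ j * 2 ^ j * M)  ≤⟨ *-monoˡ-≤ _ (binomial (size-W Y₀∈)) ⟩
        4 ^ j * s ^ j * (2 ^ j * 2 ^ j * M)  ≤⟨ *-monoˡ-≤ _ (*-monoʳ-≤ (4 ^ j) (^-monoˡ-≤ j s≤q)) ⟩
        4 ^ j * q ^ j * (2 ^ j * 2 ^ j * M)  ≡⟨ alg₃ (4 ^ j) (q ^ j) (2 ^ j * 2 ^ j) M ⟩
        M * (4 ^ j * (2 ^ j * 2 ^ j) * q ^ j)  ≡⟨ cong (λ z → M * (z * q ^ j)) pow₁ ⟩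
        M * (16 ^ j * q ^ j)  ∎

  -- That is, at most (1/2 - 2^-(j+2)) M members are covered. The next layer adds at most 2^-(j+3)
  -- M, so the bound passes from j to j + 1 and stays below M/2.
  Small : ℕ → List (Subset N) → Set
  Small j 𝒯 = 2 ^ (j + 2) * covered 𝒯 + M ≤ 2 ^ (j + 1) * M

  covered-mono : ∀ {𝒯 𝒯′} → (∀ {Y T} → Y ∈ 𝒯 → Y ⊆ T → Any (_⊆ T) 𝒯′) → covered 𝒯 ≤ covered 𝒯′
  covered-mono {𝒯} {𝒯′} h = ∑-mono F (λ T → 𝟙-mono (any? (_⊆? T) 𝒯) (any? (_⊆? T) 𝒯′) (λ a → let _ , Y∈ , Y⊆T = find a in h Y∈ Y⊆T))

  Reducible : ℕ → List (Subset N) → Subset N → Set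
  Reducible s 𝒯 Z = ∣ Z ∣ ≡ s × ∃ λ x → x ∈ˢ Z × All (λ Y → t ≤ ∣ (Z - x) ∩ Y ∣) 𝒯

  reducible? : ∀ s 𝒯 Z → Dec (Reducible s 𝒯 Z)
  reducible? s 𝒯 Z = (∣ Z ∣ ≟ s) ×-dec anyᶠ? (λ x → (x ∈? Z) ×-dec all? (λ Y → t ≤? ∣ (Z - x) ∩ Y ∣) 𝒯)

  -- A set Y of the family contains B and shares t elements with Z, while B is not inside Z; so Y
  -- also contains an element of Z ─ B. There are at most q such elements, each accounting for at
  -- most 2M/n members.
  trivial-rest : ∀ {𝒯 B Z} → ∣ B ∣ ≡ t → All (B ⊆_) 𝒯 → ¬ B ⊆ Z → ∣ Z ∣ ≤ q → (∀ {Y} → Y ∈ 𝒯 → t ≤ ∣ Y ∩ Z ∣) →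
      4 * covered 𝒯 ≤ M
  trivial-rest {𝒯} {B} {Z} eq B⊆ B⊈Z Z≤q meets = *-cancelʳ-≤ _ _ n {{>-nonZero 0<n}} (begin
    4 * covered 𝒯 * n  ≡⟨ *-assoc 4 (covered 𝒯) n ⟩
    4 * (covered 𝒯 * n)  ≤⟨ *-monoʳ-≤ 4 bound ⟩
    4 * (q * (2 * M))  ≤⟨ m≤m+n _ (120 * (q * M)) ⟩
    4 * (q * (2 * M)) + 120 * (q * M) ≡⟨ alg q M ⟩
    M * (128 * q)  ≤⟨ *-monoʳ-≤ M 128q≤n ⟩
    M * n  ∎)
    where
    open ≤-Reasoning
    alg : ∀ q M → 4 * (q * (2 * M)) + 120 * (q * M) ≡ M * (128 * q)
    alg = solve-∀
    element : ∀ {T} → Any (_⊆ T) 𝒯 → ∃ λ e → e ∈ allFin N × e ∈ˢ Z ─ B × B ∪ ⁅ e ⁆ ⊆ T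
    element a with find a
    ... | Y , Y∈ , Y⊆T with nonempty? ((Y ∩ Z) ─ B)
    ... | yes (e , e∈) = let e∈Y , e∈Z = x∈p∩q⁻ Y Z (p─q⊆p (Y ∩ Z) B e∈) in
          e , ∈-allFin e , x∈p∧x∉q⇒x∈p─q e∈Z (x∈p─q⇒x∉q (Y ∩ Z) B e∈) , ⊆-trans (∪-lub (All.lookup B⊆ Y∈) (⁅x⁆⊆ e∈Y)) Y⊆T
    ... | no empty = ⊥-elim (B⊈Z (subst (_⊆ Z) Y∩Z≡B (p∩q⊆q Y Z)))
      where
      sub : Y ∩ Z ⊆ B
      sub {x} x∈ with x ∈? B
      ... | yes x∈B = x∈B
      ... | no x∉B = ⊥-elim (empty (x , x∈p∧x∉q⇒x∈p─q x∈ x∉B))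
      Y∩Z≡B : Y ∩ Z ≡ B
      Y∩Z≡B = p⊆q∧∣q∣≤∣p∣⇒p≡q sub (≤-trans (≤-reflexive eq) (meets Y∈))
    bound : covered 𝒯 * n ≤ q * (2 * M)
    bound = begin
      covered 𝒯 * n  ≤⟨ *-monoˡ-≤ n (∑-swap-bound (λ T → any? (_⊆? T) 𝒯) (_∈? (Z ─ B)) (λ e T → (B ∪ ⁅ e ⁆) ⊆? T) F
          (allFin N) (λ _ → element)) ⟩
      ∑ (allFin N) (λ e → 𝟙 (e ∈? (Z ─ B)) * cnt F (B ∪ ⁅ e ⁆)) * n  ≡⟨ sym (∑-*ʳ (allFin N) n _) ⟩
      ∑ (allFin N) (λ e → 𝟙 (e ∈? (Z ─ B)) * cnt F (B ∪ ⁅ e ⁆) * n)  ≡⟨ ∑-cong (allFin N)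
          (λ e → *-assoc (𝟙 (e ∈? (Z ─ B))) _ _) ⟩
      ∑ (allFin N) (λ e → 𝟙 (e ∈? (Z ─ B)) * (cnt F (B ∪ ⁅ e ⁆) * n))  ≤⟨ ∑-over-subset (Z ─ B) _ _ each ⟩
      ∣ Z ─ B ∣ * (2 * M)  ≤⟨ *-monoˡ-≤ (2 * M) (≤-trans (∣p─q∣≤∣p∣ Z B) Z≤q) ⟩
      q * (2 * M)  ∎
      where
      each : ∀ {e} → e ∈ˢ Z ─ B → cnt F (B ∪ ⁅ e ⁆) * n ≤ 2 * M
      each {e} e∈ = subst (λ z → cnt F (B ∪ ⁅ e ⁆) * z ≤ 2 * M) (*-identityʳ n)
        (density (B ∪ ⁅ e ⁆) 1 (trans (∣p∪⁅x⁆∣≡1+∣p∣ (x∈p─q⇒x∉q Z B e∈)) (trans (cong suc eq) (+-comm 1 t))))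

  total : List (Subset N) → ℕ
  total 𝒯 = ∑ 𝒯 ∣_∣

  Simplified : ℕ → Set
  Simplified j = ∀ 𝒯 → Intersecting 𝒯 → (∀ {Y} → Y ∈ 𝒯 → ∣ Y ∣ ≤ t + j) → Trivial 𝒯 ⊎ Small j 𝒯

  -- Deleting an element from a core only enlarges the set of members covered, and a common B of the
  -- reduced family is common to the original one, so both outcomes carry back. The total size of
  -- the cores decreases, which bounds the number of deletions. When none is possible the top layer
  -- is irreducible, and the smaller cores fall to the previous layer.
  reduce-layer : ∀ j → t + suc j ≤ q → Simplified j → ∀ fuel 𝒯 → total 𝒯 ≤ fuel → Intersecting 𝒯 →
    (∀ {Y} → Y ∈ 𝒯 → ∣ Y ∣ ≤ t + suc j) → Trivial 𝒯 ⊎ Small (suc j) 𝒯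
  reduce-layer j s≤q rec fuel 𝒯 le int sizes with any? (reducible? (t + suc j) 𝒯) 𝒯
  reduce-layer j s≤q rec fuel 𝒯 le int sizes | yes red with find red
  ... | Z , Z∈ , _ , x , x∈Z , all with ∈-∃++ Z∈
  ... | as , bs , refl = reduce fuel le
    where
    open ≤-Reasoning
    𝒯′ = as ++ (Z - x) ∷ bs
    new : (Z - x) ∈ 𝒯′
    new = ∈-++⁺ʳ as (here refl)
    old : ∀ {Y} → Y ∈ 𝒯′ → Y ≡ Z - x ⊎ Y ∈ 𝒯
    old Y∈ with ∈-++⁻ as Y∈
    ... | inj₁ p = inj₂ (∈-++⁺ˡ p)
    ... | inj₂ (here eq) = inj₁ eq
    ... | inj₂ (there p) = inj₂ (∈-++⁺ʳ as (there p))
    kept : ∀ {Y} → Y ∈ 𝒯 → Y ≡ Z ⊎ Y ∈ 𝒯′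
    kept Y∈ with ∈-++⁻ as Y∈
    ... | inj₁ p = inj₂ (∈-++⁺ˡ p)
    ... | inj₂ (here eq) = inj₁ eq
    ... | inj₂ (there p) = inj₂ (∈-++⁺ʳ as (there p))
    int′ : Intersecting 𝒯′
    int′ {X} {Y} X∈ Y∈ with old X∈ | old Y∈
    -- The condition for Y = Z ensures that `Z - x` still has at least t elements.
    ... | inj₁ refl | inj₁ refl = ≤-trans (All.lookup all Z∈) (p⊆q⇒∣p∣≤∣q∣ λ y∈ → let a = p∩q⊆p (Z - x) Z y∈ in x∈p∩q⁺ (a , a))
    ... | inj₁ refl | inj₂ Y∈𝒯 = All.lookup all Y∈𝒯
    ... | inj₂ X∈𝒯 | inj₁ refl = subst (λ s → t ≤ ∣ s ∣) (∩-comm (Z - x) X) (All.lookup all X∈𝒯)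
    ... | inj₂ X∈𝒯 | inj₂ Y∈𝒯 = int X∈𝒯 Y∈𝒯
    sizes′ : ∀ {Y} → Y ∈ 𝒯′ → ∣ Y ∣ ≤ t + suc j
    sizes′ Y∈ with old Y∈
    ... | inj₁ refl = ≤-trans (∣p─q∣≤∣p∣ Z ⁅ x ⁆) (sizes Z∈)
    ... | inj₂ Y∈𝒯 = sizes Y∈𝒯
    smaller : total 𝒯′ < total (as ++ Z ∷ bs)
    smaller = begin-strict
      total 𝒯′  ≡⟨ ∑-++ as _ ∣_∣ ⟩
      total as + (∣ Z - x ∣ + total bs)  <⟨ +-monoʳ-< (total as) (+-monoˡ-< (total bs) (x∈p⇒∣p-x∣<∣p∣ x∈Z)) ⟩
      total as + (∣ Z ∣ + total bs)  ≡⟨ sym (∑-++ as _ ∣_∣) ⟩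
      total (as ++ Z ∷ bs)  ∎
    still : ∀ {Y T} → Y ⊆ T → Y ≡ Z ⊎ Y ∈ 𝒯′ → Any (_⊆ T) 𝒯′
    still {T = T} Z⊆T (inj₁ refl) = lose new sub
      where
      sub : Z - x ⊆ T
      sub y∈ = Z⊆T (p─q⊆p Z ⁅ x ⁆ y∈)
    still Y⊆T (inj₂ Y∈) = lose Y∈ Y⊆T
    reduce : ∀ fuel → total (as ++ Z ∷ bs) ≤ fuel → Trivial (as ++ Z ∷ bs) ⊎ Small (suc j) (as ++ Z ∷ bs)
    reduce zero le = ⊥-elim (<⇒≱ (≤-<-trans z≤n smaller) le)
    reduce (suc fuel) le with reduce-layer j s≤q rec fuel 𝒯′ (s≤s⁻¹ (≤-trans smaller le)) int′ sizes′
    ... | inj₁ (B , eq , B⊆) = inj₁ (B , eq , All.tabulate λ Y∈ → [ (λ { refl → ⊆-trans (All.lookup B⊆ new) (p─q⊆p Z ⁅ x ⁆) }) , All.lookup B⊆ ]′ (kept Y∈))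
    ... | inj₂ small = inj₂ (≤-trans (+-monoˡ-≤ M (*-monoʳ-≤ (2 ^ (suc j + 2)) (covered-mono λ Y∈ Y⊆T →
            still Y⊆T (kept Y∈)))) small)
  reduce-layer j s≤q rec fuel 𝒯 le int sizes | no irr = add-layer (rec 𝒯⁻ (λ X∈ Y∈ → int (rest∈ X∈) (rest∈ Y∈)) sizes⁻)
    where
    open ≤-Reasoning
    s = t + suc j
    top? = λ (Z : Subset N) → ∣ Z ∣ ≟ s
    W = filter top? 𝒯
    𝒯⁻ = filter (¬? ∘ top?) 𝒯
    rest∈ : ∀ {Y} → Y ∈ 𝒯⁻ → Y ∈ 𝒯
    rest∈ = proj₁ ∘ ∈-filter⁻ (¬? ∘ top?)
    W∈ : ∀ {Y} → Y ∈ W → Y ∈ 𝒯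
    W∈ = proj₁ ∘ ∈-filter⁻ top?
    sizes⁻ : ∀ {Y} → Y ∈ 𝒯⁻ → ∣ Y ∣ ≤ t + j
    sizes⁻ Y∈ = let Y∈𝒯 , ≢s = ∈-filter⁻ (¬? ∘ top?) Y∈ in s≤s⁻¹ (≤-trans (≤∧≢⇒< (sizes Y∈𝒯) ≢s) (≤-reflexive (+-suc t j)))
    size-W : ∀ {Z} → Z ∈ W → ∣ Z ∣ ≡ s
    size-W Z∈ = proj₂ (∈-filter⁻ top? {xs = 𝒯} Z∈)
    irreducible : ∀ {Z x} → Z ∈ W → x ∈ˢ Z → ∃ λ Y → Y ∈ 𝒯 × ∣ (Z - x) ∩ Y ∣ < t
    irreducible {Z} {x} Z∈ x∈ =
      let Y , Y∈ , ¬le = find (¬All⇒Any¬ (λ Y → t ≤? ∣ (Z - x) ∩ Y ∣) 𝒯 (λ all → irr (lose (W∈ Z∈) (size-W Z∈ , x , x∈ , all))))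
      in Y , Y∈ , ≰⇒> ¬le
    module Top = Irreducible (suc j) (s≤s z≤n) s≤q 𝒯 W int W∈ sizes size-W irreducible
    two = 2 ^ (j + 1)
    two≡ : 2 ^ (j + 2) ≡ 2 * two
    two≡ = cong (2 ^_) (+-suc j 1)
    split : covered 𝒯 ≤ covered W + covered 𝒯⁻
    split = ≤-trans (∑-mono F (λ T → 𝟙≤ (any? (_⊆? T) 𝒯) (λ a → in-one T (find a)))) (≤-reflexive (∑-+ F _ _))
      where
      in-one : ∀ T → (∃ λ Y → Y ∈ 𝒯 × Y ⊆ T) → 1 ≤ 𝟙 (any? (_⊆? T) W) + 𝟙 (any? (_⊆? T) 𝒯⁻)
      in-one T (Y , Y∈ , Y⊆T) with top? Y
      ... | yes eq = ≤-trans (≤-reflexive (sym (𝟙-yes (any? (_⊆? T) W) (lose (∈-filter⁺ top? Y∈ eq) Y⊆T)))) (m≤m+n _ _)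
      ... | no neq = ≤-trans (≤-reflexive (sym (𝟙-yes (any? (_⊆? T) 𝒯⁻) (lose (∈-filter⁺ (¬? ∘ top?) Y∈ neq) Y⊆T))))
          (m≤n+m _ _)
    assemble : ∀ r → 2 ^ (suc j + 2) * covered 𝒯⁻ ≤ r → M + r + M ≤ 2 * two * M → Small (suc j) 𝒯
    assemble r h h′ = ≤-trans (+-monoˡ-≤ M (begin
      2 ^ (suc j + 2) * covered 𝒯  ≤⟨ *-monoʳ-≤ (2 ^ (suc j + 2)) split ⟩
      2 ^ (suc j + 2) * (covered W + covered 𝒯⁻)  ≡⟨ *-distribˡ-+ (2 ^ (suc j + 2)) _ _ ⟩
      2 ^ (suc j + 2) * covered W + 2 ^ (suc j + 2) * covered 𝒯⁻  ≤⟨ +-mono-≤ Top.covered-bound h ⟩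
      M + r  ∎)) h′
    alg₁ : ∀ p u M → M + 2 * p * u + M ≡ 2 * (p * u + M)
    alg₁ = solve-∀
    alg₂ : ∀ w u → 2 * (2 * w) * u ≡ w * (4 * u)
    alg₂ = solve-∀
    alg₃ : ∀ w M → M + w * M + M ≡ 2 * M + w * M
    alg₃ = solve-∀
    alg₄ : ∀ w M → w * M + w * M ≡ 2 * w * M
    alg₄ = solve-∀
    add-layer : Trivial 𝒯⁻ ⊎ Small j 𝒯⁻ → Trivial 𝒯 ⊎ Small (suc j) 𝒯
    add-layer (inj₂ small) = inj₂ (assemble _ ≤-refl (begin
      M + 2 ^ (suc j + 2) * covered 𝒯⁻ + M  ≡⟨ alg₁ (2 ^ (j + 2)) (covered 𝒯⁻) M ⟩
      2 * (2 ^ (j + 2) * covered 𝒯⁻ + M)  ≤⟨ *-monoʳ-≤ 2 small ⟩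
      2 * (two * M)  ≡⟨ sym (*-assoc 2 two M) ⟩
      2 * two * M  ∎))
    add-layer (inj₁ (B , eq , B⊆)) with all? (B ⊆?_) W
    ... | yes B⊆W = inj₁ (B , eq , All.tabulate contains)
      where
      contains : ∀ {Y} → Y ∈ 𝒯 → B ⊆ Y
      contains {Y} Y∈ with top? Y
      ... | yes top = All.lookup B⊆W (∈-filter⁺ top? Y∈ top)
      ... | no ¬top = All.lookup B⊆ (∈-filter⁺ (¬? ∘ top?) Y∈ ¬top)
    ... | no ¬all with find (¬All⇒Any¬ (B ⊆?_) W ¬all)
    -- The top set Z breaks the common B of the lower layers. These then cover at most M/4, which
    -- leaves room for the top layer below M/2.
    ... | Z , Z∈ , B⊈Z = inj₂ (assemble (two * M) (begin
        2 ^ (suc j + 2) * covered 𝒯⁻  ≡⟨ cong (λ z → 2 * z * covered 𝒯⁻) two≡ ⟩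
        2 * (2 * two) * covered 𝒯⁻  ≡⟨ alg₂ two (covered 𝒯⁻) ⟩
        two * (4 * covered 𝒯⁻)  ≤⟨ *-monoʳ-≤ two (trivial-rest eq B⊆ B⊈Z (≤-trans (≤-reflexive (size-W Z∈)) s≤q)
            (λ Y∈ → int (rest∈ Y∈) (W∈ Z∈))) ⟩
        two * M  ∎)
      (begin
        M + two * M + M  ≡⟨ alg₃ two M ⟩
        2 * M + two * M  ≤⟨ +-monoˡ-≤ (two * M) (*-monoˡ-≤ M (^-monoʳ-≤ 2 (m≤n+m 1 j))) ⟩
        two * M + two * M  ≡⟨ alg₄ two M ⟩
        2 * two * M  ∎))

  simplify : ∀ j → t + j ≤ q → Simplified j
  simplify zero _ [] _ _ = inj₂ (≤-trans (≤-reflexive (cong (λ z → 4 * z + M) (∑-0 F))) (m≤m+n M (M + 0)))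
  -- Sets of size at most t that pairwise share t elements are all equal.
  simplify zero _ 𝒯@(X ∷ _) int sizes = inj₁ (X , ∣X∣≡t , All.tabulate X⊆)
    where
    ∣X∣≤t : ∣ X ∣ ≤ t
    ∣X∣≤t = ≤-trans (sizes (here refl)) (≤-reflexive (+-identityʳ t))
    ∣X∣≡t : ∣ X ∣ ≡ t
    ∣X∣≡t = ≤-antisym ∣X∣≤t (≤-trans (int (here refl) (here refl)) (∣p∩q∣≤∣p∣ X X))
    X⊆ : ∀ {Y} → Y ∈ 𝒯 → X ⊆ Y
    X⊆ {Y} Y∈ = subst (_⊆ Y) (p⊆q∧∣q∣≤∣p∣⇒p≡q (p∩q⊆p X Y) (≤-trans ∣X∣≤t (int (here refl) Y∈))) (p∩q⊆q X Y)
  simplify (suc j) s≤q 𝒯 = reduce-layer j s≤q (simplify j (≤-trans (+-monoʳ-≤ t (n≤1+n j)) s≤q)) (total 𝒯) 𝒯 ≤-refl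

-- Labellings

∏ : List A → (A → ℕ) → ℕ
∏ [] f = 1
∏ (x ∷ xs) f = f x * ∏ xs f

∏-cong-∈ : ∀ (xs : List A) {f g : A → ℕ} → (∀ {x} → x ∈ xs → f x ≡ g x) → ∏ xs f ≡ ∏ xs g
∏-cong-∈ [] h = refl
∏-cong-∈ (x ∷ xs) h = cong₂ _*_ (h (here refl)) (∏-cong-∈ xs (h ∘ there))

∏-1 : ∀ (xs : List A) {f : A → ℕ} → (∀ x → f x ≡ 1) → ∏ xs f ≡ 1
∏-1 [] h = refl
∏-1 (x ∷ xs) h = cong₂ _*_ (h x) (∏-1 xs h)

∏-update : ∀ {xs : List A} → Unique xs → ∀ {a} → a ∈ xs → (f g : A → ℕ) → (∀ {x} → x ≢ a → f x ≡ g x) →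
  ∏ xs f * g a ≡ ∏ xs g * f a
∏-update {xs = a ∷ xs} (a∉ ∷ u) (here refl) f g h =
  trans (cong (λ z → f a * z * g a) (∏-cong-∈ xs (λ x∈ → h (All.lookup a∉ x∈ ∘ sym)))) (lem (f a) (∏ xs g) (g a))
  where
  lem : ∀ a p b → a * p * b ≡ b * p * a
  lem = solve-∀
∏-update {xs = x ∷ xs} (x∉ ∷ u) {a} (there a∈) f g h = begin
  f x * ∏ xs f * g a  ≡⟨ *-assoc (f x) _ _ ⟩
  f x * (∏ xs f * g a)  ≡⟨ cong₂ _*_ (h (All.lookup x∉ a∈)) (∏-update u a∈ f g h) ⟩
  g x * (∏ xs g * f a)  ≡⟨ sym (*-assoc (g x) _ _) ⟩
  g x * ∏ xs g * f a  ∎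
  where open ≡-Reasoning

∏-update₂ : ∀ {xs : List (Fin n)} → Unique xs → ∀ {a b} → a ∈ xs → b ∈ xs → a ≢ b → (f g : Fin n → ℕ) →
    (∀ {x} → x ≢ a → x ≢ b → f x ≡ g x) →
  ∏ xs f * (g a * g b) ≡ ∏ xs g * (f a * f b)
∏-update₂ {xs = xs} u {a} {b} a∈ b∈ a≢b f g h = begin
  ∏ xs f * (g a * g b)  ≡⟨ alg (∏ xs f) (g a) (g b) ⟩
  ∏ xs f * g b * g a  ≡⟨ cong (λ z → ∏ xs f * z * g a) (sym (k≢ (≢-sym a≢b))) ⟩
  ∏ xs f * k b * g a  ≡⟨ cong (_* g a) (∏-update u b∈ f k f≗k) ⟩
  ∏ xs k * f b * g a  ≡⟨ alg₂ (∏ xs k) (f b) (g a) ⟩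
  ∏ xs k * g a * f b  ≡⟨ cong (_* f b) (∏-update u a∈ k g k≢) ⟩
  ∏ xs g * k a * f b  ≡⟨ cong (λ z → ∏ xs g * z * f b) k≡ ⟩
  ∏ xs g * f a * f b  ≡⟨ *-assoc (∏ xs g) _ _ ⟩
  ∏ xs g * (f a * f b)  ∎
  where
  open ≡-Reasoning
  alg : ∀ p a b → p * (a * b) ≡ p * b * a
  alg = solve-∀
  alg₂ : ∀ p a b → p * a * b ≡ p * b * a
  alg₂ = solve-∀
  k : Fin _ → ℕ
  k x with x ≟ᶠ a
  ... | yes _ = f x
  ... | no _ = g x
  k≢ : ∀ {x} → x ≢ a → k x ≡ g x
  k≢ {x} x≢a with x ≟ᶠ a
  ... | yes eq = ⊥-elim (x≢a eq)
  ... | no _ = refl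
  k≡ : k a ≡ f a
  k≡ with a ≟ᶠ a
  ... | yes _ = refl
  ... | no neq = ⊥-elim (neq refl)
  f≗k : ∀ {x} → x ≢ b → f x ≡ k x
  f≗k {x} x≢b with x ≟ᶠ a
  ... | yes _ = refl
  ... | no x≢a = h x≢a x≢b

∑-combine : ∀ m n (f : Fin (m * n) → ℕ) → ∑ (allFin (m * n)) f ≡ ∑ (allFin m) (λ i → ∑ (allFin n) (λ j → f (combine i j)))
∑-combine m n f = trans (≤-antisym (∑-⊆ f (Unique.allFin⁺ (m * n)) (λ {x} _ → full x)) (∑-⊆ f uniq (λ {x} _ → ∈-allFin x))) (∑-product (allFin m))
  where
  pairs = cartesianProductWith combine (allFin m) (allFin n)
  full : ∀ x → x ∈ pairs
  full x with combine-surjective {m} {n} x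
  ... | i , j , refl = ∈-cartesianProductWith⁺ combine (∈-allFin i) (∈-allFin j)
  uniq : Unique pairs
  uniq = Unique.cartesianProductWith⁺ combine (λ {w} {x} {y} {z} eq → combine-injective w y x z eq) (Unique.allFin⁺ m) (Unique.allFin⁺ n)
  ∑-product : ∀ is → ∑ (cartesianProductWith combine is (allFin n)) f ≡ ∑ is (λ i → ∑ (allFin n) (λ j → f (combine i j)))
  ∑-product [] = refl
  ∑-product (i ∷ is) = trans (∑-++ (map (combine i) (allFin n)) _ f) (cong₂ _+_ (∑-map (combine i) (allFin n) f)
      (∑-product is))

-- A labelling stands for the partition of the vertices into its fibres.
Labelling : ℕ → Set
Labelling n = Fin n → Fin n

module _ {n : ℕ} where
  private
    V : List (Fin n)
    V = allFin n

    V-unique : Unique V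
    V-unique = Unique.allFin⁺ n

  fibre : Labelling n → Fin n → ℕ
  fibre ℓ a = ∑ V (λ u → 𝟙 (ℓ u ≟ᶠ a))

  used? : (ℓ : Labelling n) (a : Fin n) → Dec (∃ λ u → ℓ u ≡ a)
  used? ℓ a = anyᶠ? (λ u → ℓ u ≟ᶠ a)

  classes : Labelling n → ℕ
  classes ℓ = ∑ V (λ a → 𝟙 (used? ℓ a))

  merge : Labelling n → Fin n → Fin n → Labelling n
  merge ℓ u v w with ℓ w ≟ᶠ ℓ v
  ... | yes _ = ℓ u
  ... | no _  = ℓ w

  ∑-𝟙≟ : ∀ (a : Fin n) → ∑ V (λ x → 𝟙 (a ≟ᶠ x)) ≡ 1
  ∑-𝟙≟ a = trans (∑-cong V (λ x → sym (*-identityʳ _))) (∑-collapse _≟ᶠ_ V-unique (∈-allFin a) (λ _ → 1))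

  fibre>0 : ∀ (ℓ : Labelling n) u → 0 < fibre ℓ (ℓ u)
  fibre>0 ℓ u = ≤-trans (≤-reflexive (sym (𝟙-yes (ℓ u ≟ᶠ ℓ u) refl))) (∑-∈ (λ w → 𝟙 (ℓ w ≟ᶠ ℓ u)) (∈-allFin u))

  fibre>1 : ∀ (ℓ : Labelling n) {u v a} → u ≢ v → ℓ u ≡ a → ℓ v ≡ a → 1 < fibre ℓ a
  fibre>1 ℓ {u} {v} {a} u≢v eu ev = begin
    1 + 1  ≡⟨ cong₂ _+_ (sym (∑-𝟙≟ u)) (sym (∑-𝟙≟ v)) ⟩
    ∑ V (λ x → 𝟙 (u ≟ᶠ x)) + ∑ V (λ x → 𝟙 (v ≟ᶠ x))  ≡⟨ sym (∑-+ V _ _) ⟩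
    ∑ V (λ x → 𝟙 (u ≟ᶠ x) + 𝟙 (v ≟ᶠ x))  ≤⟨ ∑-mono V each ⟩
    fibre ℓ a  ∎
    where
    open ≤-Reasoning
    each : ∀ x → 𝟙 (u ≟ᶠ x) + 𝟙 (v ≟ᶠ x) ≤ 𝟙 (ℓ x ≟ᶠ a)
    each x with u ≟ᶠ x | v ≟ᶠ x
    ... | yes refl | yes v≡ = ⊥-elim (u≢v (sym v≡))
    ... | yes refl | no _ = ≤-reflexive (sym (𝟙-yes (ℓ x ≟ᶠ a) eu))
    ... | no _ | yes refl = ≤-reflexive (sym (𝟙-yes (ℓ x ≟ᶠ a) ev))
    ... | no _ | no _ = z≤n

  fibre≡1 : ∀ (ℓ : Labelling n) u → (∀ x → ℓ x ≡ ℓ u → x ≡ u) → fibre ℓ (ℓ u) ≡ 1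
  fibre≡1 ℓ u single = trans (∑-cong V (λ x → 𝟙-cong (ℓ x ≟ᶠ ℓ u) (u ≟ᶠ x) (sym ∘ single x) (λ { refl → refl }))) (∑-𝟙≟ u)

  fibre-unused : ∀ (ℓ : Labelling n) {a} → ¬ (∃ λ u → ℓ u ≡ a) → fibre ℓ a ≡ 0
  fibre-unused ℓ {a} unused = trans (∑-cong V (λ u → 𝟙-no (ℓ u ≟ᶠ a) (λ eq → unused (u , eq)))) (∑-0 V)

  classes-id : classes id ≡ n
  classes-id = trans (∑-cong V (λ a → 𝟙-yes (used? id a) (a , refl))) (trans (∑-1 V) (List.length-tabulate {n = n} id))

  classes≥2 : ∀ (ℓ : Labelling n) {u v} → ℓ u ≢ ℓ v → 2 ≤ classes ℓ
  classes≥2 ℓ {u} {v} neq = begin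
    1 + 1  ≡⟨ cong₂ _+_ (sym (∑-𝟙≟ (ℓ u))) (sym (∑-𝟙≟ (ℓ v))) ⟩
    ∑ V (λ x → 𝟙 (ℓ u ≟ᶠ x)) + ∑ V (λ x → 𝟙 (ℓ v ≟ᶠ x))  ≡⟨ sym (∑-+ V _ _) ⟩
    ∑ V (λ x → 𝟙 (ℓ u ≟ᶠ x) + 𝟙 (ℓ v ≟ᶠ x))  ≤⟨ ∑-mono V each ⟩
    classes ℓ  ∎
    where
    open ≤-Reasoning
    each : ∀ x → 𝟙 (ℓ u ≟ᶠ x) + 𝟙 (ℓ v ≟ᶠ x) ≤ 𝟙 (used? ℓ x)
    each x with ℓ u ≟ᶠ x | ℓ v ≟ᶠ x
    ... | yes eu | yes ev = ⊥-elim (neq (trans eu (sym ev)))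
    ... | yes eu | no _ = ≤-reflexive (sym (𝟙-yes (used? ℓ x) (u , eu)))
    ... | no _ | yes ev = ≤-reflexive (sym (𝟙-yes (used? ℓ x) (v , ev)))
    ... | no _ | no _ = z≤n

  classes-const : ∀ (ℓ : Labelling n) (u₀ : Fin n) → (∀ u v → ℓ u ≡ ℓ v) → classes ℓ ≤ 1
  classes-const ℓ u₀ const = begin
    classes ℓ  ≤⟨ ∑-mono V (λ a → 𝟙-mono (used? ℓ a) (ℓ u₀ ≟ᶠ a) (λ (u , eq) → trans (const u₀ u) eq)) ⟩
    ∑ V (λ a → 𝟙 (ℓ u₀ ≟ᶠ a))  ≡⟨ ∑-𝟙≟ (ℓ u₀) ⟩
    1  ∎
    where open ≤-Reasoning

  merge-cong : ∀ (ℓ : Labelling n) u v {x y} → ℓ x ≡ ℓ y → merge ℓ u v x ≡ merge ℓ u v y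
  merge-cong ℓ u v {x} {y} eq with ℓ x ≟ᶠ ℓ v | ℓ y ≟ᶠ ℓ v
  ... | yes _ | yes _ = refl
  ... | yes p | no q = ⊥-elim (q (trans (sym eq) p))
  ... | no p | yes q = ⊥-elim (p (trans eq q))
  ... | no _ | no _ = eq

  merge-joins : ∀ (ℓ : Labelling n) u v → merge ℓ u v u ≡ merge ℓ u v v
  merge-joins ℓ u v with ℓ u ≟ᶠ ℓ v | ℓ v ≟ᶠ ℓ v
  ... | yes _ | yes _ = refl
  ... | no _ | yes _ = refl
  ... | yes p | no q = ⊥-elim (q refl)
  ... | no _ | no q = ⊥-elim (q refl)

  -- Merging generates the least equivalence relation joining u and v. R is an arbitrary relation,
  -- so that it can be equality of labels as well as the existence of a walk.
  merge-least : ∀ (ℓ : Labelling n) u v (R : Fin n → Fin n → Set) → (∀ {x y} → R x y → R y x) →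
      (∀ {x y z} → R x y → R y z → R x z) →
    R u v → (∀ {x y} → ℓ x ≡ ℓ y → R x y) → ∀ {x y} → merge ℓ u v x ≡ merge ℓ u v y → R x y
  merge-least ℓ u v R sy tr uv h {x} {y} eq with ℓ x ≟ᶠ ℓ v | ℓ y ≟ᶠ ℓ v
  ... | yes p | yes q = h (trans p (sym q))
  ... | yes p | no q = tr (h p) (tr (sy uv) (h eq))
  ... | no p | yes q = tr (h eq) (tr uv (h (sym q)))
  ... | no _ | no _ = h eq

  classes-merge-≤ : ∀ (ℓ : Labelling n) u v → classes ℓ ≤ suc (classes (merge ℓ u v))
  classes-merge-≤ ℓ u v = begin
    classes ℓ  ≤⟨ ∑-mono V (λ a → 𝟙≤ (used? ℓ a) (each a)) ⟩
    ∑ V (λ a → 𝟙 (ℓ v ≟ᶠ a) + 𝟙 (used? (merge ℓ u v) a))  ≡⟨ ∑-+ V _ _ ⟩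
    ∑ V (λ a → 𝟙 (ℓ v ≟ᶠ a)) + classes (merge ℓ u v)  ≡⟨ cong (_+ classes (merge ℓ u v)) (∑-𝟙≟ (ℓ v)) ⟩
    suc (classes (merge ℓ u v))  ∎
    where
    open ≤-Reasoning
    each : ∀ a → (∃ λ w → ℓ w ≡ a) → 1 ≤ 𝟙 (ℓ v ≟ᶠ a) + 𝟙 (used? (merge ℓ u v) a)
    each a (w , eq) with ℓ v ≟ᶠ a
    ... | yes _ = s≤s z≤n
    ... | no neq = ≤-reflexive (sym (𝟙-yes (used? (merge ℓ u v) a) (w , m≡)))
      where
      m≡ : merge ℓ u v w ≡ a
      m≡ with ℓ w ≟ᶠ ℓ v
      ... | yes p = ⊥-elim (neq (trans (sym p) eq))
      ... | no _ = eq

  classes-merge : ∀ (ℓ : Labelling n) u v → ℓ u ≢ ℓ v → classes ℓ ≡ suc (classes (merge ℓ u v))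
  classes-merge ℓ u v u≢v = ≤-antisym (classes-merge-≤ ℓ u v) (begin
    suc (classes (merge ℓ u v))  ≡⟨ cong (_+ classes (merge ℓ u v)) (sym (∑-𝟙≟ (ℓ v))) ⟩
    ∑ V (λ a → 𝟙 (ℓ v ≟ᶠ a)) + classes (merge ℓ u v)  ≡⟨ sym (∑-+ V _ _) ⟩
    ∑ V (λ a → 𝟙 (ℓ v ≟ᶠ a) + 𝟙 (used? (merge ℓ u v) a))  ≤⟨ ∑-mono V each ⟩
    classes ℓ  ∎)
    where
    open ≤-Reasoning
    avoids : ∀ w → merge ℓ u v w ≢ ℓ v
    avoids w with ℓ w ≟ᶠ ℓ v
    ... | yes _ = u≢v
    ... | no p = p
    old : ∀ w → ∃ λ x → ℓ x ≡ merge ℓ u v w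
    old w with ℓ w ≟ᶠ ℓ v
    ... | yes _ = u , refl
    ... | no _ = w , refl
    each : ∀ a → 𝟙 (ℓ v ≟ᶠ a) + 𝟙 (used? (merge ℓ u v) a) ≤ 𝟙 (used? ℓ a)
    each a with ℓ v ≟ᶠ a | used? (merge ℓ u v) a
    ... | yes eq | yes (w , q) = ⊥-elim (avoids w (trans q (sym eq)))
    ... | yes eq | no _ = ≤-reflexive (sym (𝟙-yes (used? ℓ a) (v , eq)))
    ... | no _ | yes (w , q) = ≤-reflexive (sym (𝟙-yes (used? ℓ a) (let x , r = old w in x , trans r q)))
    ... | no _ | no _ = z≤n

  fibre-merge-joined : ∀ (ℓ : Labelling n) u v → ℓ u ≢ ℓ v → fibre (merge ℓ u v) (ℓ u) ≡ fibre ℓ (ℓ u) + fibre ℓ (ℓ v)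
  fibre-merge-joined ℓ u v u≢v = trans (∑-cong V each) (∑-+ V _ _)
    where
    each : ∀ w → 𝟙 (merge ℓ u v w ≟ᶠ ℓ u) ≡ 𝟙 (ℓ w ≟ᶠ ℓ u) + 𝟙 (ℓ w ≟ᶠ ℓ v)
    each w with ℓ w ≟ᶠ ℓ v
    ... | yes p = trans (𝟙-yes (ℓ u ≟ᶠ ℓ u) refl) (cong (_+ 1) (sym (𝟙-no (ℓ w ≟ᶠ ℓ u) (λ q → u≢v (trans (sym q) p)))))
    ... | no _ = sym (+-identityʳ _)

  fibre-merge-empty : ∀ (ℓ : Labelling n) u v → ℓ u ≢ ℓ v → fibre (merge ℓ u v) (ℓ v) ≡ 0
  fibre-merge-empty ℓ u v u≢v = trans (∑-cong V each) (∑-0 V)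
    where
    each : ∀ w → 𝟙 (merge ℓ u v w ≟ᶠ ℓ v) ≡ 0
    each w with ℓ w ≟ᶠ ℓ v
    ... | yes _ = 𝟙-no (ℓ u ≟ᶠ ℓ v) u≢v
    ... | no p = 𝟙-no (ℓ w ≟ᶠ ℓ v) p

  fibre-merge-other : ∀ (ℓ : Labelling n) u v {a} → a ≢ ℓ u → a ≢ ℓ v → fibre (merge ℓ u v) a ≡ fibre ℓ a
  fibre-merge-other ℓ u v {a} a≢u a≢v = ∑-cong V each
    where
    each : ∀ w → 𝟙 (merge ℓ u v w ≟ᶠ a) ≡ 𝟙 (ℓ w ≟ᶠ a)
    each w with ℓ w ≟ᶠ ℓ v
    ... | yes p = trans (𝟙-no (ℓ u ≟ᶠ a) (a≢u ∘ sym)) (sym (𝟙-no (ℓ w ≟ᶠ a) (λ q → a≢v (trans (sym q) p))))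
    ... | no _ = refl

  1⊔-pos : ∀ {m} → 0 < m → 1 ⊔ m ≡ m
  1⊔-pos 0<m = m≤n⇒m⊔n≡n 0<m

  -- Unused labels have empty fibres and count as 1.
  weight : Labelling n → ℕ
  weight ℓ = ∏ V (λ a → 1 ⊔ fibre ℓ a)

  weight-id : weight id ≡ 1
  weight-id = ∏-1 V (λ a → cong (1 ⊔_) (fibre≡1 id a (λ _ eq → eq)))

  -- Class sizes a and b are replaced by a + b; the abandoned label contributes 1 to the product.
  weight-merge : ∀ (ℓ : Labelling n) u v → ℓ u ≢ ℓ v →
    weight (merge ℓ u v) * (fibre ℓ (ℓ u) * fibre ℓ (ℓ v)) ≡ weight ℓ * (fibre ℓ (ℓ u) + fibre ℓ (ℓ v))
  weight-merge ℓ u v u≢v = begin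
    weight m * (fibre ℓ (ℓ u) * fibre ℓ (ℓ v))  ≡⟨ cong (weight m *_)
        (cong₂ _*_ (sym (1⊔-pos (fibre>0 ℓ u))) (sym (1⊔-pos (fibre>0 ℓ v)))) ⟩
    weight m * ((1 ⊔ fibre ℓ (ℓ u)) * (1 ⊔ fibre ℓ (ℓ v)))
      ≡⟨ ∏-update₂ V-unique (∈-allFin (ℓ u)) (∈-allFin (ℓ v)) u≢v (λ a → 1 ⊔ fibre m a) (λ a → 1 ⊔ fibre ℓ a)
          (λ p q → cong (1 ⊔_) (fibre-merge-other ℓ u v p q)) ⟩
    weight ℓ * ((1 ⊔ fibre m (ℓ u)) * (1 ⊔ fibre m (ℓ v)))
      ≡⟨ cong (weight ℓ *_) (cong₂ (λ a b → (1 ⊔ a) * (1 ⊔ b)) (fibre-merge-joined ℓ u v u≢v)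
          (fibre-merge-empty ℓ u v u≢v)) ⟩
    weight ℓ * ((1 ⊔ (fibre ℓ (ℓ u) + fibre ℓ (ℓ v))) * 1)  ≡⟨ cong (weight ℓ *_)
        (trans (*-identityʳ _) (1⊔-pos (≤-trans (fibre>0 ℓ u) (m≤m+n _ _)))) ⟩
    weight ℓ * (fibre ℓ (ℓ u) + fibre ℓ (ℓ v))  ∎
    where
    open ≡-Reasoning
    m = merge ℓ u v

  weight-connected : ∀ (ℓ : Labelling n) (u₀ : Fin n) → (∀ u v → ℓ u ≡ ℓ v) → weight ℓ ≡ n
  weight-connected ℓ u₀ const = begin
    weight ℓ  ≡⟨ sym (*-identityʳ _) ⟩
    weight ℓ * 1  ≡⟨ ∏-update V-unique (∈-allFin (ℓ u₀)) (λ a → 1 ⊔ fibre ℓ a) (λ _ → 1)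
                                                (λ {x} x≢ → cong (1 ⊔_) (fibre-unused ℓ (λ (u , eq) → x≢ (trans (sym eq) (const u u₀))))) ⟩
    ∏ V (λ _ → 1) * (1 ⊔ fibre ℓ (ℓ u₀)) ≡⟨ cong₂ _*_ (∏-1 V (λ _ → refl)) (1⊔-pos (fibre>0 ℓ u₀)) ⟩
    1 * fibre ℓ (ℓ u₀)  ≡⟨ *-identityˡ _ ⟩
    fibre ℓ (ℓ u₀)  ≡⟨ ∑-cong V (λ u → 𝟙-yes (ℓ u ≟ᶠ ℓ u₀) (const u u₀)) ⟩
    ∑ V (λ _ → 1)  ≡⟨ ∑-1 V ⟩
    length V  ≡⟨ List.length-tabulate {n = n} id ⟩
    n  ∎
    where open ≡-Reasoning

  omit : Labelling n → Fin n → Fin n → ℕ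
  omit ℓ a x with x ≟ᶠ a
  ... | yes _ = 1
  ... | no _ = 1 ⊔ fibre ℓ x

  omit-self : ∀ (ℓ : Labelling n) a → omit ℓ a a ≡ 1
  omit-self ℓ a with a ≟ᶠ a
  ... | yes _ = refl
  ... | no neq = ⊥-elim (neq refl)

  omit-other : ∀ (ℓ : Labelling n) {a x} → x ≢ a → omit ℓ a x ≡ 1 ⊔ fibre ℓ x
  omit-other ℓ {a} {x} neq with x ≟ᶠ a
  ... | yes eq = ⊥-elim (neq eq)
  ... | no _ = refl

  -- For a used label this is `weight ℓ` divided by the size of its class, available without
  -- division.
  weight-without : Labelling n → Fin n → ℕ
  weight-without ℓ a = ∏ V (omit ℓ a)

  weight-without-* : ∀ (ℓ : Labelling n) u → fibre ℓ (ℓ u) * weight-without ℓ (ℓ u) ≡ weight ℓ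
  weight-without-* ℓ u = begin
    fibre ℓ (ℓ u) * weight-without ℓ (ℓ u)  ≡⟨ *-comm (fibre ℓ (ℓ u)) _ ⟩
    weight-without ℓ (ℓ u) * fibre ℓ (ℓ u)  ≡⟨ cong (weight-without ℓ (ℓ u) *_) (sym (1⊔-pos (fibre>0 ℓ u))) ⟩
    weight-without ℓ (ℓ u) * (1 ⊔ fibre ℓ (ℓ u))  ≡⟨ ∏-update V-unique (∈-allFin (ℓ u)) (omit ℓ (ℓ u)) (λ a → 1 ⊔ fibre ℓ a)
        (omit-other ℓ) ⟩
    weight ℓ * omit ℓ (ℓ u) (ℓ u)  ≡⟨ cong (weight ℓ *_) (omit-self ℓ (ℓ u)) ⟩
    weight ℓ * 1  ≡⟨ *-identityʳ _ ⟩
    weight ℓ  ∎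
    where open ≡-Reasoning

  weight-merge-+ : ∀ (ℓ : Labelling n) u v → ℓ u ≢ ℓ v → weight (merge ℓ u v) ≡ weight-without ℓ (ℓ u) + weight-without ℓ
      (ℓ v)
  weight-merge-+ ℓ u v u≢v = *-cancelʳ-≡ _ _ (a * b) {{m*n≢0 a b {{>-nonZero (fibre>0 ℓ u)}} {{>-nonZero (fibre>0 ℓ v)}}}}
      (begin
    weight (merge ℓ u v) * (a * b)  ≡⟨ weight-merge ℓ u v u≢v ⟩
    weight ℓ * (a + b)  ≡⟨ *-distribˡ-+ (weight ℓ) a b ⟩
    weight ℓ * a + weight ℓ * b  ≡⟨ cong₂ (λ p q → p * a + q * b) (sym (weight-without-* ℓ v)) (sym (weight-without-* ℓ u)) ⟩
    b * y * a + a * x * b  ≡⟨ alg a b x y ⟩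
    (x + y) * (a * b)  ∎)
    where
    open ≡-Reasoning
    a = fibre ℓ (ℓ u)
    b = fibre ℓ (ℓ v)
    x = weight-without ℓ (ℓ u)
    y = weight-without ℓ (ℓ v)
    alg : ∀ a b x y → b * y * a + a * x * b ≡ (x + y) * (a * b)
    alg = solve-∀

  -- A class of size s contributes s summands equal to the weight over s.
  ∑-weight-without : ∀ (ℓ : Labelling n) → ∑ V (λ u → weight-without ℓ (ℓ u)) ≡ classes ℓ * weight ℓ
  ∑-weight-without ℓ = begin
    ∑ V (λ u → weight-without ℓ (ℓ u))  ≡⟨ ∑-cong V (λ u → sym (∑-collapse _≟ᶠ_ V-unique (∈-allFin (ℓ u))
        (weight-without ℓ))) ⟩
    ∑ V (λ u → ∑ V (λ a → 𝟙 (ℓ u ≟ᶠ a) * weight-without ℓ a))  ≡⟨ ∑-swap V V (λ u a → 𝟙 (ℓ u ≟ᶠ a) * weight-without ℓ a) ⟩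
    ∑ V (λ a → ∑ V (λ u → 𝟙 (ℓ u ≟ᶠ a) * weight-without ℓ a))  ≡⟨ ∑-cong V (λ a → ∑-*ʳ V (weight-without ℓ a) _) ⟩
    ∑ V (λ a → fibre ℓ a * weight-without ℓ a)  ≡⟨ ∑-cong V each ⟩
    ∑ V (λ a → 𝟙 (used? ℓ a) * weight ℓ)  ≡⟨ ∑-*ʳ V (weight ℓ) _ ⟩
    classes ℓ * weight ℓ  ∎
    where
    open ≡-Reasoning
    each : ∀ a → fibre ℓ a * weight-without ℓ a ≡ 𝟙 (used? ℓ a) * weight ℓ
    each a with used? ℓ a
    ... | yes (u , refl) = trans (weight-without-* ℓ u) (sym (*-identityˡ _))
    ... | no unused = cong (_* weight-without ℓ a) (fibre-unused ℓ unused)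

  -- If every v were allowed, the sum would be n (c+1) times the weight. For each u, the excluded v
  -- in its own class account for exactly one weight.
  ∑-separated : ∀ (ℓ : Labelling n) {c} → classes ℓ ≡ suc c →
    ∑ V (λ u → ∑ V (λ v → 𝟙 (¬? (ℓ u ≟ᶠ ℓ v)) * weight-without ℓ (ℓ u))) ≡ n * (c * weight ℓ)
  ∑-separated ℓ {c} eq = +-cancelˡ-≡ (n * weight ℓ) _ _ (begin
    n * weight ℓ + ∑ V sep
      ≡⟨ cong (_+ ∑ V sep) (trans (cong (_* weight ℓ) (sym (List.length-tabulate {n = n} id)))
          (sym (∑-const V (weight ℓ)))) ⟩
    ∑ V (λ _ → weight ℓ) + ∑ V sep  ≡⟨ sym (∑-+ V _ sep) ⟩
    ∑ V (λ u → weight ℓ + sep u)  ≡⟨ ∑-cong V each ⟩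
    ∑ V (λ u → n * weight-without ℓ (ℓ u))  ≡⟨ ∑-*ˡ V n _ ⟩
    n * ∑ V (λ u → weight-without ℓ (ℓ u))  ≡⟨ cong (n *_) (trans (∑-weight-without ℓ) (cong (_* weight ℓ) eq)) ⟩
    n * (weight ℓ + c * weight ℓ)  ≡⟨ *-distribˡ-+ n (weight ℓ) _ ⟩
    n * weight ℓ + n * (c * weight ℓ)  ∎)
    where
    open ≡-Reasoning
    sep : Fin n → ℕ
    sep u = ∑ V (λ v → 𝟙 (¬? (ℓ u ≟ᶠ ℓ v)) * weight-without ℓ (ℓ u))
    each : ∀ u → weight ℓ + sep u ≡ n * weight-without ℓ (ℓ u)
    each u = begin
      weight ℓ + sep u  ≡⟨ cong₂ _+_ (sym (weight-without-* ℓ u)) (∑-*ʳ V w _) ⟩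
      fibre ℓ (ℓ u) * w + ∑ V (λ v → 𝟙 (¬? (ℓ u ≟ᶠ ℓ v))) * w  ≡⟨ sym (*-distribʳ-+ w (fibre ℓ (ℓ u)) _) ⟩
      (fibre ℓ (ℓ u) + ∑ V (λ v → 𝟙 (¬? (ℓ u ≟ᶠ ℓ v)))) * w  ≡⟨ cong (_* w)
          (trans (sym (∑-+ V _ _)) (trans (∑-cong V (λ v → trans
          (cong (_+ 𝟙 (¬? (ℓ u ≟ᶠ ℓ v))) (𝟙-cong (ℓ v ≟ᶠ ℓ u) (ℓ u ≟ᶠ ℓ v) sym sym)) (𝟙-¬ (ℓ u ≟ᶠ ℓ v))))
          (trans (∑-1 V) (List.length-tabulate {n = n} id)))) ⟩
      n * w  ∎
      where w = weight-without ℓ (ℓ u)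

  -- Joining classes of sizes a and b multiplies the weight by 1/a + 1/b. Assigning the two summands
  -- to the two orders of the pair turns the sum into the preceding one.
  ∑-ordered-merge : ∀ (ℓ : Labelling n) {c} → classes ℓ ≡ suc c →
    ∑ V (λ u → ∑ V (λ v → 𝟙 ((u <ᶠ? v) ×-dec ¬? (ℓ u ≟ᶠ ℓ v)) * weight (merge ℓ u v))) ≡ n * (c * weight ℓ)
  ∑-ordered-merge ℓ {c} eq = begin
    ∑ V (λ u → ∑ V (λ v → 𝟙 ((u <ᶠ? v) ×-dec ¬? (ℓ u ≟ᶠ ℓ v)) * weight (merge ℓ u v)))
      ≡⟨ ∑-cong V (λ u → trans (∑-cong V (expand u)) (∑-+ V _ _)) ⟩
    ∑ V (λ u → ∑ V (λ v → lt u v * W u v) + ∑ V (λ v → lt u v * W v u))  ≡⟨ ∑-+ V _ _ ⟩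
    ∑ V (λ u → ∑ V (λ v → lt u v * W u v)) + ∑ V (λ u → ∑ V (λ v → lt u v * W v u))  ≡⟨ cong
        (∑ V (λ u → ∑ V (λ v → lt u v * W u v)) +_) (∑-swap V V (λ u v → lt u v * W v u)) ⟩
    ∑ V (λ u → ∑ V (λ v → lt u v * W u v)) + ∑ V (λ u → ∑ V (λ v → lt v u * W u v))  ≡⟨ sym (∑-+ V _ _) ⟩
    ∑ V (λ u → ∑ V (λ v → lt u v * W u v) + ∑ V (λ v → lt v u * W u v))  ≡⟨ ∑-cong V
        (λ u → trans (sym (∑-+ V _ _)) (∑-cong V (collect u))) ⟩
    ∑ V (λ u → ∑ V (λ v → W u v))  ≡⟨ ∑-separated ℓ eq ⟩
    n * (c * weight ℓ)  ∎
    where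
    open ≡-Reasoning
    lt : Fin n → Fin n → ℕ
    lt u v = 𝟙 (u <ᶠ? v)
    W : Fin n → Fin n → ℕ
    W u v = 𝟙 (¬? (ℓ u ≟ᶠ ℓ v)) * weight-without ℓ (ℓ u)
    alg : ∀ a b x y → a * b * (x + y) ≡ a * (b * x) + a * (b * y)
    alg = solve-∀
    expand : ∀ u v → 𝟙 ((u <ᶠ? v) ×-dec ¬? (ℓ u ≟ᶠ ℓ v)) * weight (merge ℓ u v) ≡ lt u v * W u v + lt u v * W v u
    expand u v = begin
      𝟙 ((u <ᶠ? v) ×-dec ¬? (ℓ u ≟ᶠ ℓ v)) * weight (merge ℓ u v)  ≡⟨ 𝟙*-cong ((u <ᶠ? v) ×-dec ¬? (ℓ u ≟ᶠ ℓ v))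
          (λ (_ , neq) → weight-merge-+ ℓ u v neq) ⟩
      𝟙 ((u <ᶠ? v) ×-dec ¬? (ℓ u ≟ᶠ ℓ v)) * (weight-without ℓ (ℓ u) + weight-without ℓ (ℓ v))
        ≡⟨ cong (_* (weight-without ℓ (ℓ u) + weight-without ℓ (ℓ v))) (𝟙-× (u <ᶠ? v) (¬? (ℓ u ≟ᶠ ℓ v))) ⟩
      lt u v * 𝟙 (¬? (ℓ u ≟ᶠ ℓ v)) * (weight-without ℓ (ℓ u) + weight-without ℓ (ℓ v))  ≡⟨ alg (lt u v)
          (𝟙 (¬? (ℓ u ≟ᶠ ℓ v))) _ _ ⟩
      lt u v * W u v + lt u v * (𝟙 (¬? (ℓ u ≟ᶠ ℓ v)) * weight-without ℓ (ℓ v))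
        ≡⟨ cong (λ z → lt u v * W u v + lt u v * (z * weight-without ℓ (ℓ v)))
            (𝟙-cong (¬? (ℓ u ≟ᶠ ℓ v)) (¬? (ℓ v ≟ᶠ ℓ u)) ≢-sym ≢-sym) ⟩
      lt u v * W u v + lt u v * W v u  ∎
    collect : ∀ u v → lt u v * W u v + lt v u * W u v ≡ W u v
    collect u v with ℓ u ≟ᶠ ℓ v
    ... | yes _ = cong₂ _+_ (*-zeroʳ (lt u v)) (*-zeroʳ (lt v u))
    ... | no neq = trans (sym (*-distribʳ-+ w (lt u v) (lt v u))) (trans (cong (_* w) one) (*-identityˡ w))
      where
      w = 1 * weight-without ℓ (ℓ u)
      one : lt u v + lt v u ≡ 1
      one with Fin.<-cmp u v
      ... | tri< a _ b = cong₂ _+_ (𝟙-yes (u <ᶠ? v) a) (𝟙-no (v <ᶠ? u) b)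
      ... | tri≈ _ e _ = ⊥-elim (neq (cong ℓ e))
      ... | tri> a _ b = cong₂ _+_ (𝟙-no (u <ᶠ? v) a) (𝟙-yes (v <ᶠ? u) b)

-- Counting trees containing a forest

_≟ˢ_ : ∀ {N} → DecidableEquality (Subset N)
_≟ˢ_ = Vec.≡-dec Bool._≟_

grow : ∀ {N} (P : Subset N → Set) {X} → (∀ {F e} → F ⊆ X → e ∈ˢ X → e ∉ˢ F → P F → P (F ∪ ⁅ e ⁆)) →
  ∀ d {F} → F ⊆ X → ∣ X ∣ ≡ d + ∣ F ∣ → P F → P X
grow P adjoin zero F⊆X eq pF = subst P (p⊆q∧∣q∣≤∣p∣⇒p≡q F⊆X (≤-reflexive eq)) pF
grow P {X} adjoin (suc d) {F} F⊆X eq pF with ∣p∣<∣q∣⇒q─p {p = F} {X} (subst (∣ F ∣ <_) (sym eq) (m<n+m ∣ F ∣ (s≤s z≤n)))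
... | e , e∈X , e∉F = grow P adjoin d (∪-lub F⊆X (⁅x⁆⊆ e∈X))
      (trans eq (trans (sym (+-suc d ∣ F ∣)) (cong (d +_) (sym (∣p∪⁅x⁆∣≡1+∣p∣ e∉F))))) (adjoin F⊆X e∈X e∉F pF)

grow-within : ∀ {N} (P : Subset N → Set) {X F} → (∀ {F e} → F ⊆ X → e ∈ˢ X → e ∉ˢ F → P F → P (F ∪ ⁅ e ⁆)) → F ⊆ X → P F →
    P X
grow-within P {X} {F} adjoin F⊆X = grow P adjoin (∣ X ∣ ∸ ∣ F ∣) F⊆X (sym (m∸n+n≡m (p⊆q⇒∣p∣≤∣q∣ F⊆X)))

-- The pair (u, v) is the index combine u v; only indices with u < v are edges of K_n.
module Trees (n : ℕ) where

  src tgt : Fin (n * n) → Fin n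
  src e = proj₁ (remQuot {n} n e)
  tgt e = proj₂ (remQuot {n} n e)

  src-combine : ∀ u v → src (combine u v) ≡ u
  src-combine u v = cong proj₁ (remQuot-combine {n} {n} u v)

  tgt-combine : ∀ u v → tgt (combine u v) ≡ v
  tgt-combine u v = cong proj₂ (remQuot-combine {n} {n} u v)

  Respects : Labelling n → Subset (n * n) → Set
  Respects ℓ T = ∀ {e} → e ∈ˢ T → ℓ (src e) ≡ ℓ (tgt e)

  -- Connectivity without walks: no labelling that is constant along edges can tell two vertices
  -- apart. This form interacts directly with counting classes.
  Conn : Subset (n * n) → Set
  Conn T = ∀ ℓ → Respects ℓ T → ∀ u v → ℓ u ≡ ℓ v

  Ordered : Subset (n * n) → Set
  Ordered T = ∀ {e} → e ∈ˢ T → src e <ᶠ tgt e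

  Tree : Subset (n * n) → Set
  Tree T = Ordered T × ∣ T ∣ ≡ n ∸ 1 × Conn T

  process : List (Fin (n * n)) → Labelling n → Labelling n
  process [] ℓ = ℓ
  process (e ∷ es) ℓ = process es (merge ℓ (src e) (tgt e))

  process-cong : ∀ es ℓ {x y} → ℓ x ≡ ℓ y → process es ℓ x ≡ process es ℓ y
  process-cong [] ℓ eq = eq
  process-cong (e ∷ es) ℓ eq = process-cong es _ (merge-cong ℓ (src e) (tgt e) eq)

  process-joins : ∀ es ℓ {e} → e ∈ es → process es ℓ (src e) ≡ process es ℓ (tgt e)
  process-joins (e ∷ es) ℓ (here refl) = process-cong es _ (merge-joins ℓ (src e) (tgt e))
  process-joins (_ ∷ es) ℓ (there e∈) = process-joins es _ e∈

  process-least : ∀ es ℓ (R : Fin n → Fin n → Set) → (∀ {x y} → R x y → R y x) → (∀ {x y z} → R x y → R y z → R x z) →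
    (∀ {e} → e ∈ es → R (src e) (tgt e)) → (∀ {x y} → ℓ x ≡ ℓ y → R x y) → ∀ {x y} → process es ℓ x ≡ process es ℓ y → R x y
  process-least [] ℓ R sy tr es⊆R h = h
  process-least (e ∷ es) ℓ R sy tr es⊆R h = process-least es _ R sy tr (es⊆R ∘ there)
    (merge-least ℓ (src e) (tgt e) R sy tr (es⊆R (here refl)) h)

  classes-process : ∀ es ℓ → classes ℓ ≤ length es + classes (process es ℓ)
  classes-process [] ℓ = ≤-refl
  classes-process (e ∷ es) ℓ = ≤-trans (classes-merge-≤ ℓ (src e) (tgt e)) (s≤s (classes-process es _))

  edgesOf : Subset (n * n) → List (Fin (n * n))
  edgesOf T = filter (_∈? T) (allFin (n * n))

  ∈-edgesOf : ∀ {T e} → e ∈ˢ T → e ∈ edgesOf T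
  ∈-edgesOf {T} e∈ = ∈-filter⁺ (_∈? T) (∈-allFin _) e∈

  edgesOf-∈ : ∀ {T e} → e ∈ edgesOf T → e ∈ˢ T
  edgesOf-∈ {T} e∈ = proj₂ (∈-filter⁻ (_∈? T) {xs = allFin (n * n)} e∈)

  length-edgesOf : ∀ T → length (edgesOf T) ≡ ∣ T ∣
  length-edgesOf T = trans (length-filter-∑ (_∈? T) (allFin (n * n))) (sym (∣p∣≡∑ T))

  components : Subset (n * n) → Labelling n
  components T = process (edgesOf T) id

  components-least : ∀ T (R : Fin n → Fin n → Set) → (∀ {x} → R x x) → (∀ {x y} → R x y → R y x) →
      (∀ {x y z} → R x y → R y z → R x z) →
    (∀ {e} → e ∈ˢ T → R (src e) (tgt e)) → ∀ {x y} → components T x ≡ components T y → R x y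
  components-least T R re sy tr T⊆R = process-least (edgesOf T) id R sy tr (T⊆R ∘ edgesOf-∈) (λ { refl → re })

  conn? : ∀ T → Dec (Conn T)
  conn? T with allᶠ? (λ u → allᶠ? (λ v → components T u ≟ᶠ components T v))
  ... | yes all = yes λ ℓ resp u v → components-least T (λ x y → ℓ x ≡ ℓ y) refl sym trans resp (all u v)
  ... | no ¬all = no λ conn → ¬all (conn (components T) (λ e∈ → process-joins (edgesOf T) id (∈-edgesOf e∈)))

  ordered? : ∀ T → Dec (Ordered T)
  ordered? T with allᶠ? (λ e → ¬? ((e ∈? T) ×-dec ¬? (src e <ᶠ? tgt e)))
  ... | yes all = yes λ {e} e∈ → decidable-stable (src e <ᶠ? tgt e) (λ ¬lt → all e (e∈ , ¬lt))
  ... | no ¬all = no λ ord → ¬all (λ e (e∈ , ¬lt) → ¬lt (ord e∈))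

  abstract
    tree? : ∀ T → Dec (Tree T)
    tree? T = ordered? T ×-dec ((∣ T ∣ ≟ n ∸ 1) ×-dec conn? T)

  trees : List (Subset (n * n))
  trees = filter tree? (subsets (n * n))

  trees-unique : Unique trees
  trees-unique = Unique.filter⁺ tree? (subsets-unique (n * n))

  ∈-trees⁺ : ∀ {T} → Tree T → T ∈ trees
  ∈-trees⁺ {T} tree = ∈-filter⁺ tree? (∈-subsets T) tree

  ∈-trees⁻ : ∀ {T} → T ∈ trees → Tree T
  ∈-trees⁻ T∈ = proj₂ (∈-filter⁻ tree? {xs = subsets (n * n)} T∈)

  τ : Subset (n * n) → ℕ
  τ X = cnt trees X

  -- The fibres of the labelling are the components of the forest.
  data Forest : Subset (n * n) → Labelling n → Set where
    empty : Forest ⊥ id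
    add   : ∀ {F ℓ e} → Forest F ℓ → src e <ᶠ tgt e → ℓ (src e) ≢ ℓ (tgt e) → Forest (F ∪ ⁅ e ⁆) (merge ℓ (src e) (tgt e))

  forest-respects : ∀ {F ℓ} → Forest F ℓ → Respects ℓ F
  forest-respects empty e∈ = ⊥-elim (∉⊥ e∈)
  forest-respects (add {F} {ℓ} {e} fo lt neq) f∈ with x∈p∪q⁻ F ⁅ e ⁆ f∈
  ... | inj₁ f∈F = merge-cong ℓ (src e) (tgt e) (forest-respects fo f∈F)
  ... | inj₂ f∈e with x∈⁅y⁆⇒x≡y e f∈e
  ... | refl = merge-joins ℓ (src e) (tgt e)

  forest-ordered : ∀ {F ℓ} → Forest F ℓ → Ordered F
  forest-ordered empty e∈ = ⊥-elim (∉⊥ e∈)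
  forest-ordered (add {F} {ℓ} {e} fo lt neq) f∈ with x∈p∪q⁻ F ⁅ e ⁆ f∈
  ... | inj₁ f∈F = forest-ordered fo f∈F
  ... | inj₂ f∈e with x∈⁅y⁆⇒x≡y e f∈e
  ... | refl = lt

  -- Together with `forest-respects` this identifies the fibres of ℓ with the connected components
  -- of F.
  forest-least : ∀ {F ℓ} → Forest F ℓ → ∀ ℓ′ → Respects ℓ′ F → ∀ {x y} → ℓ x ≡ ℓ y → ℓ′ x ≡ ℓ′ y
  forest-least empty ℓ′ resp refl = refl
  forest-least (add {F} {ℓ} {e} fo lt neq) ℓ′ resp eq = merge-least ℓ (src e) (tgt e) (λ x y → ℓ′ x ≡ ℓ′ y) sym trans
    (resp (x∈p∪q⁺ (inj₂ (x∈⁅x⁆ e)))) (forest-least fo ℓ′ (λ f∈ → resp (x∈p∪q⁺ (inj₁ f∈)))) eq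

  separated⇒∉ : ∀ {F ℓ e} → Forest F ℓ → ℓ (src e) ≢ ℓ (tgt e) → e ∉ˢ F
  separated⇒∉ fo neq e∈ = neq (forest-respects fo e∈)

  forest-classes : ∀ {F ℓ} → Forest F ℓ → ∣ F ∣ + classes ℓ ≡ n
  forest-classes empty = cong₂ _+_ (∣⊥∣≡0 (n * n)) classes-id
  forest-classes (add {F} {ℓ} {e} fo lt neq) = trans (cong (_+ classes (merge ℓ (src e) (tgt e)))
      (∣p∪⁅x⁆∣≡1+∣p∣ (separated⇒∉ fo neq)))
    (trans (sym (+-suc ∣ F ∣ _)) (trans (cong (∣ F ∣ +_) (sym (classes-merge ℓ (src e) (tgt e) neq))) (forest-classes fo)))

  classes≡1⇒const : ∀ (ℓ : Labelling n) → classes ℓ ≡ 1 → ∀ u v → ℓ u ≡ ℓ v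
  classes≡1⇒const ℓ eq u v = decidable-stable (ℓ u ≟ᶠ ℓ v) (λ neq → <⇒≱ (classes≥2 ℓ neq) (≤-reflexive eq))

  connected-forest : ∀ {F ℓ} → Forest F ℓ → classes ℓ ≡ 1 → Tree F
  connected-forest {F} {ℓ} fo eq = forest-ordered fo ,
    trans (sym (m+n∸n≡m ∣ F ∣ 1)) (cong (_∸ 1) (trans (cong (∣ F ∣ +_) (sym eq)) (forest-classes fo))) ,
    λ ℓ′ resp u v → forest-least fo ℓ′ resp (classes≡1⇒const ℓ eq u v)

  -- Otherwise T minus e would still connect everything, with too few edges.
  tree-edge-separated : ∀ {T F ℓ e} → Tree T → Forest F ℓ → F ⊆ T → e ∈ˢ T → e ∉ˢ F → ℓ (src e) ≢ ℓ (tgt e)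
  tree-edge-separated {T} {F} {ℓ} {e} (_ , size , conn) fo F⊆T e∈T e∉F eq = <⇒≱ too-few enough
    where
    open ≤-Reasoning
    rest = (T ─ F) - e
    es = edgesOf rest
    ℓ′ = process es ℓ
    resp : Respects ℓ′ T
    resp {f} f∈ with f ∈? F | f ≟ᶠ e
    ... | yes f∈F | _ = process-cong es ℓ (forest-respects fo f∈F)
    ... | no _ | yes refl = process-cong es ℓ eq
    ... | no f∉F | no f≢e = process-joins es ℓ (∈-edgesOf {rest} (x∈p∧x≢y⇒x∈p-y (x∈p∧x∉q⇒x∈p─q f∈ f∉F) f≢e))
    e∈T─F : e ∈ˢ T ─ F
    e∈T─F = x∈p∧x∉q⇒x∈p─q e∈T e∉F
    sizes : ∣ F ∣ + suc ∣ rest ∣ ≡ n ∸ 1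
    sizes = trans (cong₂ _+_ (cong ∣_∣ (sym T∩F≡F)) (sym (∣p∣≡1+∣p-x∣ e∈T─F))) (trans (sym (∣p∣≡∣p∩q∣+∣p─q∣ T F)) size)
      where
      T∩F≡F : T ∩ F ≡ F
      T∩F≡F = ⊆-antisym (p∩q⊆q T F) (λ x∈ → x∈p∩q⁺ (F⊆T x∈ , x∈))
    few : classes ℓ ≤ ∣ rest ∣ + 1
    few = ≤-trans (classes-process es ℓ) (+-mono-≤ (≤-reflexive (length-edgesOf rest))
        (classes-const ℓ′ (src e) (conn ℓ′ resp)))
    enough : n ≤ n ∸ 1
    enough = begin
      n  ≡⟨ sym (forest-classes fo) ⟩
      ∣ F ∣ + classes ℓ  ≤⟨ +-monoʳ-≤ ∣ F ∣ few ⟩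
      ∣ F ∣ + (∣ rest ∣ + 1)  ≡⟨ cong (∣ F ∣ +_) (+-comm ∣ rest ∣ 1) ⟩
      ∣ F ∣ + suc ∣ rest ∣  ≡⟨ sizes ⟩
      n ∸ 1  ∎
    too-few : n ∸ 1 < n
    too-few = ∸-monoʳ-< {n} {1} {0} (s≤s z≤n) (positive (src e))
      where
      positive : ∀ {m} → Fin m → 1 ≤ m
      positive zero = s≤s z≤n
      positive (suc _) = s≤s z≤n

  separates? : ∀ (ℓ : Labelling n) e → Dec (src e <ᶠ tgt e × ℓ (src e) ≢ ℓ (tgt e))
  separates? ℓ e = (src e <ᶠ? tgt e) ×-dec ¬? (ℓ (src e) ≟ᶠ ℓ (tgt e))

  ∑-separating : ∀ (ℓ : Labelling n) {c} → classes ℓ ≡ suc c →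
    ∑ (allFin (n * n)) (λ e → 𝟙 (separates? ℓ e) * weight (merge ℓ (src e) (tgt e))) ≡ n * (c * weight ℓ)
  ∑-separating ℓ eq = trans (∑-combine n n _) (trans (∑-cong (allFin n) (λ u → ∑-cong (allFin n) (λ v →
    cong₂ (λ a b → 𝟙 ((a <ᶠ? b) ×-dec ¬? (ℓ a ≟ᶠ ℓ b)) * weight (merge ℓ a b)) (src-combine u v) (tgt-combine u v))))
        (∑-ordered-merge ℓ eq))

  -- Counting pairs of a tree T ⊇ F and an edge of T ─ F in two ways.
  τ-extend : ∀ {F ℓ c} → Forest F ℓ → classes ℓ ≡ suc c →
    c * τ F ≡ ∑ (allFin (n * n)) (λ e → 𝟙 (separates? ℓ e) * τ (F ∪ ⁅ e ⁆))
  τ-extend {F} {ℓ} {c} fo eq = begin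
    c * τ F  ≡⟨ sym (∑-*ˡ trees c _) ⟩
    ∑ trees (λ T → c * 𝟙 (F ⊆? T))  ≡⟨ ∑-cong-∈ trees (λ {T} T∈ → trans (*-comm c _) (𝟙*-cong (F ⊆? T) (λ F⊆T → missing T∈ F⊆T))) ⟩
    ∑ trees (λ T → 𝟙 (F ⊆? T) * ∑ E (λ e → 𝟙 (e ∈? (T ─ F))))  ≡⟨ ∑-cong trees (λ T → sym (∑-*ˡ E (𝟙 (F ⊆? T)) _)) ⟩
    ∑ trees (λ T → ∑ E (λ e → 𝟙 (F ⊆? T) * 𝟙 (e ∈? (T ─ F))))  ≡⟨ ∑-cong-∈ trees (λ T∈ → ∑-cong E (λ e → each T∈ e)) ⟩
    ∑ trees (λ T → ∑ E (λ e → 𝟙 (separates? ℓ e) * 𝟙 ((F ∪ ⁅ e ⁆) ⊆? T)))  ≡⟨ ∑-swap trees E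
        (λ T e → 𝟙 (separates? ℓ e) * 𝟙 ((F ∪ ⁅ e ⁆) ⊆? T)) ⟩
    ∑ E (λ e → ∑ trees (λ T → 𝟙 (separates? ℓ e) * 𝟙 ((F ∪ ⁅ e ⁆) ⊆? T)))  ≡⟨ ∑-cong E
        (λ e → ∑-*ˡ trees (𝟙 (separates? ℓ e)) _) ⟩
    ∑ E (λ e → 𝟙 (separates? ℓ e) * τ (F ∪ ⁅ e ⁆))  ∎
    where
    open ≡-Reasoning
    E = allFin (n * n)
    missing : ∀ {T} → T ∈ trees → F ⊆ T → c ≡ ∑ E (λ e → 𝟙 (e ∈? (T ─ F)))
    missing {T} T∈ F⊆T = trans (+-cancelˡ-≡ ∣ F ∣ _ _ (begin
      ∣ F ∣ + c  ≡⟨ sym (cong (_∸ 1) (+-suc ∣ F ∣ c)) ⟩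
      (∣ F ∣ + suc c) ∸ 1  ≡⟨ cong (λ z → (∣ F ∣ + z) ∸ 1) (sym eq) ⟩
      (∣ F ∣ + classes ℓ) ∸ 1  ≡⟨ cong (_∸ 1) (forest-classes fo) ⟩
      n ∸ 1  ≡⟨ sym (proj₁ (proj₂ (∈-trees⁻ T∈))) ⟩
      ∣ T ∣  ≡⟨ ∣p∣≡∣p∩q∣+∣p─q∣ T F ⟩
      ∣ T ∩ F ∣ + ∣ T ─ F ∣  ≡⟨ cong (λ z → ∣ z ∣ + ∣ T ─ F ∣) (⊆-antisym (p∩q⊆q T F) (λ x∈ → x∈p∩q⁺ (F⊆T x∈ , x∈))) ⟩
      ∣ F ∣ + ∣ T ─ F ∣  ∎)) (∣p∣≡∑ (T ─ F))
    each : ∀ {T} → T ∈ trees → ∀ e → 𝟙 (F ⊆? T) * 𝟙 (e ∈? (T ─ F)) ≡ 𝟙 (separates? ℓ e) * 𝟙 ((F ∪ ⁅ e ⁆) ⊆? T)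
    each {T} T∈ e = trans (sym (𝟙-× (F ⊆? T) (e ∈? (T ─ F))))
        (trans (𝟙-cong ((F ⊆? T) ×-dec (e ∈? (T ─ F))) (separates? ℓ e ×-dec ((F ∪ ⁅ e ⁆) ⊆? T)) to from)
        (𝟙-× (separates? ℓ e) _))
      where
      tree = ∈-trees⁻ T∈
      to : F ⊆ T × e ∈ˢ T ─ F → (src e <ᶠ tgt e × ℓ (src e) ≢ ℓ (tgt e)) × F ∪ ⁅ e ⁆ ⊆ T
      to (F⊆T , e∈) = let e∈T = p─q⊆p T F e∈ in (proj₁ tree e∈T , tree-edge-separated tree fo F⊆T e∈T (x∈p─q⇒x∉q T F e∈)) , ∪-lub F⊆T (⁅x⁆⊆ e∈T)
      from : (src e <ᶠ tgt e × ℓ (src e) ≢ ℓ (tgt e)) × F ∪ ⁅ e ⁆ ⊆ T → F ⊆ T × e ∈ˢ T ─ F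
      from ((_ , neq) , sub) = (λ x∈ → sub (x∈p∪q⁺ (inj₁ x∈))) , x∈p∧x∉q⇒x∈p─q (sub (x∈p∪q⁺ (inj₂ (x∈⁅x⁆ e))))
          (separated⇒∉ fo neq)

  τ-tree : ∀ {T} → Tree T → τ T ≡ 1
  τ-tree {T} tree = ≤-antisym
    (≤-trans (∑-mono-∈ trees (λ {T′} T′∈ → 𝟙-mono (T ⊆? T′) (T ≟ˢ T′) (λ s → p⊆q∧∣q∣≤∣p∣⇒p≡q s (≤-reflexive (trans (proj₁ (proj₂ (∈-trees⁻ T′∈))) (sym (proj₁ (proj₂ tree)))))))) (∑-unique≤1 _≟ˢ_ trees-unique T))
    (≤-trans (≤-reflexive (sym (𝟙-yes (T ⊆? T) ⊆-refl))) (∑-∈ (λ T′ → 𝟙 (T ⊆? T′)) (∈-trees⁺ tree)))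

  -- Induction on the number of components. Double counting expresses `τ F` through the forests with
  -- one more edge, and `∑-separating` is the matching identity for their weights, so the factors c
  -- cancel. The factor n on the left avoids the exponent c - 1, which would be negative for a tree.
  forest-count : ∀ c {F ℓ} → Forest F ℓ → classes ℓ ≡ suc c → n * τ F ≡ n ^ c * weight ℓ
  forest-count zero {F} {ℓ} fo eq = begin
    n * τ F  ≡⟨ cong (n *_) (τ-tree (connected-forest fo eq)) ⟩
    n * 1  ≡⟨ *-comm n 1 ⟩
    1 * n  ≡⟨ cong (1 *_) (sym (weight-connected ℓ vertex (classes≡1⇒const ℓ eq))) ⟩
    1 * weight ℓ  ∎
    where
    open ≡-Reasoning
    vertex : Fin n
    vertex = proj₁ (∑-witness₀ (allFin n) (λ a → 𝟙 (used? ℓ a)) (≤-reflexive (sym eq)))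
  forest-count (suc c) {F} {ℓ} fo eq = *-cancelˡ-≡ _ _ (suc c) (begin
    suc c * (n * τ F)  ≡⟨ alg (suc c) n (τ F) ⟩
    n * (suc c * τ F)  ≡⟨ cong (n *_) (τ-extend fo eq) ⟩
    n * ∑ E (λ e → 𝟙 (separates? ℓ e) * τ (F ∪ ⁅ e ⁆))  ≡⟨ sym (∑-*ˡ E n _) ⟩
    ∑ E (λ e → n * (𝟙 (separates? ℓ e) * τ (F ∪ ⁅ e ⁆)))  ≡⟨ ∑-cong E each ⟩
    ∑ E (λ e → n ^ c * (𝟙 (separates? ℓ e) * weight (merge ℓ (src e) (tgt e))))  ≡⟨ ∑-*ˡ E (n ^ c) _ ⟩
    n ^ c * ∑ E (λ e → 𝟙 (separates? ℓ e) * weight (merge ℓ (src e) (tgt e)))  ≡⟨ cong (n ^ c *_) (∑-separating ℓ eq) ⟩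
    n ^ c * (n * (suc c * weight ℓ))  ≡⟨ alg₂ (n ^ c) n (suc c) (weight ℓ) ⟩
    suc c * (n * n ^ c * weight ℓ)  ∎)
    where
    open ≡-Reasoning
    E = allFin (n * n)
    alg : ∀ a b c → a * (b * c) ≡ b * (a * c)
    alg = solve-∀
    alg₂ : ∀ p n s w → p * (n * (s * w)) ≡ s * (n * p * w)
    alg₂ = solve-∀
    each : ∀ e → n * (𝟙 (separates? ℓ e) * τ (F ∪ ⁅ e ⁆)) ≡ n ^ c * (𝟙 (separates? ℓ e) * weight (merge ℓ (src e) (tgt e)))
    each e = trans (alg n (𝟙 (separates? ℓ e)) _) (trans (𝟙*-cong (separates? ℓ e) (λ (lt , neq) →
        forest-count c (add fo lt neq) (suc-injective (trans (sym (classes-merge ℓ (src e) (tgt e) neq)) eq))))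
      (alg (𝟙 (separates? ℓ e)) (n ^ c) _))

  weight-merge-≤ : ∀ (ℓ : Labelling n) u v → ℓ u ≢ ℓ v → weight (merge ℓ u v) ≤ 2 * weight ℓ
  weight-merge-≤ ℓ u v neq = *-cancelʳ-≤ _ _ (a * b) {{m*n≢0 a b {{>-nonZero a>0}} {{>-nonZero b>0}}}} (begin
    weight (merge ℓ u v) * (a * b)  ≡⟨ weight-merge ℓ u v neq ⟩
    weight ℓ * (a + b)  ≤⟨ *-monoʳ-≤ (weight ℓ) (+-mono-≤ (m≤m*n a b {{>-nonZero b>0}}) (m≤n*m b a {{>-nonZero a>0}})) ⟩
    weight ℓ * (a * b + a * b)  ≡⟨ alg (weight ℓ) (a * b) ⟩
    2 * weight ℓ * (a * b)  ∎)
    where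
    open ≤-Reasoning
    a = fibre ℓ (ℓ u)
    b = fibre ℓ (ℓ v)
    a>0 = fibre>0 ℓ u
    b>0 = fibre>0 ℓ v
    alg : ∀ w x → w * (x + x) ≡ 2 * w * x
    alg = solve-∀

  -- The inequality a + b ≤ 2ab improves to 2(a + b) ≤ 3ab once a class has two vertices; sizes 2
  -- and 1 attain it.
  weight-merge-<  : ∀ (ℓ : Labelling n) u v → ℓ u ≢ ℓ v → 1 < fibre ℓ (ℓ u) ⊎ 1 < fibre ℓ (ℓ v) → 2 * weight
      (merge ℓ u v) ≤ 3 * weight ℓ
  weight-merge-< ℓ u v neq big = *-cancelʳ-≤ _ _ (a * b) {{m*n≢0 a b {{>-nonZero a>0}} {{>-nonZero b>0}}}} (begin
    2 * weight (merge ℓ u v) * (a * b)  ≡⟨ *-assoc 2 (weight (merge ℓ u v)) (a * b) ⟩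
    2 * (weight (merge ℓ u v) * (a * b))  ≡⟨ cong (2 *_) (weight-merge ℓ u v neq) ⟩
    2 * (weight ℓ * (a + b))  ≡⟨ alg₁ (weight ℓ) (a + b) ⟩
    weight ℓ * (2 * (a + b))  ≤⟨ *-monoʳ-≤ (weight ℓ) (main big) ⟩
    weight ℓ * (3 * (a * b))  ≡⟨ alg₂ (weight ℓ) (a * b) ⟩
    3 * weight ℓ * (a * b)  ∎)
    where
    open ≤-Reasoning
    a = fibre ℓ (ℓ u)
    b = fibre ℓ (ℓ v)
    a>0 = fibre>0 ℓ u
    b>0 = fibre>0 ℓ v
    alg₁ : ∀ w x → 2 * (w * x) ≡ w * (2 * x)
    alg₁ = solve-∀
    alg₂ : ∀ w x → w * (3 * x) ≡ 3 * w * x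
    alg₂ = solve-∀
    alg₃ : ∀ x y → 2 * (suc (suc x) + suc y) + (4 * y + x + 3 * (x * y)) ≡ 3 * (suc (suc x) * suc y)
    alg₃ = solve-∀
    bound : ∀ {x y} → 1 < x → 0 < y → 2 * (x + y) ≤ 3 * (x * y)
    bound {suc zero} (s≤s ()) _
    bound {suc (suc x)} {suc y} _ _ = ≤-trans (m≤m+n _ (4 * y + x + 3 * (x * y))) (≤-reflexive (alg₃ x y))
    main : 1 < a ⊎ 1 < b → 2 * (a + b) ≤ 3 * (a * b)
    main (inj₁ 1<a) = bound 1<a b>0
    main (inj₂ 1<b) = subst₂ (λ s p → 2 * s ≤ 3 * p) (+-comm b a) (*-comm b a) (bound 1<b a>0)

  weight-merge-≡ : ∀ (ℓ : Labelling n) u v → ℓ u ≢ ℓ v → fibre ℓ (ℓ u) ≡ 1 → fibre ℓ (ℓ v) ≡ 1 → weight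
      (merge ℓ u v) ≡ 2 * weight ℓ
  weight-merge-≡ ℓ u v neq one one′ = begin
    weight (merge ℓ u v)  ≡⟨ sym (*-identityʳ _) ⟩
    weight (merge ℓ u v) * (1 * 1)  ≡⟨ cong₂ (λ a b → weight (merge ℓ u v) * (a * b)) (sym one) (sym one′) ⟩
    weight (merge ℓ u v) * (fibre ℓ (ℓ u) * fibre ℓ (ℓ v))  ≡⟨ weight-merge ℓ u v neq ⟩
    weight ℓ * (fibre ℓ (ℓ u) + fibre ℓ (ℓ v))  ≡⟨ cong₂ (λ a b → weight ℓ * (a + b)) one one′ ⟩
    weight ℓ * 2  ≡⟨ *-comm (weight ℓ) 2 ⟩
    2 * weight ℓ  ∎
    where open ≡-Reasoning

  -- Each added edge at most doubles the weight. Starting from an arbitrary forest F lets a loss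
  -- already present in F persist in X.
  extend-forest : ∀ {T X F ℓ} → Tree T → X ⊆ T → F ⊆ X → Forest F ℓ → ∃ λ ℓ′ →
      Forest X ℓ′ × weight ℓ′ * 2 ^ ∣ F ∣ ≤ weight ℓ * 2 ^ ∣ X ∣
  extend-forest {T} {X} {F₀} {ℓ₀} tree X⊆T F₀⊆X fo₀ = grow-within
      (λ F → ∃ λ ℓ′ → Forest F ℓ′ × weight ℓ′ * 2 ^ ∣ F₀ ∣ ≤ weight ℓ₀ * 2 ^ ∣ F ∣)
    adjoin F₀⊆X (ℓ₀ , fo₀ , ≤-refl)
    where
    open ≤-Reasoning
    alg : ∀ a b → 2 * a * b ≡ 2 * (a * b)
    alg = solve-∀
    alg₂ : ∀ a b → 2 * (a * b) ≡ a * (2 * b)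
    alg₂ = solve-∀
    adjoin : ∀ {F e} → F ⊆ X → e ∈ˢ X → e ∉ˢ F → (∃ λ ℓ′ → Forest F ℓ′ × weight ℓ′ * 2 ^ ∣ F₀ ∣ ≤ weight ℓ₀ * 2 ^ ∣ F ∣) →
      ∃ λ ℓ′ → Forest (F ∪ ⁅ e ⁆) ℓ′ × weight ℓ′ * 2 ^ ∣ F₀ ∣ ≤ weight ℓ₀ * 2 ^ ∣ F ∪ ⁅ e ⁆ ∣
    adjoin {F} {e} F⊆X e∈X e∉F (ℓ , fo , w) = merge ℓ (src e) (tgt e) , add fo (proj₁ tree (X⊆T e∈X)) neq , (begin
      weight (merge ℓ (src e) (tgt e)) * 2 ^ ∣ F₀ ∣  ≤⟨ *-monoˡ-≤ _ (weight-merge-≤ ℓ (src e) (tgt e) neq) ⟩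
      2 * weight ℓ * 2 ^ ∣ F₀ ∣  ≡⟨ alg (weight ℓ) _ ⟩
      2 * (weight ℓ * 2 ^ ∣ F₀ ∣)  ≤⟨ *-monoʳ-≤ 2 w ⟩
      2 * (weight ℓ₀ * 2 ^ ∣ F ∣)  ≡⟨ alg₂ (weight ℓ₀) _ ⟩
      weight ℓ₀ * 2 ^ suc ∣ F ∣  ≡⟨ cong (λ z → weight ℓ₀ * 2 ^ z) (sym (∣p∪⁅x⁆∣≡1+∣p∣ e∉F)) ⟩
      weight ℓ₀ * 2 ^ ∣ F ∪ ⁅ e ⁆ ∣  ∎)
      where
      neq = tree-edge-separated tree fo (⊆-trans F⊆X X⊆T) (X⊆T e∈X) e∉F

  tree-subset-forest : ∀ {T X} → Tree T → X ⊆ T → ∃ λ ℓ → Forest X ℓ × weight ℓ ≤ 2 ^ ∣ X ∣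
  tree-subset-forest {T} {X} tree X⊆T with extend-forest tree X⊆T ⊥⊆ empty
  ... | ℓ , fo , w = ℓ , fo , (begin
      weight ℓ  ≡⟨ sym (*-identityʳ _) ⟩
      weight ℓ * 2 ^ 0  ≡⟨ cong (λ z → weight ℓ * 2 ^ z) (sym (∣⊥∣≡0 (n * n))) ⟩
      weight ℓ * 2 ^ ∣ ⊥ {n * n} ∣  ≤⟨ w ⟩
      weight (id {A = Fin n}) * 2 ^ ∣ X ∣ ≡⟨ cong (_* 2 ^ ∣ X ∣) (weight-id {n}) ⟩
      1 * 2 ^ ∣ X ∣  ≡⟨ *-identityˡ _ ⟩
      2 ^ ∣ X ∣  ∎)
    where open ≤-Reasoning

  zero-or-tree : ∀ X → τ X ≡ 0 ⊎ ∃ λ T → Tree T × X ⊆ T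
  zero-or-tree X with any? (X ⊆?_) trees
  ... | yes some = let T , T∈ , X⊆T = find some in inj₂ (T , ∈-trees⁻ T∈ , X⊆T)
  ... | no none = inj₁ (trans (∑-cong-∈ trees (λ {T} T∈ → 𝟙-no (X ⊆? T) (λ X⊆T → none (lose T∈ X⊆T)))) (∑-0 trees))

  classes-pred : ∀ {F ℓ} → Fin n → Forest F ℓ → ∃ λ c → classes ℓ ≡ suc c × ∣ F ∣ + suc c ≡ n
  classes-pred {F} {ℓ} u fo with classes ℓ in eq | forest-classes fo
  ... | zero | _ = ⊥-elim (<⇒≱ (≤-trans (≤-reflexive (sym (𝟙-yes (used? ℓ (ℓ u)) (u , refl))))
      (∑-∈ (λ a → 𝟙 (used? ℓ a)) (∈-allFin (ℓ u)))) (≤-reflexive eq))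
  ... | suc c | s = c , refl , s

-- Numbers of trees through small edge sets

module TreeBounds (n : ℕ) (2≤n : 2 ≤ n) where
  open Trees n

  u₀ : Fin n
  u₀ = fromℕ< (≤-trans (n≤1+n 1) 2≤n)

  instance
    n≢0 : NonZero n
    n≢0 = >-nonZero (≤-trans (n≤1+n 1) 2≤n)

  -- The exact count is the weight times n^(n-2-|X|), and a forest has weight at most 2^|X|.
  τ-spread : ∀ X → τ X * n ^ ∣ X ∣ ≤ 2 ^ ∣ X ∣ * n ^ (n ∸ 2)
  τ-spread X with zero-or-tree X
  ... | inj₁ eq = ≤-trans (≤-reflexive (cong (_* n ^ ∣ X ∣) eq)) z≤n
  ... | inj₂ (T , tree , X⊆T) with tree-subset-forest tree X⊆T
  ... | ℓ , fo , w with classes-pred u₀ fo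
  ... | c , eq , size = *-cancelˡ-≤ n (begin
    n * (τ X * n ^ x)  ≡⟨ sym (*-assoc n (τ X) _) ⟩
    n * τ X * n ^ x  ≡⟨ cong (_* n ^ x) (forest-count c fo eq) ⟩
    n ^ c * weight ℓ * n ^ x  ≤⟨ *-monoˡ-≤ (n ^ x) (*-monoʳ-≤ (n ^ c) w) ⟩
    n ^ c * 2 ^ x * n ^ x  ≡⟨ alg (n ^ c) (2 ^ x) (n ^ x) ⟩
    2 ^ x * (n ^ x * n ^ c)  ≡⟨ cong (2 ^ x *_) (trans (sym (^-distribˡ-+-* n x c)) (cong (n ^_) exponent)) ⟩
    2 ^ x * (n * n ^ (n ∸ 2))  ≡⟨ alg₂ (2 ^ x) n _ ⟩
    n * (2 ^ x * n ^ (n ∸ 2))  ∎)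
    where
    open ≤-Reasoning
    x = ∣ X ∣
    alg : ∀ a b c → a * b * c ≡ b * (c * a)
    alg = solve-∀
    alg₂ : ∀ a b c → a * (b * c) ≡ b * (a * c)
    alg₂ = solve-∀
    exponent : x + c ≡ suc (n ∸ 2)
    exponent = suc-injective (trans (sym (+-suc x c)) (trans size (sym (m+[n∸m]≡n 2≤n))))

  module Size {t : ℕ} (t+2≤n : t + 2 ≤ n) where

    M : ℕ
    M = 2 ^ t * n ^ (n ∸ t ∸ 2)

    exponent : n ≡ t + (2 + (n ∸ t ∸ 2))
    exponent = sym (trans (cong (t +_) (m+[n∸m]≡n (m+n≤o⇒m≤o∸n 2 (≤-trans (≤-reflexive (+-comm 2 t)) t+2≤n))))
        (m+[n∸m]≡n (m+n≤o⇒m≤o t t+2≤n)))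

    forest-τ : ∀ {F ℓ} → Forest F ℓ → ∣ F ∣ ≡ t → τ F ≡ weight ℓ * n ^ (n ∸ t ∸ 2)
    forest-τ {F} {ℓ} fo eq with classes-pred u₀ fo
    ... | c , eqc , size = *-cancelˡ-≡ _ _ n (begin
      n * τ F  ≡⟨ forest-count c fo eqc ⟩
      n ^ c * weight ℓ  ≡⟨ cong (λ z → n ^ z * weight ℓ) c≡ ⟩
      n * n ^ (n ∸ t ∸ 2) * weight ℓ  ≡⟨ alg n (n ^ (n ∸ t ∸ 2)) (weight ℓ) ⟩
      n * (weight ℓ * n ^ (n ∸ t ∸ 2))  ∎)
      where
      open ≡-Reasoning
      alg : ∀ a b c → a * b * c ≡ a * (c * b)
      alg = solve-∀
      c≡ : c ≡ suc (n ∸ t ∸ 2)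
      c≡ = suc-injective (+-cancelˡ-≡ t _ _ (trans (cong (_+ suc c) (sym eq)) (trans size exponent)))

    density : ∀ X j → ∣ X ∣ ≡ t + j → τ X * n ^ j ≤ 2 ^ j * M
    density X j eq = *-cancelʳ-≤ _ _ (n ^ t) {{m^n≢0 n t}} (begin
      τ X * n ^ j * n ^ t  ≡⟨ alg (τ X) (n ^ j) (n ^ t) ⟩
      τ X * (n ^ t * n ^ j)  ≡⟨ cong (τ X *_) (trans (sym (^-distribˡ-+-* n t j)) (cong (n ^_) (sym eq))) ⟩
      τ X * n ^ ∣ X ∣  ≤⟨ τ-spread X ⟩
      2 ^ ∣ X ∣ * n ^ (n ∸ 2)  ≡⟨ cong₂ _*_ (trans (cong (2 ^_) eq) (^-distribˡ-+-* 2 t j))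
          (trans (cong (n ^_) n∸2) (^-distribˡ-+-* n t _)) ⟩
      2 ^ t * 2 ^ j * (n ^ t * n ^ (n ∸ t ∸ 2))  ≡⟨ alg₂ (2 ^ t) (2 ^ j) (n ^ t) (n ^ (n ∸ t ∸ 2)) ⟩
      2 ^ j * M * n ^ t  ∎)
      where
      open ≤-Reasoning
      alg : ∀ a b c → a * b * c ≡ a * (c * b)
      alg = solve-∀
      alg₂ : ∀ a b c d → a * b * (c * d) ≡ b * (a * d) * c
      alg₂ = solve-∀
      n∸2 : n ∸ 2 ≡ t + (n ∸ t ∸ 2)
      n∸2 = trans (cong (_∸ 2) (trans exponent (alg₃ t _))) refl
        where
        alg₃ : ∀ t m → t + (2 + m) ≡ 2 + (t + m)
        alg₃ = solve-∀

    Clash : Subset (n * n) → Fin (n * n) → Fin (n * n) → Set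
    Clash B e f = e ∈ˢ B × f ∈ˢ B × e ≢ f × (src e ≡ src f ⊎ src e ≡ tgt f ⊎ tgt e ≡ src f ⊎ tgt e ≡ tgt f)

    clash? : ∀ B → Dec (∃ λ e → ∃ λ f → Clash B e f)
    clash? B = anyᶠ? (λ e → anyᶠ? (λ f → (e ∈? B) ×-dec ((f ∈? B) ×-dec (¬? (e ≟ᶠ f) ×-dec
      ((src e ≟ᶠ src f) ⊎-dec ((src e ≟ᶠ tgt f) ⊎-dec ((tgt e ≟ᶠ src f) ⊎-dec (tgt e ≟ᶠ tgt f))))))))

    -- The forest is grown from the two touching edges: their component has three vertices and
    -- weight 3 instead of 4, and the remaining edges at most double the weight.
    clash-τ : ∀ {B} → ∣ B ∣ ≡ t → (∃ λ e → ∃ λ f → Clash B e f) → 4 * τ B ≤ 3 * M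
    clash-τ {B} size (e , f , e∈ , f∈ , e≢f , share) with zero-or-tree B
    ... | inj₁ eq = ≤-trans (≤-reflexive (cong (4 *_) eq)) z≤n
    ... | inj₂ (T , tree , B⊆T) = begin
      4 * τ B  ≡⟨ cong (4 *_) (forest-τ (proj₁ (proj₂ ext)) size) ⟩
      4 * (weight ℓ * n ^ (n ∸ t ∸ 2))  ≡⟨ sym (*-assoc 4 (weight ℓ) _) ⟩
      4 * weight ℓ * n ^ (n ∸ t ∸ 2)  ≤⟨ *-monoˡ-≤ (n ^ (n ∸ t ∸ 2)) w ⟩
      3 * 2 ^ t * n ^ (n ∸ t ∸ 2)  ≡⟨ *-assoc 3 (2 ^ t) _ ⟩
      3 * M  ∎
      where
      open ≤-Reasoning
      F₁ = ⊥ ∪ ⁅ e ⁆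
      ℓ₁ = merge id (src e) (tgt e)
      e<  = proj₁ tree (B⊆T e∈)
      e-neq : src e ≢ tgt e
      e-neq eq = <-irrefl (cong toℕ eq) e<
      fo₁ : Forest F₁ ℓ₁
      fo₁ = add empty e< e-neq
      F₁⊆B : F₁ ⊆ B
      F₁⊆B = ∪-lub ⊥⊆ (⁅x⁆⊆ e∈)
      f∉F₁ : f ∉ˢ F₁
      f∉F₁ f∈F₁ with x∈p∪q⁻ ⊥ ⁅ e ⁆ f∈F₁
      ... | inj₁ f∈⊥ = ∉⊥ f∈⊥
      ... | inj₂ f∈e = e≢f (sym (x∈⁅y⁆⇒x≡y e f∈e))
      f-neq : ℓ₁ (src f) ≢ ℓ₁ (tgt f)
      f-neq = tree-edge-separated tree fo₁ (⊆-trans F₁⊆B B⊆T) (B⊆T f∈) f∉F₁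
      fo₂ : Forest (F₁ ∪ ⁅ f ⁆) (merge ℓ₁ (src f) (tgt f))
      fo₂ = add fo₁ (proj₁ tree (B⊆T f∈)) f-neq
      ℓ₂ = merge ℓ₁ (src f) (tgt f)
      joined : ℓ₁ (src e) ≡ ℓ₁ (tgt e)
      joined = merge-joins id (src e) (tgt e)
      big : 1 < fibre ℓ₁ (ℓ₁ (src f)) ⊎ 1 < fibre ℓ₁ (ℓ₁ (tgt f))
      big = go share
        where
        both : ∀ {a} → ℓ₁ (src e) ≡ a → 1 < fibre ℓ₁ a
        both refl = fibre>1 ℓ₁ e-neq refl (sym joined)
        go : _ → _
        go (inj₁ p) = inj₁ (both (cong ℓ₁ p))
        go (inj₂ (inj₁ p)) = inj₂ (both (cong ℓ₁ p))
        go (inj₂ (inj₂ (inj₁ p))) = inj₁ (both (trans joined (cong ℓ₁ p)))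
        go (inj₂ (inj₂ (inj₂ p))) = inj₂ (both (trans joined (cong ℓ₁ p)))
      ext = extend-forest tree B⊆T (∪-lub F₁⊆B (⁅x⁆⊆ f∈)) fo₂
      ℓ = proj₁ ext
      ∣F₂∣ : ∣ F₁ ∪ ⁅ f ⁆ ∣ ≡ 2
      ∣F₂∣ = trans (∣p∪⁅x⁆∣≡1+∣p∣ f∉F₁) (cong suc (trans (∣p∪⁅x⁆∣≡1+∣p∣ {x = e} ∉⊥) (cong suc (∣⊥∣≡0 (n * n)))))
      w₂ : weight ℓ₂ ≤ 3
      w₂ = *-cancelˡ-≤ 2 (begin
        2 * weight ℓ₂  ≤⟨ weight-merge-< ℓ₁ (src f) (tgt f) f-neq big ⟩
        3 * weight ℓ₁  ≤⟨ *-monoʳ-≤ 3 (weight-merge-≤ id (src e) (tgt e) e-neq) ⟩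
        3 * (2 * weight (id {A = Fin n}))  ≡⟨ cong (λ z → 3 * (2 * z)) (weight-id {n}) ⟩
        6  ∎)
      w : 4 * weight ℓ ≤ 3 * 2 ^ t
      w = begin
        4 * weight ℓ  ≡⟨ *-comm 4 (weight ℓ) ⟩
        weight ℓ * 2 ^ 2  ≡⟨ cong (λ z → weight ℓ * 2 ^ z) (sym ∣F₂∣) ⟩
        weight ℓ * 2 ^ ∣ F₁ ∪ ⁅ f ⁆ ∣  ≤⟨ proj₂ (proj₂ ext) ⟩
        weight ℓ₂ * 2 ^ ∣ B ∣  ≡⟨ cong (λ z → weight ℓ₂ * 2 ^ z) size ⟩
        weight ℓ₂ * 2 ^ t  ≤⟨ *-monoˡ-≤ (2 ^ t) w₂ ⟩
        3 * 2 ^ t  ∎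

    matching-forest : ∀ {B} → Ordered B → ¬ (∃ λ e → ∃ λ f → Clash B e f) → ∃ λ ℓ → Forest B ℓ × weight ℓ ≡ 2 ^ ∣ B ∣
    matching-forest {B} ord no-clash = let ℓ , fo , w , _ = grow-within Partial adjoin ⊥⊆ (id , empty , trans (weight-id {n}) (cong (2 ^_) (sym (∣⊥∣≡0 (n * n)))) , (λ _ eq → eq)) in ℓ , fo , w
      where
      Untouched : Subset (n * n) → Fin n → Set
      Untouched F w = ∀ {e} → e ∈ˢ F → src e ≢ w × tgt e ≢ w
      -- Keeping untouched vertices in classes of their own makes each new edge join two singletons,
      -- which doubles the weight exactly.
      Partial : Subset (n * n) → Set
      Partial F = ∃ λ ℓ → Forest F ℓ × weight ℓ ≡ 2 ^ ∣ F ∣ × (∀ {w} → Untouched F w → ∀ {x} → ℓ x ≡ ℓ w → x ≡ w)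
      adjoin : ∀ {F e} → F ⊆ B → e ∈ˢ B → e ∉ˢ F → Partial F → Partial (F ∪ ⁅ e ⁆)
      adjoin {F} {e} F⊆B e∈ e∉F (ℓ , fo , w , single) = m , add fo (ord e∈) neq ,
          trans (weight-merge-≡ ℓ u v neq (fibre≡1 ℓ u (λ _ → single u-free)) (fibre≡1 ℓ v (λ _ → single v-free)))
            (trans (cong (2 *_) w) (cong (2 ^_) (sym (∣p∪⁅x⁆∣≡1+∣p∣ e∉F)))) , single′
        where
        u = src e
        v = tgt e
        m = merge ℓ u v
        e≢ : ∀ {f} → f ∈ˢ F → e ≢ f
        e≢ f∈ refl = e∉F f∈
        u-free : Untouched F u
        u-free f∈ = (λ p → no-clash (e , _ , e∈ , F⊆B f∈ , e≢ f∈ , inj₁ (sym p))) ,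
                    (λ p → no-clash (e , _ , e∈ , F⊆B f∈ , e≢ f∈ , inj₂ (inj₁ (sym p))))
        v-free : Untouched F v
        v-free f∈ = (λ p → no-clash (e , _ , e∈ , F⊆B f∈ , e≢ f∈ , inj₂ (inj₂ (inj₁ (sym p))))) ,
                    (λ p → no-clash (e , _ , e∈ , F⊆B f∈ , e≢ f∈ , inj₂ (inj₂ (inj₂ (sym p)))))
        neq : ℓ u ≢ ℓ v
        neq eq = <-irrefl (cong toℕ (single v-free eq)) (ord e∈)
        single′ : ∀ {w} → Untouched (F ∪ ⁅ e ⁆) w → ∀ {x} → m x ≡ m w → x ≡ w
        single′ {w} free {x} eq with ℓ x ≟ᶠ ℓ v | ℓ w ≟ᶠ ℓ v
        ... | _ | yes p = ⊥-elim (proj₂ (free (x∈p∪q⁺ (inj₂ (x∈⁅x⁆ e)))) (sym (single v-free p)))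
        ... | yes _ | no _ = ⊥-elim (proj₁ (free (x∈p∪q⁺ (inj₂ (x∈⁅x⁆ e)))) (single (λ f∈ → free (x∈p∪q⁺ (inj₁ f∈))) eq))
        ... | no _ | no _ = single (λ f∈ → free (x∈p∪q⁺ (inj₁ f∈))) eq

    matching-τ : ∀ {B} → Ordered B → ∣ B ∣ ≡ t → ¬ (∃ λ e → ∃ λ f → Clash B e f) → τ B ≡ M
    matching-τ {B} ord size no-clash with matching-forest ord no-clash
    ... | ℓ , fo , w = trans (forest-τ fo size) (cong (_* n ^ (n ∸ t ∸ 2)) (trans w (cong (2 ^_) size)))

-- Switching

p-x∪⁅x⁆≡p : ∀ {N} {p : Subset N} {x} → x ∈ˢ p → (p - x) ∪ ⁅ x ⁆ ≡ p
p-x∪⁅x⁆≡p {p = p} {x} x∈ = ⊆-antisym (∪-lub (p─q⊆p p ⁅ x ⁆) (⁅x⁆⊆ x∈)) λ {y} y∈ → helper y∈ (y ≟ᶠ x)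
  where
  helper : ∀ {y} → y ∈ˢ p → Dec (y ≡ x) → y ∈ˢ (p - x) ∪ ⁅ x ⁆
  helper y∈ (yes refl) = x∈p∪q⁺ (inj₂ (x∈⁅x⁆ x))
  helper y∈ (no neq) = x∈p∪q⁺ (inj₁ (x∈p∧x≢y⇒x∈p-y y∈ neq))

p∪⁅x⁆-x≡p : ∀ {N} {p : Subset N} {x} → x ∉ˢ p → (p ∪ ⁅ x ⁆) - x ≡ p
p∪⁅x⁆-x≡p {p = p} {x} x∉ = ⊆-antisym to (λ y∈ → x∈p∧x≢y⇒x∈p-y (x∈p∪q⁺ (inj₁ y∈)) (λ { refl → x∉ y∈ }))
  where
  to : (p ∪ ⁅ x ⁆) - x ⊆ p
  to y∈ with x∈p∪q⁻ p ⁅ x ⁆ (p─q⊆p (p ∪ ⁅ x ⁆) ⁅ x ⁆ y∈)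
  ... | inj₁ y∈p = y∈p
  ... | inj₂ y∈x = ⊥-elim (x∈p─q⇒x∉q (p ∪ ⁅ x ⁆) ⁅ x ⁆ y∈ y∈x)

module Switching (n : ℕ) (1024≤n : 1024 ≤ n) {t : ℕ} (t+2≤n : t + 2 ≤ n) where
  abstract
    2≤n : 2 ≤ n
    2≤n = ≤-trans (m≤m+n 2 1022) 1024≤n

    14≤n : 14 ≤ n
    14≤n = ≤-trans (m≤m+n 14 1010) 1024≤n

  open Trees n
  open TreeBounds n 2≤n
  open Size t+2≤n

  -- Cutting e leaves two classes of sizes a + b = n, joined by a b ≥ n - 1 pairs.
  reconnect : ∀ {T e D} → Tree T → e ∈ˢ T → e ∈ˢ D → ∣ D ∣ + 2 ≤ n →
    ∃ λ f → f ∉ˢ D × f ∉ˢ T - e × Tree ((T - e) ∪ ⁅ f ⁆)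
  reconnect {T} {e} {D} tree e∈T e∈D small with tree-subset-forest tree (p─q⊆p T ⁅ e ⁆)
  ... | ℓ , fo , _ = choose (∑-witness E (λ f → 𝟙 (f ∈? D)) (λ f → 𝟙 (separates? ℓ f)) D<separating)
    where
    open ≤-Reasoning
    E = allFin (n * n)
    F = T - e
    u = src e
    v = tgt e
    e∉F : e ∉ˢ F
    e∉F e∈F = x∈p─q⇒x∉q T ⁅ e ⁆ e∈F (x∈⁅x⁆ e)
    neq : ℓ u ≢ ℓ v
    neq = tree-edge-separated tree fo (p─q⊆p T ⁅ e ⁆) e∈T e∉F
    two : classes ℓ ≡ 2
    two = +-cancelˡ-≡ ∣ F ∣ _ _ (begin-equality
      ∣ F ∣ + classes ℓ  ≡⟨ forest-classes fo ⟩
      n  ≡⟨ sym (m∸n+n≡m {n} {1} (≤-trans (n≤1+n 1) 2≤n)) ⟩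
      n ∸ 1 + 1  ≡⟨ cong (_+ 1) (sym (proj₁ (proj₂ tree))) ⟩
      ∣ T ∣ + 1  ≡⟨ cong (_+ 1) (∣p∣≡1+∣p-x∣ e∈T) ⟩
      suc ∣ F ∣ + 1  ≡⟨ sym (+-suc ∣ F ∣ 1) ⟩
      ∣ F ∣ + 2  ∎)
    one : ∀ {x y} → ℓ x ≢ ℓ y → classes (merge ℓ x y) ≡ 1
    one {x} {y} x≢y = suc-injective (trans (sym (classes-merge ℓ x y x≢y)) two)
    const : ∀ {x y} → ℓ x ≢ ℓ y → ∀ a b → merge ℓ x y a ≡ merge ℓ x y b
    const {x} {y} x≢y = classes≡1⇒const (merge ℓ x y) (one x≢y)
    separating : ∑ E (λ f → 𝟙 (separates? ℓ f)) ≡ weight ℓ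
    separating = *-cancelʳ-≡ _ _ n (begin-equality
      ∑ E (λ f → 𝟙 (separates? ℓ f)) * n  ≡⟨ sym (∑-*ʳ E n _) ⟩
      ∑ E (λ f → 𝟙 (separates? ℓ f) * n)  ≡⟨ ∑-cong E (λ f → 𝟙*-cong (separates? ℓ f)
          (λ (_ , f≢) → sym (weight-connected (merge ℓ (src f) (tgt f)) u (const f≢)))) ⟩
      ∑ E (λ f → 𝟙 (separates? ℓ f) * weight (merge ℓ (src f) (tgt f)))  ≡⟨ ∑-separating ℓ two ⟩
      n * (1 * weight ℓ)  ≡⟨ alg n (weight ℓ) ⟩
      weight ℓ * n  ∎)
      where
      alg : ∀ n w → n * (1 * w) ≡ w * n
      alg = solve-∀
    a = fibre ℓ (ℓ u)
    b = fibre ℓ (ℓ v)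
    m-u : merge ℓ u v u ≡ ℓ u
    m-u with ℓ u ≟ᶠ ℓ v
    ... | yes eq = ⊥-elim (neq eq)
    ... | no _ = refl
    a+b≡n : a + b ≡ n
    a+b≡n = begin-equality
      a + b  ≡⟨ sym (fibre-merge-joined ℓ u v neq) ⟩
      ∑ (allFin n) (λ w → 𝟙 (merge ℓ u v w ≟ᶠ ℓ u))  ≡⟨ ∑-cong (allFin n)
          (λ w → 𝟙-yes (merge ℓ u v w ≟ᶠ ℓ u) (trans (const neq w u) m-u)) ⟩
      ∑ (allFin n) (λ _ → 1)  ≡⟨ ∑-1 (allFin n) ⟩
      length (allFin n)  ≡⟨ List.length-tabulate {n = n} id ⟩
      n  ∎
    weight≡ab : weight ℓ ≡ a * b
    weight≡ab = *-cancelʳ-≡ _ _ n (begin-equality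
      weight ℓ * n  ≡⟨ cong (weight ℓ *_) (sym a+b≡n) ⟩
      weight ℓ * (a + b)  ≡⟨ sym (weight-merge ℓ u v neq) ⟩
      weight (merge ℓ u v) * (a * b)  ≡⟨ cong (_* (a * b)) (weight-connected (merge ℓ u v) u (const neq)) ⟩
      n * (a * b)  ≡⟨ *-comm n _ ⟩
      a * b * n  ∎)
    a+b≤ : ∀ {a b} → 0 < a → 0 < b → a + b ≤ a * b + 1
    a+b≤ {suc a} {suc b} _ _ = ≤-trans (m≤m+n _ (a * b)) (≤-reflexive (alg a b))
      where
      alg : ∀ a b → suc a + suc b + a * b ≡ suc a * suc b + 1
      alg = solve-∀
    D<separating : ∑ E (λ f → 𝟙 (f ∈? D)) < ∑ E (λ f → 𝟙 (separates? ℓ f))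
    D<separating = begin-strict
      ∑ E (λ f → 𝟙 (f ∈? D))  ≡⟨ sym (∣p∣≡∑ D) ⟩
      ∣ D ∣  <⟨ +-cancelʳ-≤ 1 _ _ (begin
          suc ∣ D ∣ + 1  ≡⟨ sym (+-suc ∣ D ∣ 1) ⟩
          ∣ D ∣ + 2  ≤⟨ small ⟩
          n  ≡⟨ sym a+b≡n ⟩
          a + b  ≤⟨ a+b≤ (fibre>0 ℓ u) (fibre>0 ℓ v) ⟩
          a * b + 1  ∎) ⟩
      a * b  ≡⟨ trans (sym weight≡ab) (sym separating) ⟩
      ∑ E (λ f → 𝟙 (separates? ℓ f))  ∎
    choose : (∃ λ f → f ∈ E × 𝟙 (f ∈? D) < 𝟙 (separates? ℓ f)) → ∃ λ f → f ∉ˢ D × f ∉ˢ T - e × Tree ((T - e) ∪ ⁅ f ⁆)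
    choose (f , _ , lt) = f , f∉D , separated⇒∉ fo f-neq , connected-forest (add fo f< f-neq) (one f-neq)
      where
      f-sep = 𝟙>0⇒ (separates? ℓ f) (≤-<-trans z≤n lt)
      f< = proj₁ f-sep
      f-neq = proj₂ f-sep
      f∉D : f ∉ˢ D
      f∉D f∈ = <⇒≱ lt (≤-trans (𝟙≤1 (separates? ℓ f)) (≤-reflexive (sym (𝟙-yes (f ∈? D) f∈))))

  module _ {B D : Subset (n * n)} (∣B∣≡t : ∣ B ∣ ≡ t) (τB≡M : τ B ≡ M) (disjoint : ∀ {x} → x ∈ˢ B → x ∉ˢ D)
      (D-small : ∣ D ∣ + 2 ≤ n) where

    Hits : ℕ → Subset (n * n) → Set
    Hits h T = B ⊆ T × ∣ T ∩ D ∣ ≡ h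

    hits? : ∀ h T → Dec (Hits h T)
    hits? h T = (B ⊆? T) ×-dec (∣ T ∩ D ∣ ≟ h)

    level : ℕ → ℕ
    level h = ∑ trees (λ T → 𝟙 (hits? h T))

    Swap : Subset (n * n) → Subset (n * n) → Set
    Swap T′ T = ∃ λ f → ∃ λ e → (T′ - f) ∪ ⁅ e ⁆ ≡ T

    swap? : ∀ T′ T → Dec (Swap T′ T)
    swap? T′ T = anyᶠ? (λ f → anyᶠ? (λ e → ((T′ - f) ∪ ⁅ e ⁆) ≟ˢ T))

    ─-∩-swap : ∀ {T e f} → f ∉ˢ D → (T ∩ D) - e ≡ ((T - e) ∪ ⁅ f ⁆) ∩ D
    ─-∩-swap {T} {e} {f} f∉D = ⊆-antisym to from
      where
      to : (T ∩ D) - e ⊆ ((T - e) ∪ ⁅ f ⁆) ∩ D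
      to x∈ = let x∈T , x∈D = x∈p∩q⁻ T D (p─q⊆p (T ∩ D) ⁅ e ⁆ x∈) in
        x∈p∩q⁺ (x∈p∪q⁺ (inj₁ (x∈p∧x∉q⇒x∈p─q x∈T (x∈p─q⇒x∉q (T ∩ D) ⁅ e ⁆ x∈))) , x∈D)
      from : ((T - e) ∪ ⁅ f ⁆) ∩ D ⊆ (T ∩ D) - e
      from x∈ = let x∈T′ , x∈D = x∈p∩q⁻ ((T - e) ∪ ⁅ f ⁆) D x∈ in
        [ (λ x∈F → x∈p∧x∉q⇒x∈p─q (x∈p∩q⁺ (p─q⊆p T ⁅ e ⁆ x∈F , x∈D)) (x∈p─q⇒x∉q T ⁅ e ⁆ x∈F)) ,
          (λ x∈f → ⊥-elim (f∉D (subst (_∈ˢ D) (x∈⁅y⁆⇒x≡y f x∈f) x∈D))) ]′ (x∈p∪q⁻ (T - e) ⁅ f ⁆ x∈T′)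

    -- An edge of T in D is exchanged for one outside D. B survives because it is disjoint from D.
    switch : ∀ {h T} → Tree T → Hits (suc h) T → ∃ λ T′ → Tree T′ × Hits h T′ × Swap T′ T
    switch {h} {T} tree (B⊆T , hits) =
      let e , e∈ , _ = ∣p∣<∣q∣⇒q─p {p = ⊥} {T ∩ D} (subst₂ _<_ (sym (∣⊥∣≡0 (n * n))) (sym hits) (s≤s z≤n))
          e∈T , e∈D = x∈p∩q⁻ T D e∈
      in conclude e∈ e∈T e∈D (reconnect tree e∈T e∈D D-small)
      where
      conclude : ∀ {e} → e ∈ˢ T ∩ D → e ∈ˢ T → e ∈ˢ D → (∃ λ f → f ∉ˢ D × f ∉ˢ T - e × Tree ((T - e) ∪ ⁅ f ⁆)) →
        ∃ λ T′ → Tree T′ × Hits h T′ × Swap T′ T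
      conclude {e} e∈ e∈T e∈D (f , f∉D , f∉F , tree′) = (T - e) ∪ ⁅ f ⁆ , tree′ ,
        ((λ x∈ → x∈p∪q⁺ (inj₁ (x∈p∧x≢y⇒x∈p-y (B⊆T x∈) (λ x≡e → disjoint x∈ (subst (_∈ˢ D) (sym x≡e) e∈D))))) ,
         suc-injective (trans (sym (trans (∣p∣≡1+∣p-x∣ e∈) (cong (suc ∘ ∣_∣) (─-∩-swap {T} {e} {f} f∉D)))) hits)) ,
        f , e , trans (cong (_∪ ⁅ e ⁆) (p∪⁅x⁆-x≡p f∉F)) (p-x∪⁅x⁆≡p e∈T)

    -- T is determined by `T′` and the two exchanged edges, each with n² possible indices.
    swaps-bound : ∀ T′ → ∑ trees (λ T → 𝟙 (swap? T′ T)) ≤ n ^ 4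
    swaps-bound T′ = begin
      ∑ trees (λ T → 𝟙 (swap? T′ T))
        ≤⟨ ∑-mono trees (λ T → 𝟙≤ (swap? T′ T) (one T)) ⟩
      ∑ trees (λ T → ∑ E (λ f → ∑ E (λ e → 𝟙 (((T′ - f) ∪ ⁅ e ⁆) ≟ˢ T))))  ≡⟨ ∑-swap trees E
          (λ T f → ∑ E (λ e → 𝟙 (((T′ - f) ∪ ⁅ e ⁆) ≟ˢ T))) ⟩
      ∑ E (λ f → ∑ trees (λ T → ∑ E (λ e → 𝟙 (((T′ - f) ∪ ⁅ e ⁆) ≟ˢ T))))  ≡⟨ ∑-cong E
          (λ f → ∑-swap trees E (λ T e → 𝟙 (((T′ - f) ∪ ⁅ e ⁆) ≟ˢ T))) ⟩
      ∑ E (λ f → ∑ E (λ e → ∑ trees (λ T → 𝟙 (((T′ - f) ∪ ⁅ e ⁆) ≟ˢ T))))  ≤⟨ ∑-mono E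
          (λ f → ∑-mono E (λ e → ∑-unique≤1 _≟ˢ_ trees-unique _)) ⟩
      ∑ E (λ f → ∑ E (λ e → 1))  ≡⟨ trans (∑-const E _) (cong (length E *_) (∑-1 E)) ⟩
      length E * length E  ≡⟨ cong₂ _*_ (List.length-tabulate {n = n * n} id) (List.length-tabulate {n = n * n} id) ⟩
      n * n * (n * n)  ≡⟨ alg n ⟩
      n ^ 4  ∎
      where
      open ≤-Reasoning
      E = allFin (n * n)
      alg : ∀ n → n * n * (n * n) ≡ n * (n * (n * (n * 1)))
      alg = solve-∀
      one : ∀ T → Swap T′ T → 1 ≤ ∑ E (λ f → ∑ E (λ e → 𝟙 (((T′ - f) ∪ ⁅ e ⁆) ≟ˢ T)))
      one T (f , e , eq) = ≤-trans (≤-reflexive (sym (𝟙-yes (((T′ - f) ∪ ⁅ e ⁆) ≟ˢ T) eq)))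
        (≤-trans (∑-∈ (λ e → 𝟙 (((T′ - f) ∪ ⁅ e ⁆) ≟ˢ T)) (∈-allFin e)) (∑-∈ (λ f → ∑ E (λ e → 𝟙 (((T′ - f) ∪ ⁅ e ⁆) ≟ˢ T)))
            (∈-allFin f)))

    level-step : ∀ h → level (suc h) ≤ n ^ 4 * level h
    level-step h = begin
      level (suc h)
        ≤⟨ ∑-swap-bound (hits? (suc h)) (hits? h) swap? trees trees (λ T∈ hit → let T′ , tree′ , hit′ , sw = switch (∈-trees⁻ T∈) hit in T′ , ∈-trees⁺ tree′ , hit′ , sw) ⟩
      ∑ trees (λ T′ → 𝟙 (hits? h T′) * ∑ trees (λ T → 𝟙 (swap? T′ T)))  ≤⟨ ∑-mono trees
          (λ T′ → *-monoʳ-≤ (𝟙 (hits? h T′)) (swaps-bound T′)) ⟩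
      ∑ trees (λ T′ → 𝟙 (hits? h T′) * n ^ 4)  ≡⟨ ∑-*ʳ trees (n ^ 4) _ ⟩
      level h * n ^ 4  ≡⟨ *-comm (level h) _ ⟩
      n ^ 4 * level h  ∎
      where open ≤-Reasoning

    level-bound : ∀ h → level h ≤ (n ^ 4) ^ h * level 0
    level-bound zero = ≤-reflexive (sym (*-identityˡ _))
    level-bound (suc h) = begin
      level (suc h)  ≤⟨ level-step h ⟩
      n ^ 4 * level h  ≤⟨ *-monoʳ-≤ (n ^ 4) (level-bound h) ⟩
      n ^ 4 * ((n ^ 4) ^ h * level 0)  ≡⟨ sym (*-assoc (n ^ 4) _ _) ⟩
      (n ^ 4) ^ suc h * level 0  ∎
      where open ≤-Reasoning

    many? : ∀ T → Dec (B ⊆ T × 10 ≤ ∣ T ∩ D ∣)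
    many? T = (B ⊆? T) ×-dec (10 ≤? ∣ T ∩ D ∣)

    many : ℕ
    many = ∑ trees (λ T → 𝟙 (many? T))

    -- Taking X = T ∩ D, the count is at most the sum of (2/n)^|X| M over X ⊆ D with |X| ≥ 10. This
    -- is at most 2^-10 (1 + 4/n)^n M ≤ 2^-10 · 4^4 M = M/4, since |D| ≤ n.
    many-bound : 4 * many ≤ M
    many-bound = *-cancelʳ-≤ _ _ (256 * n ^ n) {{m*n≢0 256 (n ^ n) {{_}} {{m^n≢0 n n}}}} (begin
      4 * many * (256 * n ^ n)  ≡⟨ alg many (n ^ n) ⟩
      many * (2 ^ 10 * n ^ n)  ≤⟨ *-monoˡ-≤ (2 ^ 10 * n ^ n) first ⟩
      ∑ Ss (λ X → 𝟙 (large? X) * τ (B ∪ X)) * (2 ^ 10 * n ^ n)  ≡⟨ sym (∑-*ʳ Ss _ _) ⟩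
      ∑ Ss (λ X → 𝟙 (large? X) * τ (B ∪ X) * (2 ^ 10 * n ^ n))  ≤⟨ ∑-mono Ss each ⟩
      ∑ Ss (λ X → 𝟙 (X ⊆? D) * (4 ^ ∣ X ∣ * n ^ (n ∸ ∣ X ∣)) * M)  ≡⟨ ∑-*ʳ Ss M _ ⟩
      ∑ Ss (λ X → 𝟙 (X ⊆? D) * (4 ^ ∣ X ∣ * n ^ (n ∸ ∣ X ∣))) * M  ≤⟨ *-monoˡ-≤ M (∑-⊆-binomial 4 n n D ∣D∣≤n) ⟩
      (n + 4) ^ n * M  ≤⟨ *-monoˡ-≤ M ([s+j]^s≤4^j*s^s n 4 (≤-trans (n≤1+n 1) 2≤n)) ⟩
      256 * n ^ n * M  ≡⟨ *-comm (256 * n ^ n) M ⟩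
      M * (256 * n ^ n)  ∎)
      where
      open ≤-Reasoning
      Ss = subsets (n * n)
      large? : ∀ X → Dec (X ⊆ D × 10 ≤ ∣ X ∣)
      large? X = (X ⊆? D) ×-dec (10 ≤? ∣ X ∣)
      ∣D∣≤n : ∣ D ∣ ≤ n
      ∣D∣≤n = ≤-trans (m≤m+n ∣ D ∣ 2) D-small
      alg : ∀ m x → 4 * m * (256 * x) ≡ m * (1024 * x)
      alg = solve-∀
      first : many ≤ ∑ Ss (λ X → 𝟙 (large? X) * τ (B ∪ X))
      first = ∑-swap-bound many? large? (λ X T → (B ∪ X) ⊆? T) trees Ss
        (λ {T} _ (B⊆T , ten) → T ∩ D , ∈-subsets (T ∩ D) , (p∩q⊆q T D , ten) , ∪-lub B⊆T (p∩q⊆p T D))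
      each : ∀ X → 𝟙 (large? X) * τ (B ∪ X) * (2 ^ 10 * n ^ n) ≤ 𝟙 (X ⊆? D) * (4 ^ ∣ X ∣ * n ^ (n ∸ ∣ X ∣)) * M
      each X = begin
        𝟙 (large? X) * τ (B ∪ X) * (2 ^ 10 * n ^ n)  ≡⟨ *-assoc (𝟙 (large? X)) _ _ ⟩
        𝟙 (large? X) * (τ (B ∪ X) * (2 ^ 10 * n ^ n))  ≤⟨ 𝟙*-mono (large? X) main ⟩
        𝟙 (large? X) * (4 ^ ∣ X ∣ * n ^ (n ∸ ∣ X ∣) * M)  ≤⟨ *-monoˡ-≤ _ (𝟙-mono (large? X) (X ⊆? D) proj₁) ⟩
        𝟙 (X ⊆? D) * (4 ^ ∣ X ∣ * n ^ (n ∸ ∣ X ∣) * M)  ≡⟨ sym (*-assoc (𝟙 (X ⊆? D)) _ M) ⟩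
        𝟙 (X ⊆? D) * (4 ^ ∣ X ∣ * n ^ (n ∸ ∣ X ∣)) * M  ∎
        where
        alg₂ : ∀ τ p r s → τ * (p * (r * s)) ≡ τ * r * (p * s)
        alg₂ = solve-∀
        alg₃ : ∀ a M p s → a * M * (p * s) ≡ a * p * s * M
        alg₃ = solve-∀
        main : X ⊆ D × 10 ≤ ∣ X ∣ → τ (B ∪ X) * (2 ^ 10 * n ^ n) ≤ 4 ^ ∣ X ∣ * n ^ (n ∸ ∣ X ∣) * M
        main (X⊆D , ten) = begin
          τ (B ∪ X) * (2 ^ 10 * n ^ n)  ≡⟨ cong (λ z → τ (B ∪ X) * (2 ^ 10 * z))
              (trans (cong (n ^_) (sym (m+[n∸m]≡n (≤-trans (p⊆q⇒∣p∣≤∣q∣ X⊆D) ∣D∣≤n)))) (^-distribˡ-+-* n ∣ X ∣ _)) ⟩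
          τ (B ∪ X) * (2 ^ 10 * (n ^ ∣ X ∣ * n ^ (n ∸ ∣ X ∣)))  ≡⟨ alg₂ (τ (B ∪ X)) (2 ^ 10) (n ^ ∣ X ∣) _ ⟩
          τ (B ∪ X) * n ^ ∣ X ∣ * (2 ^ 10 * n ^ (n ∸ ∣ X ∣))  ≤⟨ *-mono-≤ (density (B ∪ X) ∣ X ∣ size)
              (*-monoˡ-≤ _ (^-monoʳ-≤ 2 ten)) ⟩
          2 ^ ∣ X ∣ * M * (2 ^ ∣ X ∣ * n ^ (n ∸ ∣ X ∣))  ≡⟨ alg₃ (2 ^ ∣ X ∣) M (2 ^ ∣ X ∣) _ ⟩
          2 ^ ∣ X ∣ * 2 ^ ∣ X ∣ * n ^ (n ∸ ∣ X ∣) * M  ≡⟨ cong (λ z → z * n ^ (n ∸ ∣ X ∣) * M)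
              (sym (^-distribʳ-* ∣ X ∣ 2 2)) ⟩
          4 ^ ∣ X ∣ * n ^ (n ∸ ∣ X ∣) * M  ∎
          where
          size : ∣ B ∪ X ∣ ≡ t + ∣ X ∣
          size = trans (∣p∪q∣≡∣p∣+∣q─p∣ B X) (cong₂ _+_ ∣B∣≡t (cong ∣_∣ (disjoint-─ (λ x∈X x∈B → disjoint x∈B (X⊆D x∈X)))))

    few : ℕ
    few = ∑ (upTo 10) level

    split : M ≤ many + few
    split = begin
      M  ≡⟨ sym τB≡M ⟩
      τ B  ≤⟨ ∑-mono trees each ⟩
      ∑ trees (λ T → 𝟙 (many? T) + ∑ (upTo 10) (λ h → 𝟙 (hits? h T)))  ≡⟨ ∑-+ trees (λ T → 𝟙 (many? T))
          (λ T → ∑ (upTo 10) (λ h → 𝟙 (hits? h T))) ⟩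
      many + ∑ trees (λ T → ∑ (upTo 10) (λ h → 𝟙 (hits? h T)))  ≡⟨ cong (many +_)
          (∑-swap trees (upTo 10) (λ T h → 𝟙 (hits? h T))) ⟩
      many + few  ∎
      where
      open ≤-Reasoning
      each : ∀ T → 𝟙 (B ⊆? T) ≤ 𝟙 (many? T) + ∑ (upTo 10) (λ h → 𝟙 (hits? h T))
      each T = 𝟙≤ (B ⊆? T) λ B⊆T → cases B⊆T (10 ≤? ∣ T ∩ D ∣)
        where
        cases : B ⊆ T → Dec (10 ≤ ∣ T ∩ D ∣) → 1 ≤ 𝟙 (many? T) + ∑ (upTo 10) (λ h → 𝟙 (hits? h T))
        cases B⊆T (yes ten) = ≤-trans (≤-reflexive (sym (𝟙-yes (many? T) (B⊆T , ten)))) (m≤m+n _ _)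
        cases B⊆T (no ¬ten) = ≤-trans (≤-reflexive (sym (𝟙-yes (hits? ∣ T ∩ D ∣ T) (B⊆T , refl))))
          (≤-trans (∑-∈ (λ h → 𝟙 (hits? h T)) (∈-upTo⁺ (≰⇒> ¬ten))) (m≤n+m _ (𝟙 (many? T))))

    few-bound : few ≤ 10 * (n ^ 36 * level 0)
    few-bound = begin
      few  ≤⟨ ∑-mono-∈ (upTo 10) (λ {h} h∈ → ≤-trans (level-bound h) (*-monoˡ-≤ (level 0) (≤-trans (^-monoʳ-≤ (n ^ 4) {{m^n≢0 n 4}} (s≤s⁻¹ (∈-upTo⁻ h∈))) (≤-reflexive (^-*-assoc n 4 9))))) ⟩
      ∑ (upTo 10) (λ _ → n ^ 36 * level 0)  ≡⟨ ∑-const (upTo 10) (n ^ 36 * level 0) ⟩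
      10 * (n ^ 36 * level 0)  ∎
      where
      open ≤-Reasoning
      open import Data.List.Membership.Propositional.Properties using (∈-upTo⁻)

    -- At least 3M/4 trees above B have at most nine edges in D, and each of these ten levels is at
    -- most (n^4)^9 times level 0. One further factor n absorbs the constant, as 40 ≤ 3n.
    avoiding-bound : M ≤ n ^ 37 * level 0
    avoiding-bound = *-cancelˡ-≤ 3 (+-cancelˡ-≤ M _ _ (begin
      M + 3 * M  ≡⟨ alg M ⟩
      4 * M  ≤⟨ *-monoʳ-≤ 4 split ⟩
      4 * (many + few)  ≡⟨ *-distribˡ-+ 4 many few ⟩
      4 * many + 4 * few  ≤⟨ +-mono-≤ many-bound (*-monoʳ-≤ 4 few-bound) ⟩
      M + 4 * (10 * (n ^ 36 * level 0))  ≡⟨ cong (M +_) (alg₂ (n ^ 36 * level 0)) ⟩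
      M + 40 * (n ^ 36 * level 0)  ≤⟨ +-monoʳ-≤ M (*-monoˡ-≤ (n ^ 36 * level 0) (≤-trans (m≤m+n 40 2) (*-monoʳ-≤ 3 14≤n))) ⟩
      M + 3 * n * (n ^ 36 * level 0)  ≡⟨ cong (M +_) (alg₃ n (n ^ 36) (level 0)) ⟩
      M + 3 * (n ^ 37 * level 0)  ∎))
      where
      open ≤-Reasoning
      alg : ∀ M → M + 3 * M ≡ 4 * M
      alg = solve-∀
      alg₂ : ∀ x → 4 * (10 * x) ≡ 40 * x
      alg₂ = solve-∀
      alg₃ : ∀ n p l → 3 * n * (p * l) ≡ 3 * (n * p * l)
      alg₃ = solve-∀

-- The extremal problem

module Main (n t : ℕ) (2¹⁹≤n : 2 ^ 19 ≤ n) (1<t : 1 < t) (small-t : n ^ (4032 * t) ≤ 2 ^ n) where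

  q : ℕ
  q = n / 128

  abstract
    0<n : 0 < n
    0<n = ≤-trans (^-monoʳ-≤ 2 {0} {19} z≤n) 2¹⁹≤n

  instance
    n-nonZero : NonZero n
    n-nonZero = >-nonZero 0<n

  abstract
    128q≤n : 128 * q ≤ n
    128q≤n = ≤-trans (≤-reflexive (*-comm 128 q)) (m/n*n≤m n 128)

    4096≤q : 4096 ≤ q
    4096≤q = /-monoˡ-≤ 128 2¹⁹≤n

    n≤129q : n ≤ 129 * q
    n≤129q = begin
      n  ≡⟨ m≡m%n+[m/n]*n n 128 ⟩
      -- The remainder is below 128, hence below q; this turns the bound on 2^n into one on 2^q at
      -- the cost of 129 in place of 128.
      n % 128 + q * 128  ≤⟨ +-monoˡ-≤ (q * 128) (≤-trans (<⇒≤ (m%n<n n 128)) (≤-trans (m≤m+n 128 3968) 4096≤q)) ⟩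
      q + q * 128  ≡⟨ alg q ⟩
      129 * q  ∎
      where
      open ≤-Reasoning
      alg : ∀ q → q + q * 128 ≡ 129 * q
      alg = solve-∀

    -- The hypothesis `small-t` is 4032 t log n ≤ n, with the logarithm to base 2. As n ≤ 129 q and
    -- 31 · 129 = 3999, it yields 31 t log n ≤ q.
    n^31t≤2^q : n ^ (31 * t) ≤ 2 ^ q
    n^31t≤2^q = ^-cancelˡ-≤ _ _ 129 (s≤s z≤n) (begin
      (n ^ (31 * t)) ^ 129  ≡⟨ ^-*-assoc n (31 * t) 129 ⟩
      n ^ (31 * t * 129)  ≤⟨ ^-monoʳ-≤ n (≤-trans (m≤m+n (31 * t * 129) (33 * t)) (≤-reflexive (alg t))) ⟩
      n ^ (4032 * t)  ≤⟨ small-t ⟩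
      2 ^ n  ≤⟨ ^-monoʳ-≤ 2 n≤129q ⟩
      2 ^ (129 * q)  ≡⟨ cong (2 ^_) (*-comm 129 q) ⟩
      2 ^ (q * 129)  ≡⟨ sym (^-*-assoc 2 q 129) ⟩
      (2 ^ q) ^ 129  ∎)
      where
      open ≤-Reasoning
      alg : ∀ t → 31 * t * 129 + 33 * t ≡ 4032 * t
      alg = solve-∀

    n^[37+t]≤2^q : n ^ (37 + t) ≤ 2 ^ q
    n^[37+t]≤2^q = ≤-trans (^-monoʳ-≤ n (begin
      -- Here t ≥ 2 gives 37 ≤ 60 ≤ 30 t.
      37 + t  ≤⟨ +-monoˡ-≤ t (≤-trans (m≤m+n 37 23) (*-monoʳ-≤ 30 1<t)) ⟩
      30 * t + t  ≡⟨ +-comm (30 * t) t ⟩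
      31 * t  ∎)) n^31t≤2^q
      where open ≤-Reasoning

    n^t≤2^q : n ^ t ≤ 2 ^ q
    n^t≤2^q = ≤-trans (^-monoʳ-≤ n (m≤n+m t 37)) n^[37+t]≤2^q

    t≤q : t ≤ q
    t≤q = ≮⇒≥ λ q<t → <⇒≱ (^-monoʳ-< 2 (s≤s (s≤s z≤n)) q<t) (≤-trans
        (^-monoˡ-≤ t (≤-trans (^-monoʳ-≤ 2 {1} {19} (s≤s z≤n)) 2¹⁹≤n)) n^t≤2^q)

    t+2≤n : t + 2 ≤ n
    t+2≤n = begin
      t + 2  ≤⟨ +-mono-≤ t≤q (≤-trans (m≤m+n 2 4094) 4096≤q) ⟩
      q + q  ≤⟨ m≤m+n (q + q) (126 * q) ⟩
      q + q + 126 * q  ≡⟨ alg q ⟩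
      128 * q  ≤⟨ 128q≤n ⟩
      n  ∎
      where
      open ≤-Reasoning
      alg : ∀ q → q + q + 126 * q ≡ 128 * q
      alg = solve-∀

    1024≤n : 1024 ≤ n
    1024≤n = ≤-trans (^-monoʳ-≤ 2 {10} {19} (m≤m+n 10 9)) 2¹⁹≤n

    43008≤n : 43008 ≤ n
    43008≤n = ≤-trans (≤-trans (m≤m+n 43008 22528) (^-monoʳ-≤ 2 {16} {19} (m≤m+n 16 3))) 2¹⁹≤n

    0<q : 0 < q
    0<q = ≤-trans (m≤m+n 1 4095) 4096≤q

  open Trees n
  module Sw = Switching n 1024≤n {t} t+2≤n
  open TreeBounds n Sw.2≤n hiding (n≢0)
  open Size {t} t+2≤n

  K : ℕ
  K = n ^ (n ∸ t ∸ 2)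

  K>0 : 0 < K
  K>0 = m^n>0 n (n ∸ t ∸ 2)

  Q≡ : n ^ (n ∸ 2) ≡ n ^ t * K
  Q≡ = trans (cong (n ^_) (trans (cong (_∸ 2) (trans exponent (alg t _))) refl)) (^-distribˡ-+-* n t _)
    where
    alg : ∀ t m → t + (2 + m) ≡ 2 + (t + m)
    alg = solve-∀

  4K≤M : 4 * K ≤ M
  4K≤M = *-monoˡ-≤ K (^-monoʳ-≤ 2 1<t)

  K<M : K < M
  K<M = <-≤-trans (m<m*n K 4 {{>-nonZero K>0}} (s≤s (s≤s z≤n))) (≤-trans (≤-reflexive (*-comm K 4)) 4K≤M)

  tree-size : ∀ {T} → Tree T → ∣ T ∣ + 1 ≡ n
  tree-size tree = trans (cong (_+ 1) (proj₁ (proj₂ tree))) (m∸n+n≡m {n} {1} 0<n)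

  -- A tree avoiding D cannot share a t-intersecting family with T₀. The size limit makes D smaller
  -- than any cut of K_n, so that switching out of D is always possible.
  Blocker : Subset (n * n) → Subset (n * n) → Subset (n * n) → Set
  Blocker B T₀ D = ∣ D ∣ + 2 ≤ n × (∀ {x} → x ∈ˢ B → x ∉ˢ D) × (∀ {T} → ∣ T ∩ D ∣ ≡ 0 → ∣ T ∩ T₀ ∣ < t)

  -- If T₀ meets B, then D = T₀ ─ B is small enough, and only the fewer than t edges of T₀ ∩ B can
  -- be shared.
  blocker : ∀ {B T₀} → ∣ B ∣ ≡ t → Tree T₀ → ¬ B ⊆ T₀ → ∃ (Blocker B T₀)
  blocker {B} {T₀} size tree B⊈T₀ with nonempty? (T₀ ∩ B)
  ... | yes (e , e∈) = T₀ ─ B , D-small , (λ x∈B x∈D → x∈p─q⇒x∉q T₀ B x∈D x∈B) , λ {T} no-hit → begin-strict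
      ∣ T ∩ T₀ ∣  ≤⟨ p⊆q⇒∣p∣≤∣q∣ (sub T) ⟩
      ∣ (T ∩ (T₀ ─ B)) ∪ (T₀ ∩ B) ∣  ≤⟨ ∣p∪q∣≤∣p∣+∣q∣ (T ∩ (T₀ ─ B)) (T₀ ∩ B) ⟩
      ∣ T ∩ (T₀ ─ B) ∣ + ∣ T₀ ∩ B ∣  ≡⟨ cong (_+ ∣ T₀ ∩ B ∣) no-hit ⟩
      ∣ T₀ ∩ B ∣  <⟨ ≰⇒> (λ t≤ → B⊈T₀ (subst (_⊆ T₀) (p⊆q∧∣q∣≤∣p∣⇒p≡q (p∩q⊆q T₀ B) (≤-trans (≤-reflexive size) t≤))
          (p∩q⊆p T₀ B))) ⟩
      t  ∎
    where
    open ≤-Reasoning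
    D-small : ∣ T₀ ─ B ∣ + 2 ≤ n
    D-small = begin
      ∣ T₀ ─ B ∣ + 2  ≡⟨ alg ∣ T₀ ─ B ∣ ⟩
      1 + ∣ T₀ ─ B ∣ + 1  ≤⟨ +-monoˡ-≤ 1 (+-monoˡ-≤ ∣ T₀ ─ B ∣ (≤-trans (s≤s z≤n) (≤-reflexive (sym (∣p∣≡1+∣p-x∣ e∈))))) ⟩
      ∣ T₀ ∩ B ∣ + ∣ T₀ ─ B ∣ + 1  ≡⟨ cong (_+ 1) (sym (∣p∣≡∣p∩q∣+∣p─q∣ T₀ B)) ⟩
      ∣ T₀ ∣ + 1  ≡⟨ tree-size tree ⟩
      n  ∎
      where
      alg : ∀ d → d + 2 ≡ 1 + d + 1
      alg = solve-∀
    sub : ∀ T → T ∩ T₀ ⊆ (T ∩ (T₀ ─ B)) ∪ (T₀ ∩ B)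
    sub T {x} x∈ with x∈p∩q⁻ T T₀ x∈ | x ∈? B
    ... | x∈T , x∈T₀ | yes x∈B = x∈p∪q⁺ (inj₂ (x∈p∩q⁺ (x∈T₀ , x∈B)))
    ... | x∈T , x∈T₀ | no x∉B = x∈p∪q⁺ (inj₁ (x∈p∩q⁺ (x∈T , x∈p∧x∉q⇒x∈p─q x∈T₀ x∉B)))
  -- Here T₀ itself has n - 1 edges, one more than the size limit allows. Leaving out one edge lets
  -- T share at most that edge, and 1 < t.
  ... | no none = remove (∣p∣<∣q∣⇒q─p {p = ⊥} {T₀} (subst (_< ∣ T₀ ∣) (sym (∣⊥∣≡0 (n * n)))
      (+-cancelʳ-< 1 0 ∣ T₀ ∣ (subst (1 <_) (sym (tree-size tree)) Sw.2≤n))))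
    where
    open ≤-Reasoning
    remove : (∃ λ e → e ∈ˢ T₀ × e ∉ˢ ⊥) → ∃ (Blocker B T₀)
    remove (e , e∈ , _) = T₀ - e , D-small , (λ x∈B x∈D → none (_ , x∈p∩q⁺ (p─q⊆p T₀ ⁅ e ⁆ x∈D , x∈B))) , λ {T} no-hit → begin-strict
      ∣ T ∩ T₀ ∣  ≤⟨ p⊆q⇒∣p∣≤∣q∣ (sub T) ⟩
      ∣ (T ∩ (T₀ - e)) ∪ ⁅ e ⁆ ∣  ≤⟨ ∣p∪q∣≤∣p∣+∣q∣ (T ∩ (T₀ - e)) ⁅ e ⁆ ⟩
      ∣ T ∩ (T₀ - e) ∣ + ∣ ⁅ e ⁆ ∣  ≡⟨ cong₂ _+_ no-hit (∣⁅x⁆∣≡1 e) ⟩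
      1  <⟨ 1<t ⟩
      t  ∎
      where
      D-small : ∣ T₀ - e ∣ + 2 ≤ n
      D-small = ≤-reflexive (trans (+-suc ∣ T₀ - e ∣ 1) (trans (cong (_+ 1) (sym (∣p∣≡1+∣p-x∣ e∈))) (tree-size tree)))
      sub : ∀ T → T ∩ T₀ ⊆ (T ∩ (T₀ - e)) ∪ ⁅ e ⁆
      sub T {x} x∈ with x∈p∩q⁻ T T₀ x∈ | x ≟ᶠ e
      ... | _ | yes refl = x∈p∪q⁺ (inj₂ (x∈⁅x⁆ e))
      ... | x∈T , x∈T₀ | no neq = x∈p∪q⁺ (inj₁ (x∈p∩q⁺ (x∈T , x∈p∧x≢y⇒x∈p-y x∈T₀ neq)))

  Star : List (Subset (n * n)) → Subset (n * n) → Set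
  Star F B = ∣ B ∣ ≡ t × Ordered B × ¬ (∃ λ e → ∃ λ f → Clash B e f) ×
    (∀ T → (T ∈ F → Tree T × B ⊆ T) × (Tree T × B ⊆ T → T ∈ F))

  star-size : ∀ {F B} → Unique F → Star F B → length F ≡ M
  star-size {F} {B} uniq (size , ord , no-clash , iff) = trans (≤-antisym upper lower) (matching-τ ord size no-clash)
    where
    open ≤-Reasoning
    upper : length F ≤ τ B
    upper = begin
      length F  ≡⟨ sym (∑-1 F) ⟩
      ∑ F (λ _ → 1) ≡⟨ ∑-cong-∈ F (λ {T} T∈ → sym (𝟙-yes (B ⊆? T) (proj₂ (proj₁ (iff T) T∈)))) ⟩
      cnt F B  ≤⟨ ∑-⊆ (λ T → 𝟙 (B ⊆? T)) uniq (λ {T} T∈ → ∈-trees⁺ (proj₁ (proj₁ (iff T) T∈))) ⟩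
      τ B  ∎
    lower : τ B ≤ length F
    lower = begin
      τ B  ≡⟨ sym (length-filter-∑ (B ⊆?_) trees) ⟩
      length (filter (B ⊆?_) trees)  ≡⟨ sym (∑-1 (filter (B ⊆?_) trees)) ⟩
      ∑ (filter (B ⊆?_) trees) (λ _ → 1)  ≤⟨ ∑-⊆ (λ _ → 1) (Unique.filter⁺ (B ⊆?_) trees-unique) (λ {T} T∈ → let T∈trees , B⊆T = ∈-filter⁻ (B ⊆?_) {xs = trees} T∈ in proj₂ (iff T) (∈-trees⁻ T∈trees , B⊆T)) ⟩
      ∑ F (λ _ → 1)  ≡⟨ ∑-1 F ⟩
      length F  ∎

  module _ (F : List (Subset (n * n))) (uniq : Unique F) (all-trees : ∀ {T} → T ∈ F → Tree T)
    (t-int : ∀ {T T′} → T ∈ F → T′ ∈ F → T ≢ T′ → t ≤ ∣ T ∩ T′ ∣) where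

    open ≤-Reasoning

    t-int′ : ∀ {T T′} → T ∈ F → T′ ∈ F → t ≤ ∣ T ∩ T′ ∣
    t-int′ {T} {T′} T∈ T′∈ with T ≟ˢ T′
    ... | no neq = t-int T∈ T′∈ neq
    ... | yes refl = begin
      t  ≤⟨ +-cancelʳ-≤ 1 _ _ (≤-trans (+-monoʳ-≤ t (n≤1+n 1))
          (≤-trans t+2≤n (≤-reflexive (sym (tree-size (all-trees T∈)))))) ⟩
      ∣ T ∣  ≡⟨ cong ∣_∣ (sym (∩-idem T)) ⟩
      ∣ T ∩ T ∣  ∎

    cnt≤τ : ∀ X → cnt F X ≤ τ X
    cnt≤τ X = ∑-⊆ (λ T → 𝟙 (X ⊆? T)) uniq (λ T∈ → ∈-trees⁺ (all-trees T∈))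

    j : ℕ
    j = q ∸ t

    t+j≡q : t + j ≡ q
    t+j≡q = m+[n∸m]≡n t≤q

    open Simplification n q t M 0<n 128q≤n 0<q F
      (λ X j eq → ≤-trans (*-monoˡ-≤ (n ^ j) (cnt≤τ X)) (density X j eq)) using (covered; Trivial; Small; simplify)

    Remainder : ℕ → Set
    Remainder R = R * 2 ^ suc q ≤ n ^ (n ∸ 2)

    2R≤K : ∀ R → Remainder R → 2 * R ≤ K
    2R≤K R rem = *-cancelʳ-≤ _ _ (2 ^ q) {{m^n≢0 2 q}} (begin
      2 * R * 2 ^ q  ≡⟨ alg R (2 ^ q) ⟩
      R * 2 ^ suc q  ≤⟨ rem ⟩
      n ^ (n ∸ 2)  ≡⟨ Q≡ ⟩
      n ^ t * K  ≤⟨ *-monoˡ-≤ K n^t≤2^q ⟩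
      2 ^ q * K  ≡⟨ *-comm (2 ^ q) K ⟩
      K * 2 ^ q  ∎)
      where
      alg : ∀ r p → 2 * r * p ≡ r * (2 * p)
      alg = solve-∀

    R<M : ∀ R → Remainder R → R < M
    R<M R rem = ≤-<-trans (≤-trans (m≤n*m R 2) (2R≤K R rem)) K<M

    -- The covered members number at most M/2 and the uncovered ones at most K/2, where K < M.
    small-case : ∀ 𝒮 → Remainder (uncoveredBy 𝒮 F) → Small j 𝒮 → length F < M
    small-case 𝒮 rem small = *-cancelˡ-< 2 _ _ (begin-strict
      2 * length F  ≡⟨ cong (2 *_) (sym (∑-𝟙-split (λ T → any? (_⊆? T) 𝒮) F)) ⟩
      2 * (covered 𝒮 + uncoveredBy 𝒮 F)  ≡⟨ *-distribˡ-+ 2 (covered 𝒮) _ ⟩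
      2 * covered 𝒮 + 2 * uncoveredBy 𝒮 F  ≤⟨ +-mono-≤ 2U≤M (2R≤K (uncoveredBy 𝒮 F) rem) ⟩
      M + K  <⟨ +-monoʳ-< M K<M ⟩
      M + M  ≡⟨ cong (M +_) (sym (+-identityʳ M)) ⟩
      2 * M  ∎)
      where
      alg : ∀ p u → p * (2 * u) ≡ p * 2 * u
      alg = solve-∀
      2U≤M : 2 * covered 𝒮 ≤ M
      2U≤M = *-cancelˡ-≤ (2 ^ (j + 1)) {{m^n≢0 2 (j + 1)}} (begin
        2 ^ (j + 1) * (2 * covered 𝒮)  ≡⟨ alg (2 ^ (j + 1)) (covered 𝒮) ⟩
        2 ^ (j + 1) * 2 ^ 1 * covered 𝒮  ≡⟨ cong (_* covered 𝒮) (sym (^-distribˡ-+-* 2 (j + 1) 1)) ⟩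
        2 ^ (j + 1 + 1) * covered 𝒮  ≡⟨ cong (λ z → 2 ^ z * covered 𝒮) (+-assoc j 1 1) ⟩
        2 ^ (j + 2) * covered 𝒮  ≤⟨ m≤m+n _ M ⟩
        2 ^ (j + 2) * covered 𝒮 + M  ≤⟨ small ⟩
        2 ^ (j + 1) * M  ∎)

    module Common (B : Subset (n * n)) (size : ∣ B ∣ ≡ t) (rem : Remainder (∑ F (λ T → 𝟙 (¬? (B ⊆? T))))) where

      R : ℕ
      R = ∑ F (λ T → 𝟙 (¬? (B ⊆? T)))

      count : cnt F B + R ≡ length F
      count = ∑-𝟙-split (B ⊆?_) F

      τB≤M : τ B ≤ M
      τB≤M = begin
        τ B  ≡⟨ sym (*-identityʳ _) ⟩
        τ B * n ^ 0  ≤⟨ density B 0 (trans size (sym (+-identityʳ t))) ⟩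
        1 * M  ≡⟨ *-identityˡ M ⟩
        M  ∎

      star-case : R ≡ 0 → length F ≤ M × (length F ≡ M → Star F B)
      star-case R≡0 = ≤-trans F≤τ τB≤M , λ F≡M → size , ord F≡M , no-clash F≡M , iff F≡M
        where
        F≡cnt : length F ≡ cnt F B
        F≡cnt = trans (sym count) (trans (cong (cnt F B +_) R≡0) (+-identityʳ _))
        F≤τ : length F ≤ τ B
        F≤τ = ≤-trans (≤-reflexive F≡cnt) (cnt≤τ B)
        contains : ∀ {T} → T ∈ F → B ⊆ T
        contains {T} T∈ = decidable-stable (B ⊆? T) (λ B⊈T → <⇒≱ (≤-trans (≤-reflexive (sym (𝟙-yes (¬? (B ⊆? T)) B⊈T)))
            (∑-∈ (λ T → 𝟙 (¬? (B ⊆? T))) T∈)) (≤-reflexive R≡0))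
        M≤τ : length F ≡ M → M ≤ τ B
        M≤τ F≡M = ≤-trans (≤-reflexive (sym F≡M)) F≤τ
        ord : length F ≡ M → Ordered B
        ord F≡M with empty-or-∈ F
        ... | inj₁ refl = ⊥-elim (<⇒≱ (≤-<-trans z≤n K<M) (≤-reflexive (sym F≡M)))
        ... | inj₂ (T , T∈) = λ e∈ → proj₁ (all-trees T∈) (contains T∈ e∈)
        no-clash : length F ≡ M → ¬ (∃ λ e → ∃ λ f → Clash B e f)
        no-clash F≡M clash = <⇒≱ (m<n+m (3 * M) (≤-<-trans z≤n K<M)) (≤-trans (*-monoʳ-≤ 4 (M≤τ F≡M)) (clash-τ size clash))
        iff : length F ≡ M → ∀ T → (T ∈ F → Tree T × B ⊆ T) × (Tree T × B ⊆ T → T ∈ F)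
        -- A tree above B missing from F could be added to F, giving more than M distinct trees
        -- above B.
        iff F≡M T = (λ T∈ → all-trees T∈ , contains T∈) , λ (tree , B⊆T) → decidable-stable (any? (T ≟ˢ_) F) λ T∉ → <⇒≱
          (begin-strict
            τ B  ≤⟨ τB≤M ⟩
            M  ≡⟨ trans (sym F≡M) F≡cnt ⟩
            cnt F B  <⟨ ≤-reflexive (cong (_+ cnt F B) (sym (𝟙-yes (B ⊆? T) B⊆T))) ⟩
            cnt (T ∷ F) B  ∎)
          (∑-⊆ (λ T → 𝟙 (B ⊆? T)) (All.tabulate (λ {T′} T′∈ T≡T′ → T∉ (lose T′∈ T≡T′)) ∷ uniq)
            (λ { (here refl) → ∈-trees⁺ tree ; (there T′∈) → ∈-trees⁺ (all-trees T′∈) }))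

      -- Touching edges reduce the trees above B to 3M/4, and the exceptional members add at most
      -- K/2 ≤ M/8.
      clash-case : (∃ λ e → ∃ λ f → Clash B e f) → length F < M
      clash-case clash = *-cancelˡ-< 4 _ _ (begin-strict
        4 * length F  ≡⟨ cong (4 *_) (sym count) ⟩
        4 * (cnt F B + R)  ≡⟨ alg (cnt F B) R ⟩
        4 * cnt F B + 2 * (2 * R)  ≤⟨ +-mono-≤ (≤-trans (*-monoʳ-≤ 4 (cnt≤τ B)) (clash-τ size clash))
            (*-monoʳ-≤ 2 (2R≤K R rem)) ⟩
        3 * M + 2 * K  <⟨ +-monoʳ-< (3 * M) (<-≤-trans (*-monoˡ-< K {{>-nonZero K>0}} {2} {4} (s≤s (s≤s (s≤s z≤n)))) 4K≤M) ⟩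
        3 * M + M  ≡⟨ alg₂ M ⟩
        4 * M  ∎)
        where
        alg : ∀ c r → 4 * (c + r) ≡ 4 * c + 2 * (2 * r)
        alg = solve-∀
        alg₂ : ∀ m → 3 * m + m ≡ 4 * m
        alg₂ = solve-∀

      exceptional-case : ∀ {T₀} → T₀ ∈ F → ¬ B ⊆ T₀ → ¬ (∃ λ e → ∃ λ f → Clash B e f) → length F < M
      exceptional-case {T₀} T₀∈ B⊈T₀ no-clash = [ not-extendable , (λ (_ , tree₁ , B⊆T₁) → extendable tree₁ B⊆T₁
          (blocker size (all-trees T₀∈) B⊈T₀)) ]′ (zero-or-tree B)
        where
        not-extendable : τ B ≡ 0 → length F < M
        not-extendable τ≡0 = begin-strict
          length F  ≡⟨ sym count ⟩
          cnt F B + R  ≤⟨ +-monoˡ-≤ R (≤-trans (cnt≤τ B) (≤-reflexive τ≡0)) ⟩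
          R  <⟨ R<M R rem ⟩
          M  ∎
        extendable : ∀ {T₁} → Tree T₁ → B ⊆ T₁ → ∃ (Blocker B T₀) → length F < M
        extendable tree₁ B⊆T₁ (D , D-small , disjoint , blocks) = begin-strict
          length F  ≡⟨ sym count ⟩
          cnt F B + R  <⟨ +-monoʳ-< (cnt F B) R<lost ⟩
          cnt F B + lost  ≤⟨ room ⟩
          τ B  ≡⟨ τB≡M ⟩
          M  ∎
          where
          τB≡M : τ B ≡ M
          τB≡M = matching-τ (λ e∈ → proj₁ tree₁ (B⊆T₁ e∈)) size no-clash
          lost? : ∀ T → Dec (B ⊆ T × ∣ T ∩ D ∣ ≡ 0)
          lost? = Sw.hits? size τB≡M disjoint D-small 0
          lost : ℕ
          lost = Sw.level size τB≡M disjoint D-small 0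
          excluded : ∀ {T} → T ∈ F → ¬ (B ⊆ T × ∣ T ∩ D ∣ ≡ 0)
          excluded {T} T∈ (_ , no-hit) = <⇒≱ (blocks {T} no-hit) (t-int′ T∈ T₀∈)
          room : cnt F B + lost ≤ τ B
          room = begin
            cnt F B + lost  ≡⟨ cong (_+ lost) (∑-cong-∈ F (λ {T} T∈ → trans (sym (*-identityʳ _)) (cong (𝟙 (B ⊆? T) *_) (sym (𝟙-yes (¬? (lost? T)) (excluded T∈)))))) ⟩
            ∑ F (λ T → 𝟙 (B ⊆? T) * 𝟙 (¬? (lost? T))) + lost  ≤⟨ +-monoˡ-≤ lost
                (∑-⊆ (λ T → 𝟙 (B ⊆? T) * 𝟙 (¬? (lost? T))) uniq (λ T∈ → ∈-trees⁺ (all-trees T∈))) ⟩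
            ∑ trees (λ T → 𝟙 (B ⊆? T) * 𝟙 (¬? (lost? T))) + lost  ≡⟨ sym (∑-+ trees (λ T → 𝟙 (B ⊆? T) * 𝟙 (¬? (lost? T)))
                (λ T → 𝟙 (lost? T))) ⟩
            ∑ trees (λ T → 𝟙 (B ⊆? T) * 𝟙 (¬? (lost? T)) + 𝟙 (lost? T))  ≤⟨ ∑-mono trees each ⟩
            τ B  ∎
            where
            each : ∀ T → 𝟙 (B ⊆? T) * 𝟙 (¬? (lost? T)) + 𝟙 (lost? T) ≤ 𝟙 (B ⊆? T)
            each T with lost? T
            ... | yes (B⊆T , _) = ≤-reflexive (trans (cong (_+ 1) (*-zeroʳ (𝟙 (B ⊆? T)))) (sym (𝟙-yes (B ⊆? T) B⊆T)))
            ... | no _ = ≤-reflexive (trans (+-identityʳ _) (*-identityʳ _))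
          R<lost : R < lost
          -- Were the lost trees at most R in number, then M ≤ n^37 R. The remainder bound gives R
          -- 2^(q+1) ≤ n^t K, so M 2^(q+1) ≤ n^(37+t) K ≤ 2^q K, contrary to K < M.
          R<lost = ≰⇒> λ lost≤R → <⇒≱ (m<m+n (2 ^ q * K) (*-mono-< {0} {2 ^ q} {0} {K} (m^n>0 2 q) K>0)) (begin
            2 ^ q * K + 2 ^ q * K  ≡⟨ alg (2 ^ q) K ⟩
            K * 2 ^ suc q  ≤⟨ *-monoˡ-≤ (2 ^ suc q) (<⇒≤ K<M) ⟩
            M * 2 ^ suc q  ≤⟨ *-monoˡ-≤ (2 ^ suc q) (Sw.avoiding-bound size τB≡M disjoint D-small) ⟩
            n ^ 37 * lost * 2 ^ suc q  ≤⟨ *-monoˡ-≤ (2 ^ suc q) (*-monoʳ-≤ (n ^ 37) lost≤R) ⟩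
            n ^ 37 * R * 2 ^ suc q  ≡⟨ *-assoc (n ^ 37) R _ ⟩
            n ^ 37 * (R * 2 ^ suc q)  ≤⟨ *-monoʳ-≤ (n ^ 37) rem ⟩
            n ^ 37 * n ^ (n ∸ 2)  ≡⟨ cong (n ^ 37 *_) Q≡ ⟩
            n ^ 37 * (n ^ t * K)  ≡⟨ sym (*-assoc (n ^ 37) (n ^ t) K) ⟩
            n ^ 37 * n ^ t * K  ≡⟨ cong (_* K) (sym (^-distribˡ-+-* n 37 t)) ⟩
            n ^ (37 + t) * K  ≤⟨ *-monoˡ-≤ K n^[37+t]≤2^q ⟩
            2 ^ q * K  ∎)
            where
            alg : ∀ p k → p * k + p * k ≡ k * (2 * p)
            alg = solve-∀

    strictly : length F < M → length F ≤ M × (length F ≡ M → ∃ (Star F))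
    strictly lt = <⇒≤ lt , λ eq → ⊥-elim (<-irrefl eq lt)

    common-case : ∀ B → ∣ B ∣ ≡ t → Remainder (∑ F (λ T → 𝟙 (¬? (B ⊆? T)))) → length F ≤ M × (length F ≡ M → ∃ (Star F))
    common-case B size rem = [ not-all-contain , all-contain ]′ (some-or-none (any? (λ T → ¬? (B ⊆? T)) F))
      where
      open Common B size rem
      some-or-none : ∀ {P : Set} → Dec P → P ⊎ ¬ P
      some-or-none (yes p) = inj₁ p
      some-or-none (no ¬p) = inj₂ ¬p
      all-contain : ¬ Any (λ T → ¬ B ⊆ T) F → length F ≤ M × (length F ≡ M → ∃ (Star F))
      all-contain none = let bound , star = star-case R≡0 in bound , λ eq → B , star eq
        where
        R≡0 : R ≡ 0
        R≡0 = trans (∑-cong-∈ F (λ {T} T∈ → 𝟙-no (¬? (B ⊆? T)) (λ B⊈T → none (lose T∈ B⊈T)))) (∑-0 F)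
      not-all-contain : Any (λ T → ¬ B ⊆ T) F → length F ≤ M × (length F ≡ M → ∃ (Star F))
      not-all-contain some = let T₀ , T₀∈ , B⊈T₀ = find some in
        strictly ([ clash-case , exceptional-case T₀∈ B⊈T₀ ]′ (some-or-none (clash? B)))

    extremal : length F ≤ M × (length F ≡ M → ∃ (Star F))
    extremal = conclude (peel {n = n} {q} {n ^ (n ∸ 2)} 0<n (length F) F ≤-refl
        (λ X → ≤-trans (*-monoˡ-≤ (n ^ ∣ X ∣) (cnt≤τ X)) (τ-spread X)))
      where
      trivial-case : ∀ 𝒮 → Remainder (uncoveredBy 𝒮 F) → Trivial 𝒮 → length F ≤ M × (length F ≡ M → ∃ (Star F))
      trivial-case 𝒮 rem (B , size , B⊆) = common-case B size (≤-trans (*-monoˡ-≤ (2 ^ suc q) fewer) rem)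
        where
        fewer : ∑ F (λ T → 𝟙 (¬? (B ⊆? T))) ≤ uncoveredBy 𝒮 F
        fewer = ∑-mono F (λ T → 𝟙-mono (¬? (B ⊆? T)) (¬? (any? (_⊆? T) 𝒮)) (λ B⊈T covered → let S , S∈ , S⊆T = find covered in B⊈T (⊆-trans (All.lookup B⊆ S∈) S⊆T)))
      conclude : (∃ λ 𝒮 → All (Core n q F) 𝒮 × Remainder (uncoveredBy 𝒮 F)) → length F ≤ M × (length F ≡ M → ∃ (Star F))
      conclude (𝒮 , cores , rem) = [ trivial-case 𝒮 rem , strictly ∘ small-case 𝒮 rem ]′ (simplify j (≤-reflexive t+j≡q) 𝒮
        (λ S∈ S′∈ → cores-intersect 43008≤n 128q≤n (λ T∈ → ≤-trans (m≤m+n _ 1)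
            (≤-reflexive (tree-size (all-trees T∈)))) t-int′ (All.lookup cores S∈) (All.lookup cores S′∈))
        (λ S∈ → ≤-trans (Core.small (All.lookup cores S∈)) (≤-reflexive (sym t+j≡q))))

-- Edge sets as subsets of Fin (n * n)

∣p++q∣ : ∀ {m n} (p : Subset m) (q : Subset n) → ∣ p Vec.++ q ∣ ≡ ∣ p ∣ + ∣ q ∣
∣p++q∣ [] q = refl
∣p++q∣ (true ∷ p) q = cong suc (∣p++q∣ p q)
∣p++q∣ (false ∷ p) q = ∣p++q∣ p q

∣concat∣ : ∀ {m k} (E : Vec (Subset m) k) → Vec.foldr (λ _ → ℕ) (λ s acc → ∣ s ∣ + acc) 0 E ≡ ∣ concat E ∣
∣concat∣ [] = refl
∣concat∣ (s ∷ E) = trans (cong (∣ s ∣ +_) (∣concat∣ E)) (sym (∣p++q∣ s (concat E)))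

concat-∩ : ∀ {m k} (E F : Vec (Subset m) k) → concat (zipWith _∩_ E F) ≡ concat E ∩ concat F
concat-∩ [] [] = refl
concat-∩ (s ∷ E) (t ∷ F) = trans (cong ((s ∩ t) Vec.++_) (concat-∩ E F)) (sym (Vec.zipWith-++ _ s (concat E) t (concat F)))

concat-injective : ∀ {m k} {E F : Vec (Subset m) k} → concat E ≡ concat F → E ≡ F
concat-injective {E = []} {[]} _ = refl
concat-injective {E = s ∷ E} {t ∷ F} eq = cong₂ _∷_ (Vec.++-injectiveˡ s t eq) (concat-injective (Vec.++-injectiveʳ s t eq))

∈-concat⁺ : ∀ {m k} (E : Vec (Subset m) k) {i j} → j ∈ˢ lookup E i → combine i j ∈ˢ concat E
∈-concat⁺ E {i} {j} j∈ = Vec.lookup⇒[]= (combine i j) (concat E) (trans (Vec.lookup-concat E i j) (Vec.[]=⇒lookup j∈))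

∈-concat⁻ : ∀ {m k} (E : Vec (Subset m) k) {i j} → combine i j ∈ˢ concat E → j ∈ˢ lookup E i
∈-concat⁻ E {i} {j} e∈ = Vec.lookup⇒[]= j (lookup E i) (trans (sym (Vec.lookup-concat E i j)) (Vec.[]=⇒lookup e∈))

module _ {n : ℕ} where
  open Trees n

  hasEdge⁺ : ∀ (E : EdgeSet n) {e} → e ∈ˢ concat E → HasEdge E (src e) (tgt e)
  hasEdge⁺ E {e} e∈ = ∈-concat⁻ E (subst (_∈ˢ concat E) (sym (combine-remQuot {n} n e)) e∈)

  WF⇒Ordered : ∀ (E : EdgeSet n) → WF E → Ordered (concat E)
  WF⇒Ordered E wf e∈ = wf _ _ (hasEdge⁺ E e∈)

  Ordered⇒WF : ∀ (E : EdgeSet n) → Ordered (concat E) → WF E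
  Ordered⇒WF E ord i j edge = subst₂ _<ᶠ_ (src-combine i j) (tgt-combine i j) (ord (∈-concat⁺ E edge))

  respects-edge : ∀ (E : EdgeSet n) {ℓ : Labelling n} → Respects ℓ (concat E) → ∀ {i j} → HasEdge E i j → ℓ i ≡ ℓ j
  respects-edge E {ℓ} resp {i} {j} edge = subst₂ (λ a b → ℓ a ≡ ℓ b) (src-combine i j) (tgt-combine i j)
      (resp (∈-concat⁺ E edge))

  respects-walk : ∀ (E : EdgeSet n) {ℓ : Labelling n} → Respects ℓ (concat E) → ∀ {u v} → Walk E u v → ℓ u ≡ ℓ v
  respects-walk E resp here = refl
  respects-walk E resp (step (inj₁ edge) w) = trans (respects-edge E resp edge) (respects-walk E resp w)
  respects-walk E resp (step (inj₂ edge) w) = trans (sym (respects-edge E resp edge)) (respects-walk E resp w)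

  walk-trans : ∀ {E : EdgeSet n} {u v w} → Walk E u v → Walk E v w → Walk E u w
  walk-trans here w = w
  walk-trans (step a p) w = step a (walk-trans p w)

  walk-sym : ∀ {E : EdgeSet n} {u v} → Walk E u v → Walk E v u
  walk-sym here = here
  walk-sym (step a p) = walk-trans (walk-sym p) (step (swap a) here)

  Connected⇒Conn : ∀ (E : EdgeSet n) → Connected E → Conn (concat E)
  Connected⇒Conn E connected ℓ resp u v = respects-walk E resp (connected u v)

  -- Being joined by a walk is an equivalence relation containing the edges, hence contains the
  -- component relation, and `conn` makes the component labelling constant.
  Conn⇒Connected : ∀ (E : EdgeSet n) → Conn (concat E) → Connected E
  Conn⇒Connected E conn u v = components-least (concat E) (Walk E) here walk-sym walk-trans
      (λ e∈ → step (inj₁ (hasEdge⁺ E e∈)) here)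
    (conn (components (concat E)) (λ e∈ → process-joins (edgesOf (concat E)) id (∈-edgesOf e∈)) u v)

  SpanningTree⇒Tree : ∀ (E : EdgeSet n) → IsSpanningTree E → Tree (concat E)
  SpanningTree⇒Tree E (wf , size , connected) = WF⇒Ordered E wf , trans (sym (∣concat∣ E)) size , Connected⇒Conn E connected

  Tree⇒SpanningTree : ∀ (E : EdgeSet n) → Tree (concat E) → IsSpanningTree E
  Tree⇒SpanningTree E (ord , size , conn) = Ordered⇒WF E ord , trans (∣concat∣ E) size , Conn⇒Connected E conn

  ⊆E⇒⊆ : ∀ (E F : EdgeSet n) → E ⊆E F → concat E ⊆ concat F
  ⊆E⇒⊆ E F sub {e} e∈ = subst (_∈ˢ concat F) (combine-remQuot {n} n e) (∈-concat⁺ F (sub (src e) (hasEdge⁺ E e∈)))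

  ⊆⇒⊆E : ∀ (E F : EdgeSet n) → concat E ⊆ concat F → E ⊆E F
  ⊆⇒⊆E E F sub i {j} j∈ = ∈-concat⁻ F (sub (∈-concat⁺ E j∈))

  numEdges-∩E : ∀ (E F : EdgeSet n) → numEdges (E ∩E F) ≡ ∣ concat E ∩ concat F ∣
  numEdges-∩E E F = trans (∣concat∣ (E ∩E F)) (cong ∣_∣ (concat-∩ E F))

  module _ (2≤n : 2 ≤ n) {t : ℕ} (t+2≤n : t + 2 ≤ n) where
    open TreeBounds n 2≤n
    open Size t+2≤n

    PairwiseDisjoint⇒¬Clash : ∀ (S : EdgeSet n) → PairwiseDisjoint S → ¬ (∃ λ e → ∃ λ f → Clash (concat S) e f)
    PairwiseDisjoint⇒¬Clash S disjoint (e , f , e∈ , f∈ , e≢f , share) with disjoint _ _ _ _ (hasEdge⁺ S e∈) (hasEdge⁺ S f∈)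
    ... | inj₁ (p , q) = e≢f (trans (sym (combine-remQuot {n} n e)) (trans (cong₂ combine p q) (combine-remQuot {n} n f)))
    ... | inj₂ (a , b , c , d) = [ a , [ b , [ c , d ]′ ]′ ]′ share

    ¬Clash⇒PairwiseDisjoint : ∀ (S : EdgeSet n) → ¬ (∃ λ e → ∃ λ f → Clash (concat S) e f) → PairwiseDisjoint S
    ¬Clash⇒PairwiseDisjoint S no-clash a b c d ab cd with combine a b ≟ᶠ combine c d
    ... | yes eq = inj₁ (combine-injective a b c d eq)
    ... | no neq = inj₂ (no-share ∘ inj₁ , no-share ∘ inj₂ ∘ inj₁ , no-share ∘ inj₂ ∘ inj₂ ∘ inj₁ , no-share ∘ inj₂ ∘ inj₂ ∘ inj₂)
      where
      no-share : ¬ (a ≡ c ⊎ a ≡ d ⊎ b ≡ c ⊎ b ≡ d)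
      no-share share = no-clash (combine a b , combine c d , ∈-concat⁺ S ab , ∈-concat⁺ S cd , neq , shared share)
        where
        between : ∀ {x x′ y y′ : Fin n} → x ≡ x′ → y ≡ y′ → x′ ≡ y′ → x ≡ y
        between p q eq = trans p (trans eq (sym q))
        shared = Sum.map (between (src-combine a b) (src-combine c d)) (Sum.map (between (src-combine a b) (tgt-combine c d))
          (Sum.map (between (tgt-combine a b) (src-combine c d)) (between (tgt-combine a b) (tgt-combine c d))))

theorem1p4 : (n t : ℕ) → 2 ^ 19 ≤ n → 1 < t → n ^ (4032 * t) ≤ 2 ^ n →
    (𝓕 : List (EdgeSet n)) → IsTIntersectingTreeFamily t 𝓕 →
    (length 𝓕 ≤ 2 ^ t * n ^ (n ∸ t ∸ 2))
    × (length 𝓕 ≡ 2 ^ t * n ^ (n ∸ t ∸ 2) ⇔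
    Σ (EdgeSet n) (λ S → WF S × numEdges S ≡ t × PairwiseDisjoint S
    × ((T : EdgeSet n) → (T ∈ 𝓕 ⇔ (IsSpanningTree T × S ⊆E T)))))
theorem1p4 n t 2¹⁹≤n 1<t small-t 𝓕 (uniq , all-trees , t-int) =
  subst (_≤ M) size-F (proj₁ (extremal F uniq-F trees-F t-int-F)) , mk⇔
    (λ eq → from-star (proj₂ (extremal F uniq-F trees-F t-int-F) (trans size-F eq)))
    (λ (S , wf , size , disjoint , iff) → trans (sym size-F)
        (star-size uniq-F (to-star S wf size disjoint (λ T → Equivalence.to (iff T)) (λ T → Equivalence.from (iff T)))))
  where
  open Main n t 2¹⁹≤n 1<t small-t
  open Trees n
  module B = TreeBounds n Sw.2≤n
  open B.Size {t} t+2≤n using (M; Clash)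
  F = map concat 𝓕
  size-F : length F ≡ length 𝓕
  size-F = List.length-map concat 𝓕
  uniq-F : Unique F
  uniq-F = Unique.map⁺ concat-injective uniq
  trees-F : ∀ {T} → T ∈ F → Tree T
  trees-F T∈ with ∈-map⁻ concat T∈
  ... | E , E∈ , refl = SpanningTree⇒Tree E (all-trees E E∈)
  t-int-F : ∀ {T T′} → T ∈ F → T′ ∈ F → T ≢ T′ → t ≤ ∣ T ∩ T′ ∣
  t-int-F T∈ T′∈ neq with ∈-map⁻ concat T∈ | ∈-map⁻ concat T′∈
  ... | E , E∈ , refl | E′ , E′∈ , refl = subst (t ≤_) (numEdges-∩E E E′) (t-int E E′ E∈ E′∈ (neq ∘ cong concat))
  -- Every subset of the n² indices is the concatenation of an edge set, so conditions over all
  -- subsets and over all edge sets agree.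
  unconcat : ∀ (X : Subset (n * n)) → ∃ λ E → X ≡ concat E
  unconcat X = Vec.group n n X
  from-star : ∃ (Star F) → Σ (EdgeSet n) (λ S → WF S × numEdges S ≡ t × PairwiseDisjoint S
    × ((T : EdgeSet n) → (T ∈ 𝓕 ⇔ (IsSpanningTree T × S ⊆E T))))
  from-star (B , size , ord , no-clash , iff) with unconcat B
  ... | S , refl = S , Ordered⇒WF S ord , trans (∣concat∣ S) size , ¬Clash⇒PairwiseDisjoint Sw.2≤n t+2≤n S no-clash , λ T →
      mk⇔
    (λ T∈ → let tree , S⊆T = proj₁ (iff (concat T)) (∈-map⁺ concat T∈) in Tree⇒SpanningTree T tree , ⊆⇒⊆E S T S⊆T)
    (λ (tree , S⊆T) → let E , E∈ , eq = ∈-map⁻ concat (proj₂ (iff (concat T)) (SpanningTree⇒Tree T tree , ⊆E⇒⊆ S T S⊆T)) in subst (_∈ 𝓕) (sym (concat-injective eq)) E∈)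
  to-star : ∀ S → WF S → numEdges S ≡ t → PairwiseDisjoint S → (∀ T → T ∈ 𝓕 → IsSpanningTree T × S ⊆E T) →
    (∀ T → IsSpanningTree T × S ⊆E T → T ∈ 𝓕) → Star F (concat S)
  to-star S wf size disjoint to from = trans (sym (∣concat∣ S)) size , WF⇒Ordered S wf , PairwiseDisjoint⇒¬Clash Sw.2≤n t+2≤n S disjoint ,
    λ X → members X (unconcat X)
    where
    members : ∀ X → (∃ λ E → X ≡ concat E) → (X ∈ F → Tree X × concat S ⊆ X) × (Tree X × concat S ⊆ X → X ∈ F)
    members _ (T , refl) =
      (λ T∈ → let E , E∈ , eq = ∈-map⁻ concat T∈ ; tree , S⊆T = to T (subst (_∈ 𝓕) (sym (concat-injective eq)) E∈) in SpanningTree⇒Tree T tree , ⊆E⇒⊆ S T S⊆T) ,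
      (λ (tree , S⊆T) → ∈-map⁺ concat (from T (Tree⇒SpanningTree T tree , ⊆⇒⊆E S T S⊆T)))
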